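{- Let $G=(G^{+},G^{ - })$ be a signed graph on a finite vertex set $V_{G}$ and assume that $G^{+}\supseteq G^{ - }$, i.e. every negative edge $\{u,v\}\in E_G^-$ is also a positive edge, $\{u,v\}\in E_G^+$. Then the following are equivalent: (1) $G$ is balanced chordal; (2) the signed-graphic arrangement $\mathcal{A}(G^{+},G^{ - },V_{G})$ (every vertex carries a loop) is free; (3) $\mathcal{A}(G^{+},G^{ - },L)$ is free for some loop set $L\subseteq V_{G}$.
   Context: A signed graph is a triple $G=(G^{+},G^{ - },L_{G})$ where $G^{+}=(V_G,E_G^{+})$ and $G^{ - }=(V_G,E_G^{ - })$ are simple graphs on the same finite vertex set $V_G$ and $L_G\subseteq V_G$ is the set of loops; elements of $E_G^+$ (resp. $E_G^-$) are positive (resp. negative) edges. Writing $(G^+,G^-)$ means loops are not considered. For $V_G=\{1,\dots,\ell\}$, the signed-graphic arrangement $\mathcal{A}(G)$ in $\mathbb{K}^{\ell}$ ($\mathbb{K}$ a field of characteristic zero, e.g. $\mathbb{R}$) consists of the hyperplanes $\{x_i-x_j=0\}$ for $\{i,j\}\in E_G^+$, $\{x_i+x_j=0\}$ for $\{i,j\}\in E_G^-$, and $\{x_i=0\}$ for $i\in L_G$. An arrangement $\mathcal{A}$ is free if its module of logarithmic derivations $D(\mathcal{A})=\{\theta\in\mathrm{Der}(S):\theta(\alpha_H)\in\alpha_H S\ \forall H\in\mathcal{A}\}$ is a free module over the polynomial ring $S=\mathbb{K}[x_1,\dots,x_\ell]$, where $\ker\alpha_H=H$. A cycle of length $k\ge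 3$ is a sequence of distinct vertices $v_1,\dots,v_k$ together with edges $\{v_1,v_2\},\dots,\{v_{k-1},v_k\},\{v_k,v_1\}$, each of which may be positive or negative. A cycle is balanced if it contains an even number of negative edges. A balanced chord of a balanced cycle is an edge of $G$ that is not part of the cycle, connects two vertices of the cycle, and separates the cycle into two balanced cycles. $G$ is balanced chordal if every balanced cycle of length at least four has a balanced chord (this ignores loops). -}

module Defs where

open import Level using (Level; _⊔_)
import Level
open import Algebra.Bundles using (CommutativeRing)
open import Data.Nat using (ℕ; zero; suc; _≤_; _+_; _≤ᵇ_; _<ᵇ_)
open import Data.Nat.DivMod using (_mod_)
open import Data.Nat.Divisibility using (_∣_)
open import Data.Fin using (Fin; toℕ)
open import Data.Fin.Properties using ()
open import Data.Bool using (Bool; true; false; T; _∧_; if_then_else_)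
open import Data.List using (List; []; _∷_; map; allFin)
open import Data.Nat.ListAction using (sum)
open import Data.List.Relation.Unary.All using (All)
open import Data.Product using (Σ; _×_; ∃)
open import Relation.Nullary using (¬_)
open import Relation.Binary.PropositionalEquality using (_≡_)
open import Function.Definitions using (Injective)

-- Signed graphs on the vertex set Fin ℓ (loops are kept separately)

record SignedGraph (ℓ : ℕ) : Set where
  field
    pos  : Fin ℓ → Fin ℓ → Bool
    neg  : Fin ℓ → Fin ℓ → Bool
    pos-sym    : ∀ i j → T (pos i j) → T (pos j i)
    neg-sym    : ∀ i j → T (neg i j) → T (neg j i)
    pos-irrefl : ∀ i → ¬ T (pos i i)
    neg-irrefl : ∀ i → ¬ T (neg i i)
open SignedGraph public

LoopSet : ℕ → Set
LoopSet ℓ = Fin ℓ → Bool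

allLoops : ∀ {ℓ} → LoopSet ℓ
allLoops _ = true

NegInPos : ∀ {ℓ} → SignedGraph ℓ → Set
NegInPos {ℓ} G = ∀ (i j : Fin ℓ) → T (neg G i j) → T (pos G i j)

data Sign : Set where
  plus minus : Sign

Edge : ∀ {ℓ} → SignedGraph ℓ → Sign → Fin ℓ → Fin ℓ → Set
Edge G plus  i j = T (pos G i j)
Edge G minus i j = T (neg G i j)

isMinus : Sign → Bool
isMinus plus  = false
isMinus minus = true

signVal : Sign → ℕ
signVal plus  = 0
signVal minus = 1

nextF : ∀ {m} → Fin (suc m) → Fin (suc m)
nextF {m} i = (suc (toℕ i)) mod (suc m)

record Cycle {ℓ : ℕ} (G : SignedGraph ℓ) : Set where
  field
    m      : ℕ
    len≥3  : 3 ≤ suc m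
    v      : Fin (suc m) → Fin ℓ
    v-inj  : Injective _≡_ _≡_ v
    s      : Fin (suc m) → Sign
    edges  : ∀ i → Edge G (s i) (v i) (v (nextF i))
open Cycle public

len : ∀ {ℓ} {G : SignedGraph ℓ} → Cycle G → ℕ
len C = suc (m C)

negCount : ∀ {ℓ} {G : SignedGraph ℓ} (C : Cycle G) → (Fin (suc (m C)) → Bool) → ℕ
negCount C P = sum (map (λ i → if P i ∧ isMinus (s C i) then 1 else 0) (allFin (suc (m C))))

Balanced : ∀ {ℓ} {G : SignedGraph ℓ} → Cycle G → Set
Balanced C = 2 ∣ negCount C (λ _ → true)

inArc : ∀ {k} → Fin k → Fin k → Fin k → Bool
inArc a b i = (toℕ a ≤ᵇ toℕ i) ∧ (toℕ i <ᵇ toℕ b)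

notB : Bool → Bool
notB true = false
notB false = true

-- A balanced chord: an edge (sign t) of G joining two cycle vertices v a, v b
-- (a < b) which are not consecutive on the cycle (so the edge is not a cycle
-- edge and splits the cycle into two cycles), such that both cycles
--   v a, …, v b, (chord)   and   v b, …, v (k-1), v 0, …, v a, (chord)
-- are balanced.
record BalancedChord {ℓ : ℕ} {G : SignedGraph ℓ} (C : Cycle G) : Set where
  field
    a b     : Fin (suc (m C))
    gap     : toℕ a + 2 ≤ toℕ b
    notWrap : ¬ (toℕ a ≡ 0 × toℕ b ≡ m C)
    t       : Sign
    chord   : Edge G t (v C a) (v C b)
    bal₁    : 2 ∣ (negCount C (inArc a b) + signVal t)
    bal₂    : 2 ∣ (negCount C (λ i → notB (inArc a b i)) + signVal t)

BalancedChordal : ∀ {ℓ} → SignedGraph ℓ → Set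
BalancedChordal G = ∀ (C : Cycle G) → Balanced C → 4 ≤ len C → BalancedChord C

module _ {c ℓ′ : Level} (K : CommutativeRing c ℓ′) where
  open CommutativeRing K using (Carrier; 0#; 1#; _≈_) renaming (_+_ to _+K_; _*_ to _*K_)

  natK : ℕ → Carrier
  natK zero    = 0#
  natK (suc n) = 1# +K natK n

  IsFieldChar0 : Set (c ⊔ ℓ′)
  IsFieldChar0 =
    (¬ (1# ≈ 0#)) ×
    (∀ x → ¬ (x ≈ 0#) → Σ Carrier (λ y → (x *K y) ≈ 1#)) ×
    (∀ n → ¬ (natK (suc n) ≈ 0#))

module Poly {c ℓ′ : Level} (K : CommutativeRing c ℓ′) where
  open CommutativeRing K using (Carrier; 0#; 1#) renaming (_+_ to _+K_; _*_ to _*K_; -_ to -K_; _≈_ to _≈K_)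

  -- Pol (suc n) = polynomials in one further variable (coefficient lists,
  -- lowest degree first) with coefficients in Pol n;  Pol 0 = K.
  data Pol : ℕ → Set c where
    con : Carrier → Pol zero
    lst : ∀ {n} → List (Pol n) → Pol (suc n)

  IsZero : ∀ {n} → Pol n → Set (c ⊔ ℓ′)
  IsZero (con a) = Level.Lift c (a ≈K 0#)
  IsZero (lst p) = All IsZero p

  const : ∀ {n} → Carrier → Pol n
  const {zero}  a = con a
  const {suc n} a = lst (const a ∷ [])

  0P 1P : ∀ {n} → Pol n
  0P = const 0#
  1P = const 1#

  var : ∀ {n} → Fin n → Pol n
  var {suc n} Fin.zero    = lst (0P ∷ 1P ∷ [])
  var {suc n} (Fin.suc i) = lst (var i ∷ [])

  addL : ∀ {n} → (Pol n → Pol n → Pol n) → List (Pol n) → List (Pol n) → List (Pol n)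
  addL f []      q       = q
  addL f (a ∷ p) []      = a ∷ p
  addL f (a ∷ p) (b ∷ q) = f a b ∷ addL f p q

  _+P_ : ∀ {n} → Pol n → Pol n → Pol n
  con a +P con b = con (a +K b)
  lst p +P lst q = lst (addL _+P_ p q)

  -P_ : ∀ {n} → Pol n → Pol n
  -P con a = con (-K a)
  -P lst p = lst (negL p)
    where
    negL : _ → _
    negL []      = []
    negL (a ∷ p) = (-P a) ∷ negL p

  mulL : ∀ {n} → (Pol n → Pol n → Pol n) → List (Pol n) → List (Pol n) → List (Pol n)
  mulL f []      q = []
  mulL f (a ∷ p) q = addL _+P_ (map (f a) q) (0P ∷ mulL f p q)

  _*P_ : ∀ {n} → Pol n → Pol n → Pol n
  con a *P con b = con (a *K b)
  lst p *P lst q = lst (mulL _*P_ p q)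

  _-P_ : ∀ {n} → Pol n → Pol n → Pol n
  p -P q = p +P (-P q)

  infix 4 _≈P_ _∣P_
  _≈P_ : ∀ {n} → Pol n → Pol n → Set (c ⊔ ℓ′)
  p ≈P q = IsZero (p -P q)

  _∣P_ : ∀ {n} → Pol n → Pol n → Set (c ⊔ ℓ′)
  _∣P_ {n} p q = Σ (Pol n) (λ r → q ≈P (p *P r))

  sumP : ∀ {n m} → (Fin m → Pol n) → Pol n
  sumP {m = zero}  f = 0P
  sumP {m = suc m} f = f Fin.zero +P sumP (λ i → f (Fin.suc i))

  -- Derivations θ = Σ θ_i ∂/∂x_i of S = K[x_0,…,x_{ℓ-1}], represented by
  -- their values θ_i = θ(x_i).

  Der : ℕ → Set c
  Der ℓ = Fin ℓ → Pol ℓ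

  -- θ ∈ D(𝒜(G⁺, G⁻, L)):  θ(α_H) ∈ α_H S for every hyperplane H.
  InD : ∀ {ℓ} → SignedGraph ℓ → LoopSet ℓ → Der ℓ → Set (c ⊔ ℓ′)
  InD {ℓ} G L θ =
    (∀ (i j : Fin ℓ) → T (pos G i j) → (var i -P var j) ∣P (θ i -P θ j)) ×
    (∀ (i j : Fin ℓ) → T (neg G i j) → (var i +P var j) ∣P (θ i +P θ j)) ×
    (∀ (i : Fin ℓ) → T (L i) → var i ∣P θ i)

  Free : ∀ {ℓ} → SignedGraph ℓ → LoopSet ℓ → Set (c ⊔ ℓ′)
  Free {ℓ} G L =
    Σ ℕ λ r → Σ (Fin r → Der ℓ) λ B →
      (∀ k → InD G L (B k)) ×
      (∀ θ → InD G L θ →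
         Σ (Fin r → Pol ℓ) λ f → ∀ i → θ i ≈P sumP (λ k → f k *P B k i)) ×
      (∀ (f : Fin r → Pol ℓ) →
         (∀ i → IsZero (sumP (λ k → f k *P B k i))) → ∀ k → IsZero (f k))

-- Dividing the i-th value of a logarithmic derivation of 𝒜(G⁺, G⁻, V) by x_i
-- identifies the module with the splines g on the vertices: x_i - s x_j divides
-- g_i - g_j for every edge ij of sign s.  If G is balanced chordal, the vertex set is
-- taken apart by eliminating simplicial vertices (where Newton interpolation extends
-- splines), by splitting along minimal separators (which are cliques), and by
-- exchanging one vertex of a clique all of whose pairs are negative edges; each step
-- carries a basis along.
--
-- Conversely, a balanced cycle without balanced chord has, in suitable signed
-- coordinates, the edge forms z_i = y_i - y_{i+1}, and at a generic point of their
-- common zero set no other hyperplane of the arrangement matters.  Up to a factor Q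
-- that does not vanish there, the derivations M₁ = (0 , -z₁z₂), M₂ = (z₀z₂ , z₀z₂),
-- M₃ = (-z₀z₁ , 0) in the directions y₁, y₂ are logarithmic, and
-- z₀ M₁ + z₁ M₂ + z₂ M₃ = 0.  Since z₀, z₁, z₂ is a regular sequence, freeness would
-- give Q M₃ = z₀ N₀ + z₁ N₁ with N₀, N₁ logarithmic; comparing the quotients of the
-- values of N₁ along the edges of a cycle of length at least four shows Q = 0 at the
-- generic point.

module Submission where

open import Defs
open import Level using (Level)
open import Algebra.Bundles using (CommutativeRing)
open import Data.Nat using (ℕ)
open import Data.Product using (Σ; _×_; _,_)
open import Function.Bundles using (_⇔_; mk⇔)

-- Bases add up along `C ⊆ W` only when every spline on `C` extends to `W`, so the induction is over
-- pairs of a vertex set `W` and a clique `C` in it. The obstacle is a negative path outside `C`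
-- between two vertices of `C` that have no negative edge; a clique without such paths is called
-- calm. Since every negative edge lies over a positive one, a minimal separator `K` is a positive
-- clique, but it may fail to be calm towards one of its sides. Chords of balanced cycles show that
-- it cannot fail towards both, and a calm side is split off first. If `C` reaches into that side,
-- all pairs of `C` turn out to be negative edges, and its vertex there is exchanged for a vertex of
-- `K`. In the converse, the factor `Q` also contains every `x_i`, so the derivations are
-- logarithmic for each loop set, and one cycle refutes freeness for all of them. Equality in the
-- field is not assumed decidable, so cancellation rests on non-zero-divisors and on substitutions
-- that act as reduction modulo a linear form.

module Signs where
  open import Data.Fin using (Fin)
  open import Data.Sum using (_⊎_; inj₁; inj₂)
  open import Relation.Nullary using (Dec)
  open import Relation.Nullary.Decidable using (map′; _⊎-dec_)
  open import Relation.Binary.PropositionalEquality using (_≡_; _≢_; refl)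

  infixl 7 _·_
  _·_ : Sign → Sign → Sign
  plus · t = t
  minus · plus = minus
  minus · minus = plus

  ·-identityʳ : ∀ s → s · plus ≡ s
  ·-identityʳ plus = refl
  ·-identityʳ minus = refl

  ·-comm : ∀ s t → s · t ≡ t · s
  ·-comm plus plus = refl
  ·-comm plus minus = refl
  ·-comm minus plus = refl
  ·-comm minus minus = refl

  ·-assoc : ∀ s t u → (s · t) · u ≡ s · (t · u)
  ·-assoc plus t u = refl
  ·-assoc minus plus u = refl
  ·-assoc minus minus plus = refl
  ·-assoc minus minus minus = refl

  ·-self : ∀ s → s · s ≡ plus
  ·-self plus = refl
  ·-self minus = refl

  ·≡plus⇒≡ : ∀ s t → s · t ≡ plus → s ≡ t
  ·≡plus⇒≡ plus plus _ = refl
  ·≡plus⇒≡ minus minus _ = refl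

  ·≡minus : ∀ s t → s · t ≡ minus → s ≡ minus ⊎ t ≡ minus
  ·≡minus plus t h = inj₂ h
  ·≡minus minus t h = inj₁ refl

  ≢⇒·≡minus : ∀ {s t} → s ≢ t → s · t ≡ minus
  ≢⇒·≡minus {plus} {plus} h with () ← h refl
  ≢⇒·≡minus {plus} {minus} h = refl
  ≢⇒·≡minus {minus} {plus} h = refl
  ≢⇒·≡minus {minus} {minus} h with () ← h refl

  anySign? : ∀ {P : Sign → Set} → (∀ s → Dec (P s)) → Dec (Σ Sign P)
  anySign? P? = map′ (λ { (inj₁ p) → plus , p ; (inj₂ p) → minus , p }) (λ { (plus , p) → inj₁ p ; (minus , p) → inj₂ p })
    (P? plus ⊎-dec P? minus)

  -- The root (u , s) stands for the linear form s x_u.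
  Root : ℕ → Set
  Root ℓ = Fin ℓ × Sign

-- Coefficient lists form a commutative ring.

module PolynomialArithmetic where
  open import Level using (_⊔_; lift)
  open import Algebra.Structures using (IsCommutativeRing)
  open import Data.Nat using (zero; suc)
  open import Data.List using (List; []; _∷_; map)
  open import Data.List.Relation.Unary.All using (All; []; _∷_)
  open import Relation.Binary.PropositionalEquality using (_≡_; refl; cong)
  import Relation.Binary.PropositionalEquality as ≡
  import Algebra.Properties.Ring as RingProperties
  import Algebra.Properties.CommutativeSemigroup as CommutativeSemigroupProperties
  import Relation.Binary.Reasoning.Setoid as SetoidReasoning

  module PolynomialRing {c ℓ′ : Level} (K : CommutativeRing c ℓ′) where
    open Poly K
    private module K = CommutativeRing K

    unlst : ∀ {n} → Pol (suc n) → List (Pol n)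
    unlst (lst p) = p

    -- The negation of coefficient lists in Defs is a local function that also
    -- depends on the whole list w; negL-map abstracts from w, its type is inferred
    -- from the use in neg-tail.
    mutual
      neg-tail : ∀ {n} (a : Pol n) (p : List (Pol n)) → unlst (-P lst (a ∷ p)) ≡ map -P_ (a ∷ p)
      neg-tail a p with a ∷ p
      ... | w = cong ((-P a) ∷_) (negL-map w p)

      negL-map : ∀ {n} (w q : List (Pol n)) → _
      negL-map w [] = refl
      negL-map w (b ∷ q) = cong ((-P b) ∷_) (negL-map w q)

    -P-lst : ∀ {n} (p : List (Pol n)) → -P lst p ≡ lst (map -P_ p)
    -P-lst [] = refl
    -P-lst (a ∷ p) = cong lst (neg-tail a p)

    -- The two conversions with `IsZero` belong to the inductive hypothesis: equality one level up
    -- is `IsZero` of all coefficients of a difference, and has to be read as coefficientwise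
    -- equality.
    record PolRing (n : ℕ) : Set (c ⊔ ℓ′) where
      field
        isCommutativeRing : IsCommutativeRing (_≈P_ {n}) _+P_ _*P_ -P_ 0P 1P
        IsZero⇒≈0 : ∀ {p : Pol n} → IsZero p → p ≈P 0P
        ≈0⇒IsZero : ∀ {p : Pol n} → p ≈P 0P → IsZero p

      commutativeRing : CommutativeRing c (c ⊔ ℓ′)
      commutativeRing = record { isCommutativeRing = isCommutativeRing }

    polRing-zero : PolRing zero
    polRing-zero = record
      { isCommutativeRing = record
        { isRing = record
          { +-isAbelianGroup = record
            { isGroup = record
              { isMonoid = record
                { isSemigroup = record
                  { isMagma = record
                    { isEquivalence = record
                      { refl = λ { {con a} → to K.refl }
                      ; sym = λ { {con a} {con b} p → to (K.sym (from p)) }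
                      ; trans = λ { {con a} {con b} {con d} p q → to (K.trans (from p) (from q)) } }
                    ; ∙-cong = λ { {con a} {con b} {con d} {con e} p q → to (K.+-cong (from p) (from q)) } }
                  ; assoc = λ { (con a) (con b) (con d) → to (K.+-assoc a b d) } }
                ; identity = (λ { (con a) → to (K.+-identityˡ a) }) , (λ { (con a) → to (K.+-identityʳ a) }) }
              ; inverse = (λ { (con a) → to (K.-‿inverseˡ a) }) , (λ { (con a) → to (K.-‿inverseʳ a) })
              ; ⁻¹-cong = λ { {con a} {con b} p → to (K.-‿cong (from p)) } }
            ; comm = λ { (con a) (con b) → to (K.+-comm a b) } }
          ; *-cong = λ { {con a} {con b} {con d} {con e} p q → to (K.*-cong (from p) (from q)) }
          ; *-assoc = λ { (con a) (con b) (con d) → to (K.*-assoc a b d) }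
          ; *-identity = (λ { (con a) → to (K.*-identityˡ a) }) , (λ { (con a) → to (K.*-identityʳ a) })
          ; distrib = (λ { (con a) (con b) (con d) → to (K.distribˡ a b d) })
                    , (λ { (con a) (con b) (con d) → to (K.distribʳ a b d) }) }
        ; *-comm = λ { (con a) (con b) → to (K.*-comm a b) } }
      ; IsZero⇒≈0 = λ { {con a} (lift p) → to p }
      ; ≈0⇒IsZero = λ { {con a} p → lift (from p) } }
      where
      module RP = RingProperties K.ring

      to : ∀ {a b} → a K.≈ b → con a ≈P con b
      to {a} {b} p = lift (K.trans (K.+-congʳ p) (K.-‿inverseʳ b))

      from : ∀ {a b} → con a ≈P con b → a K.≈ b
      from {a} {b} (lift p) = RP.x∙y⁻¹≈ε⇒x≈y a b p

    module PolRing-suc {n : ℕ} (R : PolRing n) where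
      open PolRing R using (IsZero⇒≈0; ≈0⇒IsZero)
      private
        module R = CommutativeRing (PolRing.commutativeRing R)
        module RP = RingProperties R.ring
        module +P = CommutativeSemigroupProperties R.+-commutativeSemigroup
      open SetoidReasoning R.setoid

      L : Set c
      L = List (Pol n)

      coef : L → ℕ → Pol n
      coef [] _ = 0P
      coef (a ∷ p) zero = a
      coef (a ∷ p) (suc k) = coef p k

      infixl 6 _⊕_
      _⊕_ _⊗_ : L → L → L
      p ⊕ q = addL _+P_ p q
      p ⊗ q = mulL _*P_ p q

      infix 4 _≋_
      -- Lists that differ by trailing zeros are the same polynomial, so the ring laws are checked
      -- on coefficient functions, which are total.
      _≋_ : L → L → Set (c ⊔ ℓ′)
      p ≋ q = ∀ k → coef p k R.≈ coef q k

      coef-⊕ : ∀ p q k → coef (p ⊕ q) k R.≈ coef p k R.+ coef q k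
      coef-⊕ [] q k = R.sym (R.+-identityˡ _)
      coef-⊕ (a ∷ p) [] k = R.sym (R.+-identityʳ _)
      coef-⊕ (a ∷ p) (b ∷ q) zero = R.refl
      coef-⊕ (a ∷ p) (b ∷ q) (suc k) = coef-⊕ p q k

      coef-neg : ∀ p k → coef (map -P_ p) k R.≈ R.- coef p k
      coef-neg [] k = R.sym RP.-0#≈0#
      coef-neg (a ∷ p) zero = R.refl
      coef-neg (a ∷ p) (suc k) = coef-neg p k

      coef-scale : ∀ a p k → coef (map (a *P_) p) k R.≈ a R.* coef p k
      coef-scale a [] k = R.sym (R.zeroʳ a)
      coef-scale a (b ∷ p) zero = R.refl
      coef-scale a (b ∷ p) (suc k) = coef-scale a p k

      All⇒coef : ∀ {p} → All IsZero p → ∀ k → coef p k R.≈ 0P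
      All⇒coef [] k = R.refl
      All⇒coef (z ∷ zs) zero = IsZero⇒≈0 z
      All⇒coef (z ∷ zs) (suc k) = All⇒coef zs k

      coef⇒All : ∀ p → (∀ k → coef p k R.≈ 0P) → All IsZero p
      coef⇒All [] h = []
      coef⇒All (a ∷ p) h = ≈0⇒IsZero (h zero) ∷ coef⇒All p (λ k → h (suc k))

      coef-minus : ∀ p q k → coef (p ⊕ map -P_ q) k R.≈ coef p k R.- coef q k
      coef-minus p q k = R.trans (coef-⊕ p (map -P_ q) k) (R.+-congˡ (coef-neg q k))

      ≋⇒≈ : ∀ {p q} → p ≋ q → lst p ≈P lst q
      ≋⇒≈ {p} {q} h = ≡.subst (λ u → IsZero (lst p +P u)) (≡.sym (-P-lst q)) (coef⇒All _ λ k →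
        R.trans (coef-minus p q k) (R.trans (R.+-congʳ (h k)) (R.-‿inverseʳ _)))

      ≈⇒≋ : ∀ {p q} → lst p ≈P lst q → p ≋ q
      ≈⇒≋ {p} {q} z k = RP.x∙y⁻¹≈ε⇒x≈y _ _
        (R.trans (R.sym (coef-minus p q k))
          (All⇒coef (≡.subst (λ u → IsZero (lst p +P u)) (-P-lst q) z) k))

      ≋-trans : ∀ {p q r} → p ≋ q → q ≋ r → p ≋ r
      ≋-trans h h′ k = R.trans (h k) (h′ k)

      ≋-sym : ∀ {p q} → p ≋ q → q ≋ p
      ≋-sym h k = R.sym (h k)

      ⊕-cong : ∀ {p p′ q q′} → p ≋ p′ → q ≋ q′ → p ⊕ q ≋ p′ ⊕ q′
      ⊕-cong {p} {p′} {q} {q′} h h′ k = begin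
        coef (p ⊕ q) k ≈⟨ coef-⊕ p q k ⟩
        coef p k R.+ coef q k ≈⟨ R.+-cong (h k) (h′ k) ⟩
        coef p′ k R.+ coef q′ k ≈⟨ coef-⊕ p′ q′ k ⟨
        coef (p′ ⊕ q′) k ∎

      ∷-cong : ∀ {a b p q} → a R.≈ b → p ≋ q → (a ∷ p) ≋ (b ∷ q)
      ∷-cong h h′ zero = h
      ∷-cong h h′ (suc k) = h′ k

      scale-cong : ∀ {a b p q} → a R.≈ b → p ≋ q → map (a *P_) p ≋ map (b *P_) q
      scale-cong {a} {b} {p} {q} h h′ k =
        R.trans (coef-scale a p k) (R.trans (R.*-cong h (h′ k)) (R.sym (coef-scale b q k)))

      ⊗-congˡ : ∀ p {q q′} → q ≋ q′ → p ⊗ q ≋ p ⊗ q′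
      ⊗-congˡ [] h k = R.refl
      ⊗-congˡ (a ∷ p) {q} {q′} h = ⊕-cong {map (a *P_) q} {map (a *P_) q′} {0P ∷ (p ⊗ q)} {0P ∷ (p ⊗ q′)}
        (scale-cong {a} {a} {q} {q′} R.refl h)
        (∷-cong {0P} {0P} {p ⊗ q} {p ⊗ q′} R.refl (⊗-congˡ p {q} {q′} h))

      coef-⊗ : ∀ a p q k → coef ((a ∷ p) ⊗ q) k R.≈ (a R.* coef q k) R.+ coef (0P ∷ (p ⊗ q)) k
      coef-⊗ a p q k = R.trans (coef-⊕ (map (a *P_) q) _ k) (R.+-congʳ (coef-scale a q k))

      -- `mulL` recurses on its left factor; this is the mirror image on the right, from which
      -- commutativity follows by one induction.
      ⊗-∷ʳ : ∀ p b q k → coef (p ⊗ (b ∷ q)) k R.≈ (b R.* coef p k) R.+ coef (0P ∷ (p ⊗ q)) k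
      ⊗-∷ʳ [] b q k = R.sym (R.trans (R.+-cong (R.zeroʳ b) (zz k)) (R.+-identityˡ _))
        where
        zz : ∀ k → coef (0P ∷ []) k R.≈ 0P
        zz zero = R.refl
        zz (suc k) = R.refl
      ⊗-∷ʳ (a ∷ p) b q zero = R.+-congʳ (R.*-comm a b)
      ⊗-∷ʳ (a ∷ p) b q (suc k) = begin
        coef ((a ∷ p) ⊗ (b ∷ q)) (suc k) ≈⟨ coef-⊗ a p (b ∷ q) (suc k) ⟩
        (a R.* coef q k) R.+ coef (p ⊗ (b ∷ q)) k ≈⟨ R.+-congˡ (⊗-∷ʳ p b q k) ⟩
        (a R.* coef q k) R.+ ((b R.* coef p k) R.+ coef (0P ∷ (p ⊗ q)) k) ≈⟨ +P.x∙yz≈y∙xz _ _ _ ⟩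
        (b R.* coef p k) R.+ ((a R.* coef q k) R.+ coef (0P ∷ (p ⊗ q)) k) ≈⟨ R.+-congˡ (coef-⊗ a p q k) ⟨
        (b R.* coef p k) R.+ coef ((a ∷ p) ⊗ q) k ∎

      ⊗-zeroʳ : ∀ p → p ⊗ [] ≋ []
      ⊗-zeroʳ [] k = R.refl
      ⊗-zeroʳ (a ∷ p) zero = R.refl
      ⊗-zeroʳ (a ∷ p) (suc k) = ⊗-zeroʳ p k

      ⊗-comm : ∀ p q → p ⊗ q ≋ q ⊗ p
      ⊗-comm [] q k = R.sym (⊗-zeroʳ q k)
      ⊗-comm (a ∷ p) q k = begin
        coef ((a ∷ p) ⊗ q) k ≈⟨ coef-⊗ a p q k ⟩
        (a R.* coef q k) R.+ coef (0P ∷ (p ⊗ q)) k ≈⟨ R.+-congˡ (∷-cong R.refl (⊗-comm p q) k) ⟩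
        (a R.* coef q k) R.+ coef (0P ∷ (q ⊗ p)) k ≈⟨ ⊗-∷ʳ q a p k ⟨
        coef (q ⊗ (a ∷ p)) k ∎

      -- Commutativity brings each factor to the right-hand position, where congruence is an
      -- induction on the factor that stays fixed.
      ⊗-cong : ∀ {p p′ q q′} → p ≋ p′ → q ≋ q′ → p ⊗ q ≋ p′ ⊗ q′
      ⊗-cong {p} {p′} {q} {q′} h h′ k = begin
        coef (p ⊗ q) k ≈⟨ ⊗-congˡ p {q} {q′} h′ k ⟩
        coef (p ⊗ q′) k ≈⟨ ⊗-comm p q′ k ⟩
        coef (q′ ⊗ p) k ≈⟨ ⊗-congˡ q′ {p} {p′} h k ⟩
        coef (q′ ⊗ p′) k ≈⟨ ⊗-comm q′ p′ k ⟩
        coef (p′ ⊗ q′) k ∎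

      ⊗-distribˡ : ∀ p q r → p ⊗ (q ⊕ r) ≋ (p ⊗ q) ⊕ (p ⊗ r)
      ⊗-distribˡ [] q r k = R.refl
      ⊗-distribˡ (a ∷ p) q r k = begin
        coef ((a ∷ p) ⊗ (q ⊕ r)) k
          ≈⟨ coef-⊗ a p (q ⊕ r) k ⟩
        (a R.* coef (q ⊕ r) k) R.+ coef (0P ∷ (p ⊗ (q ⊕ r))) k
          ≈⟨ R.+-cong (R.trans (R.*-congˡ (coef-⊕ q r k)) (R.distribˡ a _ _)) (shift k) ⟩
        (a R.* coef q k R.+ a R.* coef r k) R.+ (coef (0P ∷ (p ⊗ q)) k R.+ coef (0P ∷ (p ⊗ r)) k)
          ≈⟨ +P.interchange _ _ _ _ ⟩
        (a R.* coef q k R.+ coef (0P ∷ (p ⊗ q)) k) R.+ (a R.* coef r k R.+ coef (0P ∷ (p ⊗ r)) k)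
          ≈⟨ R.+-cong (coef-⊗ a p q k) (coef-⊗ a p r k) ⟨
        coef ((a ∷ p) ⊗ q) k R.+ coef ((a ∷ p) ⊗ r) k
          ≈⟨ coef-⊕ ((a ∷ p) ⊗ q) ((a ∷ p) ⊗ r) k ⟨
        coef (((a ∷ p) ⊗ q) ⊕ ((a ∷ p) ⊗ r)) k ∎
        where
        shift : ∀ k → coef (0P ∷ (p ⊗ (q ⊕ r))) k R.≈ coef (0P ∷ (p ⊗ q)) k R.+ coef (0P ∷ (p ⊗ r)) k
        shift zero = R.sym (R.+-identityˡ _)
        shift (suc k) = R.trans (⊗-distribˡ p q r k) (coef-⊕ (p ⊗ q) (p ⊗ r) k)

      ⊗-distribʳ : ∀ p q r → (q ⊕ r) ⊗ p ≋ (q ⊗ p) ⊕ (r ⊗ p)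
      ⊗-distribʳ p q r k = begin
        coef ((q ⊕ r) ⊗ p) k ≈⟨ ⊗-comm (q ⊕ r) p k ⟩
        coef (p ⊗ (q ⊕ r)) k ≈⟨ ⊗-distribˡ p q r k ⟩
        coef ((p ⊗ q) ⊕ (p ⊗ r)) k
          ≈⟨ ⊕-cong {p ⊗ q} {q ⊗ p} {p ⊗ r} {r ⊗ p} (⊗-comm p q) (⊗-comm p r) k ⟩
        coef ((q ⊗ p) ⊕ (r ⊗ p)) k ∎

      scale-⊗ : ∀ a p q k → coef (map (a *P_) p ⊗ q) k R.≈ a R.* coef (p ⊗ q) k
      scale-⊗ a [] q k = R.sym (R.zeroʳ a)
      scale-⊗ a (b ∷ p) q k = begin
        coef (((a R.* b) ∷ map (a *P_) p) ⊗ q) k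
          ≈⟨ coef-⊗ (a R.* b) (map (a *P_) p) q k ⟩
        ((a R.* b) R.* coef q k) R.+ coef (0P ∷ (map (a *P_) p ⊗ q)) k
          ≈⟨ R.+-cong (R.*-assoc a b _) (shift k) ⟩
        (a R.* (b R.* coef q k)) R.+ a R.* coef (0P ∷ (p ⊗ q)) k
          ≈⟨ R.distribˡ a _ _ ⟨
        a R.* ((b R.* coef q k) R.+ coef (0P ∷ (p ⊗ q)) k)
          ≈⟨ R.*-congˡ (coef-⊗ b p q k) ⟨
        a R.* coef ((b ∷ p) ⊗ q) k ∎
        where
        shift : ∀ k → coef (0P ∷ (map (a *P_) p ⊗ q)) k R.≈ a R.* coef (0P ∷ (p ⊗ q)) k
        shift zero = R.sym (R.zeroʳ a)
        shift (suc k) = scale-⊗ a p q k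

      0∷-⊗ : ∀ p q → (0P ∷ p) ⊗ q ≋ 0P ∷ (p ⊗ q)
      0∷-⊗ p q k = R.trans (coef-⊗ 0P p q k) (R.trans (R.+-congʳ (R.zeroˡ _)) (R.+-identityˡ _))

      ⊗-assoc : ∀ p q r → (p ⊗ q) ⊗ r ≋ p ⊗ (q ⊗ r)
      ⊗-assoc [] q r k = R.refl
      ⊗-assoc (a ∷ p) q r k = begin
        coef ((map (a *P_) q ⊕ (0P ∷ (p ⊗ q))) ⊗ r) k
          ≈⟨ ⊗-distribʳ r (map (a *P_) q) (0P ∷ (p ⊗ q)) k ⟩
        coef ((map (a *P_) q ⊗ r) ⊕ ((0P ∷ (p ⊗ q)) ⊗ r)) k
          ≈⟨ coef-⊕ (map (a *P_) q ⊗ r) _ k ⟩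
        coef (map (a *P_) q ⊗ r) k R.+ coef ((0P ∷ (p ⊗ q)) ⊗ r) k
          ≈⟨ R.+-cong (scale-⊗ a q r k) (R.trans (0∷-⊗ (p ⊗ q) r k) (∷-cong R.refl (⊗-assoc p q r) k)) ⟩
        a R.* coef (q ⊗ r) k R.+ coef (0P ∷ (p ⊗ (q ⊗ r))) k
          ≈⟨ coef-⊗ a p (q ⊗ r) k ⟨
        coef ((a ∷ p) ⊗ (q ⊗ r)) k ∎

      ⊗-identityˡ : ∀ p → (1P ∷ []) ⊗ p ≋ p
      ⊗-identityˡ p k = R.trans (coef-⊗ 1P [] p k) (R.trans (R.+-cong (R.*-identityˡ _) (zz k)) (R.+-identityʳ _))
        where
        zz : ∀ k → coef (0P ∷ []) k R.≈ 0P
        zz zero = R.refl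
        zz (suc k) = R.refl

      0≋[] : (0P ∷ []) ≋ []
      0≋[] zero = R.refl
      0≋[] (suc k) = R.refl

      ⊕-identityʳ : ∀ p → p ⊕ (0P ∷ []) ≋ p
      ⊕-identityʳ p k = R.trans (coef-⊕ p _ k) (R.trans (R.+-congˡ (0≋[] k)) (R.+-identityʳ _))

      ⊕-comm : ∀ p q → p ⊕ q ≋ q ⊕ p
      ⊕-comm p q k = R.trans (coef-⊕ p q k) (R.trans (R.+-comm _ _) (R.sym (coef-⊕ q p k)))

      ⊕-assoc : ∀ p q r → (p ⊕ q) ⊕ r ≋ p ⊕ (q ⊕ r)
      ⊕-assoc p q r k = begin
        coef ((p ⊕ q) ⊕ r) k ≈⟨ coef-⊕ (p ⊕ q) r k ⟩
        coef (p ⊕ q) k R.+ coef r k ≈⟨ R.+-congʳ (coef-⊕ p q k) ⟩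
        (coef p k R.+ coef q k) R.+ coef r k ≈⟨ R.+-assoc _ _ _ ⟩
        coef p k R.+ (coef q k R.+ coef r k) ≈⟨ R.+-congˡ (coef-⊕ q r k) ⟨
        coef p k R.+ coef (q ⊕ r) k ≈⟨ coef-⊕ p (q ⊕ r) k ⟨
        coef (p ⊕ (q ⊕ r)) k ∎

      ⊕-inverseʳ : ∀ p → p ⊕ map -P_ p ≋ 0P ∷ []
      ⊕-inverseʳ p k = R.trans (coef-minus p p k) (R.trans (R.-‿inverseʳ _) (R.sym (0≋[] k)))

      neg-cong : ∀ {p q} → p ≋ q → map -P_ p ≋ map -P_ q
      neg-cong {p} {q} h k = R.trans (coef-neg p k) (R.trans (R.-‿cong (h k)) (R.sym (coef-neg q k)))

      ≈-refl′ : ∀ {p : Pol (suc n)} → p ≈P p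
      ≈-refl′ {lst p} = ≋⇒≈ {p} {p} (λ k → R.refl)

      polRing-suc : PolRing (suc n)
      polRing-suc = record
        { isCommutativeRing = record
          { isRing = record
            { +-isAbelianGroup = record
              { isGroup = record
                { isMonoid = record
                  { isSemigroup = record
                    { isMagma = record
                      { isEquivalence = record
                        { refl = λ {p} → ≈-refl′ {p}
                        ; sym = λ { {lst p} {lst q} h → ≋⇒≈ {q} {p} (≋-sym {p} {q} (≈⇒≋ {p} {q} h)) }
                        ; trans = λ { {lst p} {lst q} {lst r} → tr {p} {q} {r} } }
                      ; ∙-cong = λ { {lst p} {lst p′} {lst q} {lst q′} h h′ →
                          ≋⇒≈ {p ⊕ q} {p′ ⊕ q′} (⊕-cong {p} {p′} {q} {q′} (≈⇒≋ {p} {p′} h) (≈⇒≋ {q} {q′} h′)) } }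
                    ; assoc = λ { (lst p) (lst q) (lst r) → ≋⇒≈ {(p ⊕ q) ⊕ r} {p ⊕ (q ⊕ r)} (⊕-assoc p q r) } }
                  ; identity =
                      (λ { (lst p) → ≋⇒≈ {(0P ∷ []) ⊕ p} {p} (λ k → R.trans (⊕-comm (0P ∷ []) p k) (⊕-identityʳ p k)) })
                    , (λ { (lst p) → ≋⇒≈ {p ⊕ (0P ∷ [])} {p} (⊕-identityʳ p) }) }
                ; inverse =
                    (λ { (lst p) → inv p (λ u → u +P lst p) (≋⇒≈ {map -P_ p ⊕ p} {0P ∷ []}
                        (λ k → R.trans (⊕-comm (map -P_ p) p k) (⊕-inverseʳ p k))) })
                  , (λ { (lst p) → inv p (λ u → lst p +P u) (≋⇒≈ {p ⊕ map -P_ p} {0P ∷ []} (⊕-inverseʳ p)) })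
                ; ⁻¹-cong = λ { {lst p} {lst q} h →
                    ≡.subst₂ _≈P_ (≡.sym (-P-lst p)) (≡.sym (-P-lst q))
                      (≋⇒≈ {map -P_ p} {map -P_ q} (neg-cong {p} {q} (≈⇒≋ {p} {q} h))) } }
              ; comm = λ { (lst p) (lst q) → ≋⇒≈ {p ⊕ q} {q ⊕ p} (⊕-comm p q) } }
            ; *-cong = λ { {lst p} {lst p′} {lst q} {lst q′} h h′ →
                ≋⇒≈ {p ⊗ q} {p′ ⊗ q′} (⊗-cong {p} {p′} {q} {q′} (≈⇒≋ {p} {p′} h) (≈⇒≋ {q} {q′} h′)) }
            ; *-assoc = λ { (lst p) (lst q) (lst r) → ≋⇒≈ {(p ⊗ q) ⊗ r} {p ⊗ (q ⊗ r)} (⊗-assoc p q r) }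
            ; *-identity =
                (λ { (lst p) → ≋⇒≈ {(1P ∷ []) ⊗ p} {p} (⊗-identityˡ p) })
              , (λ { (lst p) → ≋⇒≈ {p ⊗ (1P ∷ [])} {p}
                    (λ k → R.trans (⊗-comm p (1P ∷ []) k) (⊗-identityˡ p k)) })
            ; distrib =
                (λ { (lst p) (lst q) (lst r) → ≋⇒≈ {p ⊗ (q ⊕ r)} {(p ⊗ q) ⊕ (p ⊗ r)} (⊗-distribˡ p q r) })
              , (λ { (lst p) (lst q) (lst r) → ≋⇒≈ {(q ⊕ r) ⊗ p} {(q ⊗ p) ⊕ (r ⊗ p)} (⊗-distribʳ p q r) }) }
          ; *-comm = λ { (lst p) (lst q) → ≋⇒≈ {p ⊗ q} {q ⊗ p} (⊗-comm p q) } }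
        ; IsZero⇒≈0 = λ { {lst p} z → ≋⇒≈ {p} {0P ∷ []} (λ k → R.trans (All⇒coef z k) (R.sym (0≋[] k))) }
        ; ≈0⇒IsZero = λ { {lst p} h → coef⇒All p (λ k → R.trans (≈⇒≋ {p} {0P ∷ []} h k) (0≋[] k)) } }
        where
        tr : ∀ {p q r} → lst p ≈P lst q → lst q ≈P lst r → lst p ≈P lst r
        tr {p} {q} {r} h h′ = ≋⇒≈ {p} {r} (≋-trans {p} {q} {r} (≈⇒≋ {p} {q} h) (≈⇒≋ {q} {r} h′))

        inv : ∀ p (f : Pol (suc n) → Pol (suc n)) → f (lst (map -P_ p)) ≈P 0P → f (-P lst p) ≈P 0P
        inv p f h = ≡.subst (λ u → f u ≈P 0P) (≡.sym (-P-lst p)) h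

    polRing : ∀ n → PolRing n
    polRing zero = polRing-zero
    polRing (suc n) = PolRing-suc.polRing-suc (polRing n)

-- Ring solver, divisibility, non-zero-divisors and homomorphisms.

module RingTools where
  open import Level using (_⊔_)
  open import Data.Nat as ℕ using (zero; suc)
  open import Data.Fin using (Fin)
  import Data.Fin as Fin
  open import Data.Integer using (ℤ; -[1+_]; _⊖_; _◃_; ∣_∣; sign) renaming (+_ to posℤ)
  import Data.Integer as ℤ
  import Data.Integer.Properties as ℤ
  import Data.Sign as Sgn
  open import Data.List using (List; []; _∷_)
  open import Data.Maybe using (Maybe; just; nothing)
  open import Relation.Nullary using (yes; no)
  open import Relation.Binary.PropositionalEquality using (_≡_; refl; cong)
  import Relation.Binary.PropositionalEquality as ≡
  import Algebra.Properties.Ring as RingProperties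
  import Algebra.Properties.Semiring.Mult as SemiringMult
  import Algebra.Solver.Ring as RingSolver
  open import Algebra.Solver.Ring.AlmostCommutativeRing using (fromCommutativeRing; _-Raw-AlmostCommutative⟶_)
  import Relation.Binary.Reasoning.Setoid as SetoidReasoning

  -- Equality in `R` need not be decidable, so the solver normalises with coefficients in ℤ, whose
  -- equality is, and maps them to `R`.
  module IntegerSolver {a b : Level} (R : CommutativeRing a b) where
    open CommutativeRing R renaming (refl to ≈-refl; sym to ≈-sym; trans to ≈-trans)
    open RingProperties ring using (-‿involutive; -0#≈0#; -‿+-comm; -1*x≈-x)
    open SemiringMult semiring using (×-homo-+; ×1-homo-*) renaming (_×_ to _×ⁿ_)
    open SetoidReasoning setoid

    fromℤ : ℤ → Carrier
    fromℤ (posℤ n) = n ×ⁿ 1#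
    fromℤ -[1+ n ] = - (suc n ×ⁿ 1#)

    private
      ⟨_⟩ : ℕ → Carrier
      ⟨ n ⟩ = n ×ⁿ 1#

      neg-homo : ∀ i → fromℤ (ℤ.- i) ≈ - fromℤ i
      neg-homo (posℤ zero) = ≈-sym -0#≈0#
      neg-homo (posℤ (suc n)) = ≈-refl
      neg-homo -[1+ n ] = ≈-sym (-‿involutive _)

      cancel-1 : ∀ x y → (1# + x) - (1# + y) ≈ x - y
      cancel-1 x y = begin
        (1# + x) - (1# + y) ≈⟨ +-cong (+-comm 1# x) (≈-sym (-‿+-comm 1# y)) ⟩
        (x + 1#) + (- 1# - y) ≈⟨ +-assoc x 1# _ ⟩
        x + (1# + (- 1# - y)) ≈⟨ +-congˡ (≈-sym (+-assoc 1# (- 1#) (- y))) ⟩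
        x + ((1# - 1#) - y) ≈⟨ +-congˡ (+-congʳ (-‿inverseʳ 1#)) ⟩
        x + (0# - y) ≈⟨ +-congˡ (+-identityˡ _) ⟩
        x - y ∎

      ⊖-homo : ∀ m n → fromℤ (m ⊖ n) ≈ ⟨ m ⟩ - ⟨ n ⟩
      ⊖-homo zero zero = ≈-sym (-‿inverseʳ 0#)
      ⊖-homo zero (suc n) = ≈-sym (+-identityˡ _)
      ⊖-homo (suc m) zero = ≈-sym (≈-trans (+-congˡ -0#≈0#) (+-identityʳ _))
      ⊖-homo (suc m) (suc n) = begin
        fromℤ (suc m ⊖ suc n) ≡⟨ cong fromℤ (ℤ.[1+m]⊖[1+n]≡m⊖n m n) ⟩
        fromℤ (m ⊖ n) ≈⟨ ⊖-homo m n ⟩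
        ⟨ m ⟩ - ⟨ n ⟩ ≈⟨ cancel-1 ⟨ m ⟩ ⟨ n ⟩ ⟨
        ⟨ suc m ⟩ - ⟨ suc n ⟩ ∎

      +-homo : ∀ i j → fromℤ (i ℤ.+ j) ≈ fromℤ i + fromℤ j
      +-homo (posℤ m) (posℤ n) = ×-homo-+ 1# m n
      +-homo (posℤ m) -[1+ n ] = ⊖-homo m (suc n)
      +-homo -[1+ m ] (posℤ n) = ≈-trans (⊖-homo n (suc m)) (+-comm _ _)
      +-homo -[1+ m ] -[1+ n ] = begin
        - (1# + (1# + ⟨ m ℕ.+ n ⟩)) ≈⟨ -‿cong (+-congˡ (+-congˡ (×-homo-+ 1# m n))) ⟩
        - (1# + (1# + (⟨ m ⟩ + ⟨ n ⟩))) ≈⟨ -‿cong (+-congˡ (≈-sym (+-assoc 1# _ _))) ⟩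
        - (1# + ((1# + ⟨ m ⟩) + ⟨ n ⟩)) ≈⟨ -‿cong (+-congˡ (+-comm _ _)) ⟩
        - (1# + (⟨ n ⟩ + (1# + ⟨ m ⟩))) ≈⟨ -‿cong (≈-sym (+-assoc 1# _ _)) ⟩
        - (⟨ suc n ⟩ + ⟨ suc m ⟩) ≈⟨ -‿cong (+-comm _ _) ⟩
        - (⟨ suc m ⟩ + ⟨ suc n ⟩) ≈⟨ -‿+-comm _ _ ⟨
        - ⟨ suc m ⟩ - ⟨ suc n ⟩ ∎

      ⟦_⟧ₛ : Sgn.Sign → Carrier
      ⟦ Sgn.+ ⟧ₛ = 1#
      ⟦ Sgn.- ⟧ₛ = - 1#

      ⟦⟧ₛ-homo : ∀ s t → ⟦ s Sgn.* t ⟧ₛ ≈ ⟦ s ⟧ₛ * ⟦ t ⟧ₛ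
      ⟦⟧ₛ-homo Sgn.+ t = ≈-sym (*-identityˡ _)
      ⟦⟧ₛ-homo Sgn.- Sgn.+ = ≈-sym (*-identityʳ _)
      ⟦⟧ₛ-homo Sgn.- Sgn.- = ≈-sym (≈-trans (-1*x≈-x _) (-‿involutive _))

      ◃-homo : ∀ s n → fromℤ (s ◃ n) ≈ ⟦ s ⟧ₛ * ⟨ n ⟩
      ◃-homo s zero = ≈-sym (zeroʳ _)
      ◃-homo Sgn.+ (suc n) = ≈-sym (*-identityˡ _)
      ◃-homo Sgn.- (suc n) = ≈-sym (-1*x≈-x _)

      signAbs-homo : ∀ i → fromℤ i ≈ ⟦ sign i ⟧ₛ * ⟨ ∣ i ∣ ⟩
      signAbs-homo i = ≈-trans (reflexive (cong fromℤ (≡.sym (ℤ.signᵢ◃∣i∣≡i i)))) (◃-homo (sign i) ∣ i ∣)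

      *-homo : ∀ i j → fromℤ (i ℤ.* j) ≈ fromℤ i * fromℤ j
      *-homo i j = begin
        fromℤ (i ℤ.* j)
          ≈⟨ ◃-homo (sign i Sgn.* sign j) (∣ i ∣ ℕ.* ∣ j ∣) ⟩
        ⟦ sign i Sgn.* sign j ⟧ₛ * ⟨ ∣ i ∣ ℕ.* ∣ j ∣ ⟩
          ≈⟨ *-cong (⟦⟧ₛ-homo (sign i) (sign j)) (×1-homo-* ∣ i ∣ ∣ j ∣) ⟩
        (⟦ sign i ⟧ₛ * ⟦ sign j ⟧ₛ) * (⟨ ∣ i ∣ ⟩ * ⟨ ∣ j ∣ ⟩)
          ≈⟨ *-assoc _ _ _ ⟩
        ⟦ sign i ⟧ₛ * (⟦ sign j ⟧ₛ * (⟨ ∣ i ∣ ⟩ * ⟨ ∣ j ∣ ⟩))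
          ≈⟨ *-congˡ (≈-trans (≈-sym (*-assoc _ _ _)) (≈-trans (*-congʳ (*-comm _ _)) (*-assoc _ _ _))) ⟩
        ⟦ sign i ⟧ₛ * (⟨ ∣ i ∣ ⟩ * (⟦ sign j ⟧ₛ * ⟨ ∣ j ∣ ⟩))
          ≈⟨ *-assoc _ _ _ ⟨
        (⟦ sign i ⟧ₛ * ⟨ ∣ i ∣ ⟩) * (⟦ sign j ⟧ₛ * ⟨ ∣ j ∣ ⟩)
          ≈⟨ *-cong (signAbs-homo i) (signAbs-homo j) ⟨
        fromℤ i * fromℤ j ∎

      morphism : CommutativeRing.rawRing ℤ.+-*-commutativeRing -Raw-AlmostCommutative⟶ fromCommutativeRing R
      morphism = record
        { ⟦_⟧ = fromℤ
        ; +-homo = +-homo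
        ; *-homo = *-homo
        ; -‿homo = neg-homo
        ; 0-homo = ≈-refl
        ; 1-homo = +-identityʳ 1# }

      dec : ∀ i j → Maybe (fromℤ i ≈ fromℤ j)
      dec i j with i ℤ.≟ j
      ... | yes refl = just ≈-refl
      ... | no _ = nothing

    open RingSolver (CommutativeRing.rawRing ℤ.+-*-commutativeRing) (fromCommutativeRing R) morphism dec public
      using (solve; _:=_; _:+_; _:*_; :-_; _:-_; con)

    fromℤ-+ = +-homo
    fromℤ-neg = neg-homo

  module RingKit {a b : Level} (R : CommutativeRing a b) where
    open CommutativeRing R renaming (refl to ≈-refl; sym to ≈-sym; trans to ≈-trans)
    open IntegerSolver R
    open RingProperties ring using (-‿involutive; -0#≈0#; x≈y⇒x∙y⁻¹≈ε; x∙y⁻¹≈ε⇒x≈y)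
    open SetoidReasoning setoid

    infix 4 _∣_
    _∣_ : Carrier → Carrier → Set (a ⊔ b)
    x ∣ y = Σ Carrier (λ r → y ≈ (x * r))

    ∣-resp : ∀ {x x′ y y′} → x ≈ x′ → y ≈ y′ → x ∣ y → x′ ∣ y′
    ∣-resp p q (r , e) = r , ≈-trans (≈-sym q) (≈-trans e (*-congʳ p))

    ∣-respʳ : ∀ {x y y′} → y ≈ y′ → x ∣ y → x ∣ y′
    ∣-respʳ = ∣-resp ≈-refl

    ∣-refl : ∀ {x} → x ∣ x
    ∣-refl = 1# , ≈-sym (*-identityʳ _)

    ∣-0 : ∀ {x y} → y ≈ 0# → x ∣ y
    ∣-0 p = 0# , ≈-trans p (≈-sym (zeroʳ _))

    ∣-+ : ∀ {x y z} → x ∣ y → x ∣ z → x ∣ y + z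
    ∣-+ (r , e) (s , f) = r + s , ≈-trans (+-cong e f) (≈-sym (distribˡ _ r s))

    ∣-neg : ∀ {x y} → x ∣ y → x ∣ - y
    ∣-neg {x} (r , e) = - r , ≈-trans (-‿cong e) (solve 2 (λ u v → :- (u :* v) := u :* :- v) ≈-refl x r)

    ∣-minus : ∀ {x y z} → x ∣ y → x ∣ z → x ∣ y - z
    ∣-minus p q = ∣-+ p (∣-neg q)

    ∣-*ˡ : ∀ {x y} z → x ∣ y → x ∣ z * y
    ∣-*ˡ {x} z (r , e) = z * r ,
      ≈-trans (*-congˡ e) (solve 3 (λ u v w → w :* (u :* v) := u :* (w :* v)) ≈-refl x r z)

    ∣-*ʳ : ∀ {x y} z → x ∣ y → x ∣ y * z
    ∣-*ʳ z p = ∣-respʳ (*-comm _ _) (∣-*ˡ z p)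

    ∣-trans : ∀ {x y z} → x ∣ y → y ∣ z → x ∣ z
    ∣-trans {x} (r , e) (s , f) = r * s , ≈-trans f (≈-trans (*-congʳ e) (*-assoc x r s))

    neg-∣ : ∀ {x y} → x ∣ y → (- x) ∣ y
    neg-∣ {x} (r , e) = - r , ≈-trans e (solve 2 (λ u v → u :* v := :- u :* :- v) ≈-refl x r)

    ∣-diff-*ˡ : ∀ {x y z} w → x ∣ y - z → x ∣ w * y - w * z
    ∣-diff-*ˡ {x} {y} {z} w p =
      ∣-respʳ (solve 3 (λ w y z → w :* (y :- z) := w :* y :- w :* z) ≈-refl w y z) (∣-*ˡ w p)

    -- Divisibility of a difference is congruence modulo `x`; this and `∣-diff-+` make it compatible
    -- with the ring operations.
    ∣-diff-* : ∀ {x y y′ z z′} → x ∣ y - y′ → x ∣ z - z′ → x ∣ y * z - y′ * z′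
    ∣-diff-* {x} {y} {y′} {z} {z′} p q =
      ∣-respʳ (solve 4 (λ y y′ z z′ → (y :- y′) :* z :+ y′ :* (z :- z′) := y :* z :- y′ :* z′) ≈-refl y y′ z z′)
        (∣-+ (∣-*ʳ z p) (∣-*ˡ y′ q))

    ∣-diff-+ : ∀ {x y y′ z z′} → x ∣ y - y′ → x ∣ z - z′ → x ∣ (y + z) - (y′ + z′)
    ∣-diff-+ {x} {y} {y′} {z} {z′} p q =
      ∣-respʳ (solve 4 (λ y y′ z z′ → (y :- y′) :+ (z :- z′) := (y :+ z) :- (y′ :+ z′)) ≈-refl y y′ z z′) (∣-+ p q)

    ∣-diff-sym : ∀ {x y z} → x ∣ y - z → x ∣ z - y
    ∣-diff-sym {x} {y} {z} p = ∣-respʳ (solve 2 (λ y z → :- (y :- z) := z :- y) ≈-refl y z) (∣-neg p)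

    ∣-diff-≈ : ∀ {x y z} → y ≈ z → x ∣ y - z
    ∣-diff-≈ {x} {y} {z} e = ∣-0 (x≈y⇒x∙y⁻¹≈ε e)

    minus-swap : ∀ x y → y - x ≈ - (x - y)
    minus-swap = solve 2 (λ x y → y :- x := :- (x :- y)) ≈-refl

    -- Stands in for the property of being a domain: cancellation is only needed by units and
    -- explicit products of linear forms.
    NZD : Carrier → Set (a ⊔ b)
    NZD x = ∀ m → x * m ≈ 0# → m ≈ 0#

    NZD-resp : ∀ {x y} → x ≈ y → NZD x → NZD y
    NZD-resp e h m p = h m (≈-trans (*-congʳ e) p)

    NZD-neg : ∀ {x} → NZD x → NZD (- x)
    NZD-neg {x} h m p = h m (begin
      x * m ≈⟨ solve 2 (λ x m → x :* m := :- (:- x :* m)) ≈-refl x m ⟩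
      - (- x * m) ≈⟨ -‿cong p ⟩
      - 0# ≈⟨ -0#≈0# ⟩
      0# ∎)

    NZD-neg⁻ : ∀ {x} → NZD (- x) → NZD x
    NZD-neg⁻ h = NZD-resp (-‿involutive _) (NZD-neg h)

    NZD-* : ∀ {x y} → NZD x → NZD y → NZD (x * y)
    NZD-* h h′ m p = h′ m (h _ (≈-trans (≈-sym (*-assoc _ _ _)) p))

    NZD-1 : NZD 1#
    NZD-1 m p = ≈-trans (≈-sym (*-identityˡ m)) p

    NZD-unit : ∀ {x y} → x * y ≈ 1# → NZD x
    NZD-unit {x} {y} e m p = begin
      m ≈⟨ *-identityˡ m ⟨
      1# * m ≈⟨ *-congʳ e ⟨
      (x * y) * m ≈⟨ solve 3 (λ x y m → (x :* y) :* m := y :* (x :* m)) ≈-refl x y m ⟩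
      y * (x * m) ≈⟨ *-congˡ p ⟩
      y * 0# ≈⟨ zeroʳ y ⟩
      0# ∎

    NZD-cancel : ∀ {x y z} → NZD x → x * y ≈ x * z → y ≈ z
    NZD-cancel {x} {y} {z} h e = x∙y⁻¹≈ε⇒x≈y y z (h _ (begin
      x * (y - z) ≈⟨ solve 3 (λ x y z → x :* (y :- z) := x :* y :- x :* z) ≈-refl x y z ⟩
      x * y - x * z ≈⟨ x≈y⇒x∙y⁻¹≈ε e ⟩
      0# ∎))

    ∏ : ∀ {i} {I : Set i} → (I → Carrier) → List I → Carrier
    ∏ f [] = 1#
    ∏ f (i ∷ is) = f i * ∏ f is

    ∑ : ∀ {n} → (Fin n → Carrier) → Carrier
    ∑ {zero} f = 0#
    ∑ {suc n} f = f Fin.zero + ∑ (λ i → f (Fin.suc i))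

    ∑-cong : ∀ {n} {f g : Fin n → Carrier} → (∀ i → f i ≈ g i) → ∑ f ≈ ∑ g
    ∑-cong {zero} h = ≈-refl
    ∑-cong {suc n} h = +-cong (h Fin.zero) (∑-cong (λ i → h (Fin.suc i)))

    ∑-0 : ∀ {n} {f : Fin n → Carrier} → (∀ i → f i ≈ 0#) → ∑ f ≈ 0#
    ∑-0 {zero} h = ≈-refl
    ∑-0 {suc n} h = ≈-trans (+-cong (h Fin.zero) (∑-0 (λ i → h (Fin.suc i)))) (+-identityˡ _)

    ∑-+ : ∀ {n} (f g : Fin n → Carrier) → ∑ (λ i → f i + g i) ≈ ∑ f + ∑ g
    ∑-+ {zero} f g = ≈-sym (+-identityˡ _)
    ∑-+ {suc n} f g = ≈-trans (+-congˡ (∑-+ (λ i → f (Fin.suc i)) (λ i → g (Fin.suc i))))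
      (solve 4 (λ a b c d → (a :+ b) :+ (c :+ d) := (a :+ c) :+ (b :+ d)) ≈-refl _ _ _ _)

    ∑-*ˡ : ∀ {n} c (f : Fin n → Carrier) → ∑ (λ i → c * f i) ≈ c * ∑ f
    ∑-*ˡ {zero} c f = ≈-sym (zeroʳ c)
    ∑-*ˡ {suc n} c f = ≈-trans (+-congˡ (∑-*ˡ c (λ i → f (Fin.suc i)))) (≈-sym (distribˡ c _ _))

    ∑-neg : ∀ {n} (f : Fin n → Carrier) → ∑ (λ i → - f i) ≈ - ∑ f
    ∑-neg {zero} f = ≈-sym -0#≈0#
    ∑-neg {suc n} f = ≈-trans (+-congˡ (∑-neg (λ i → f (Fin.suc i))))
      (solve 2 (λ a b → (:- a) :+ (:- b) := :- (a :+ b)) ≈-refl _ _)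

    ∣-∑ : ∀ {n x} (f : Fin n → Carrier) → (∀ i → x ∣ f i) → x ∣ ∑ f
    ∣-∑ {zero} f h = ∣-0 ≈-refl
    ∣-∑ {suc n} f h = ∣-+ (h Fin.zero) (∣-∑ (λ i → f (Fin.suc i)) (λ i → h (Fin.suc i)))

  record Hom {a b c d : Level} (R : CommutativeRing a b) (S : CommutativeRing c d) : Set (a ⊔ b ⊔ c ⊔ d) where
    private
      module R = CommutativeRing R
      module S = CommutativeRing S
    field
      ⟦_⟧ : R.Carrier → S.Carrier
      ⟦⟧-cong : ∀ {x y} → x R.≈ y → ⟦ x ⟧ S.≈ ⟦ y ⟧
      +-homo : ∀ x y → ⟦ x R.+ y ⟧ S.≈ ⟦ x ⟧ S.+ ⟦ y ⟧
      *-homo : ∀ x y → ⟦ x R.* y ⟧ S.≈ ⟦ x ⟧ S.* ⟦ y ⟧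
      1-homo : ⟦ R.1# ⟧ S.≈ S.1#

    open RingProperties S.ring using (+-identityˡ-unique; +-inverseʳ-unique)

    0-homo : ⟦ R.0# ⟧ S.≈ S.0#
    0-homo = +-identityˡ-unique _ _ (S.trans (S.sym (+-homo _ _)) (⟦⟧-cong (R.+-identityˡ R.0#)))

    -‿homo : ∀ x → ⟦ R.- x ⟧ S.≈ S.- ⟦ x ⟧
    -‿homo x = +-inverseʳ-unique _ _
      (S.trans (S.sym (+-homo _ _)) (S.trans (⟦⟧-cong (R.-‿inverseʳ x)) 0-homo))

    minus-homo : ∀ x y → ⟦ x R.- y ⟧ S.≈ ⟦ x ⟧ S.- ⟦ y ⟧
    minus-homo x y = S.trans (+-homo x (R.- y)) (S.+-congˡ (-‿homo y))

-- Evaluation and substitution of polynomials.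

module PolynomialEvaluation where
  open import Level using (_⊔_; lift)
  open import Data.Nat using (zero; suc)
  open import Data.Fin using (Fin)
  import Data.Fin as Fin
  open import Data.List using (List; []; _∷_; map)
  open import Data.List.Relation.Unary.All using (All; []; _∷_)
  open import Data.Product using (proj₂)
  open import Data.Empty using (⊥-elim)
  open import Function using (_∘_)
  open import Relation.Binary.PropositionalEquality using (_≢_; refl; cong)
  import Algebra.Properties.Ring as RingProperties
  import Relation.Binary.Reasoning.Setoid as SetoidReasoning
  open PolynomialArithmetic
  open RingTools

  module Evaluation {c ℓ′ : Level} (K : CommutativeRing c ℓ′) where
    open Poly K renaming (_+P_ to infixl 6 _+P_; _-P_ to infixl 6 _-P_; _*P_ to infixl 7 _*P_; -P_ to infix 8 -P_)
    open PolynomialRing K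
    private module K = CommutativeRing K

    PolyRing : ℕ → CommutativeRing c (c ⊔ ℓ′)
    PolyRing n = PolRing.commutativeRing (polRing n)

    module Evaluate {a b : Level} (R : CommutativeRing a b) (ι : Hom K R) where
      open CommutativeRing R using (Carrier; _≈_; _+_; _*_; -_; 0#; 1#; +-cong; +-congˡ; *-congˡ; *-cong; ring; setoid; zeroˡ; zeroʳ; +-identityˡ; +-identityʳ)
      private module R = CommutativeRing R
      open RingKit R using (_∣_; ∣-diff-≈; ∣-diff-+; ∣-diff-*)
      open IntegerSolver R
      open RingProperties ring using (x∙y⁻¹≈ε⇒x≈y; -0#≈0#)
      open SetoidReasoning setoid
      open Hom ι using () renaming (⟦_⟧ to ⟦_⟧ι; ⟦⟧-cong to ι-cong; +-homo to ι-+; *-homo to ι-*; 1-homo to ι-1; 0-homo to ι-0; -‿homo to ι-neg)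

      Env : ℕ → Set a
      Env n = Fin n → Carrier

      mutual
        eval : ∀ {n} → Env n → Pol n → Carrier
        eval e (con x) = ⟦ x ⟧ι
        eval e (lst p) = evalL e p

        evalL : ∀ {n} → Env (suc n) → List (Pol n) → Carrier
        evalL e [] = 0#
        evalL e (x ∷ p) = eval (e ∘ Fin.suc) x + e Fin.zero * evalL e p

      eval-const : ∀ {n} (e : Env n) x → eval e (const x) ≈ ⟦ x ⟧ι
      eval-const {zero} e x = R.refl
      eval-const {suc n} e x = R.trans (+-cong (eval-const (e ∘ Fin.suc) x) (zeroʳ _)) (+-identityʳ _)

      eval-0P : ∀ {n} (e : Env n) → eval e 0P ≈ 0#
      eval-0P e = R.trans (eval-const e K.0#) ι-0

      eval-1P : ∀ {n} (e : Env n) → eval e 1P ≈ 1#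
      eval-1P e = R.trans (eval-const e K.1#) ι-1

      eval-var : ∀ {n} (e : Env n) i → eval e (var i) ≈ e i
      eval-var e Fin.zero = begin
        eval (e ∘ Fin.suc) 0P + e Fin.zero * (eval (e ∘ Fin.suc) 1P + e Fin.zero * 0#)
          ≈⟨ +-cong (eval-0P (e ∘ Fin.suc)) (*-congˡ (+-cong (eval-1P (e ∘ Fin.suc)) (zeroʳ _))) ⟩
        0# + e Fin.zero * (1# + 0#)
          ≈⟨ R.trans (+-identityˡ _) (R.trans (*-congˡ (+-identityʳ _)) (R.*-identityʳ _)) ⟩
        e Fin.zero ∎
      eval-var e (Fin.suc i) = R.trans (+-cong (eval-var (e ∘ Fin.suc) i) (zeroʳ _)) (+-identityʳ _)

      mutual
        eval-+ : ∀ {n} (e : Env n) p q → eval e (p +P q) ≈ eval e p + eval e q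
        eval-+ e (con x) (con y) = ι-+ x y
        eval-+ e (lst p) (lst q) = evalL-+ e p q

        evalL-+ : ∀ {n} (e : Env (suc n)) p q → evalL e (addL _+P_ p q) ≈ evalL e p + evalL e q
        evalL-+ e [] q = R.sym (+-identityˡ _)
        evalL-+ e (x ∷ p) [] = R.sym (+-identityʳ _)
        evalL-+ e (x ∷ p) (y ∷ q) = R.trans (+-cong (eval-+ _ x y) (*-congˡ (evalL-+ e p q)))
          (solve 5 (λ x y t u v → (x :+ y) :+ t :* (u :+ v) := (x :+ t :* u) :+ (y :+ t :* v)) R.refl _ _ _ _ _)

      mutual
        eval-neg : ∀ {n} (e : Env n) p → eval e (-P p) ≈ - eval e p
        eval-neg e (con x) = ι-neg x
        eval-neg e (lst p) = R.trans (R.reflexive (cong (eval e) (-P-lst p))) (evalL-neg e p)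

        evalL-neg : ∀ {n} (e : Env (suc n)) p → evalL e (map -P_ p) ≈ - evalL e p
        evalL-neg e [] = R.sym -0#≈0#
        evalL-neg e (x ∷ p) = R.trans (+-cong (eval-neg _ x) (*-congˡ (evalL-neg e p)))
          (solve 3 (λ x t u → :- x :+ t :* :- u := :- (x :+ t :* u)) R.refl _ _ _)

      mutual
        eval-* : ∀ {n} (e : Env n) p q → eval e (p *P q) ≈ eval e p * eval e q
        eval-* e (con x) (con y) = ι-* x y
        eval-* e (lst p) (lst q) = evalL-* e p q

        evalL-* : ∀ {n} (e : Env (suc n)) p q → evalL e (mulL _*P_ p q) ≈ evalL e p * evalL e q
        evalL-* e [] q = R.sym (zeroˡ _)
        evalL-* e (x ∷ p) q = begin
          evalL e (addL _+P_ (map (x *P_) q) (0P ∷ mulL _*P_ p q))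
            ≈⟨ evalL-+ e (map (x *P_) q) _ ⟩
          evalL e (map (x *P_) q) + (eval (e ∘ Fin.suc) 0P + e Fin.zero * evalL e (mulL _*P_ p q))
            ≈⟨ +-cong (evalL-scale e x q) (+-cong (eval-0P (e ∘ Fin.suc)) (*-congˡ (evalL-* e p q))) ⟩
          eval _ x * evalL e q + (0# + e Fin.zero * (evalL e p * evalL e q))
            ≈⟨ +-congˡ (+-identityˡ _) ⟩
          eval _ x * evalL e q + e Fin.zero * (evalL e p * evalL e q)
            ≈⟨ solve 4 (λ x t u v → x :* v :+ t :* (u :* v) := (x :+ t :* u) :* v) R.refl _ _ _ _ ⟩
          (eval _ x + e Fin.zero * evalL e p) * evalL e q ∎

        evalL-scale : ∀ {n} (e : Env (suc n)) x q → evalL e (map (x *P_) q) ≈ eval (e ∘ Fin.suc) x * evalL e q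
        evalL-scale e x [] = R.sym (zeroʳ _)
        evalL-scale e x (y ∷ q) = R.trans (+-cong (eval-* _ x y) (*-congˡ (evalL-scale e x q)))
          (solve 4 (λ x y t u → x :* y :+ t :* (x :* u) := x :* (y :+ t :* u)) R.refl _ _ _ _)

      mutual
        eval-IsZero : ∀ {n} (e : Env n) p → IsZero p → eval e p ≈ 0#
        eval-IsZero e (con x) (lift z) = R.trans (ι-cong z) ι-0
        eval-IsZero e (lst p) z = evalL-IsZero e p z

        evalL-IsZero : ∀ {n} (e : Env (suc n)) p → All IsZero p → evalL e p ≈ 0#
        evalL-IsZero e [] [] = R.refl
        evalL-IsZero e (x ∷ p) (z ∷ zs) =
          R.trans (+-cong (eval-IsZero _ x z) (R.trans (*-congˡ (evalL-IsZero e p zs)) (zeroʳ _))) (+-identityˡ _)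

      eval-cong : ∀ {n} (e : Env n) {p q} → p ≈P q → eval e p ≈ eval e q
      eval-cong e {p} {q} z = x∙y⁻¹≈ε⇒x≈y _ _
        (R.trans (R.sym (R.trans (eval-+ e p (-P q)) (+-congˡ (eval-neg e q)))) (eval-IsZero e (p -P q) z))

      evalHom : ∀ {n} → Env n → Hom (PolyRing n) R
      evalHom e = record
        { ⟦_⟧ = eval e
        ; ⟦⟧-cong = λ {p} {q} → eval-cong e {p} {q}
        ; +-homo = eval-+ e
        ; *-homo = eval-* e
        ; 1-homo = eval-1P e }

      mutual
        -- Substitution respects congruence modulo `α`. With a single changed coordinate this is the
        -- remainder theorem behind `≔-diff`.
        eval-diff : ∀ {n} {α} (e f : Env n) → (∀ i → α ∣ R._-_ (e i) (f i)) → ∀ p → α ∣ R._-_ (eval e p) (eval f p)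
        eval-diff e f h (con x) = ∣-diff-≈ R.refl
        eval-diff e f h (lst p) = evalL-diff e f h p

        evalL-diff : ∀ {n} {α} (e f : Env (suc n)) → (∀ i → α ∣ R._-_ (e i) (f i)) → ∀ p → α ∣ R._-_ (evalL e p) (evalL f p)
        evalL-diff e f h [] = ∣-diff-≈ R.refl
        evalL-diff e f h (x ∷ p) =
          ∣-diff-+ (eval-diff _ _ (h ∘ Fin.suc) x) (∣-diff-* (h Fin.zero) (evalL-diff e f h p))

      mutual
        eval-ext : ∀ {n} {e f : Env n} → (∀ i → e i ≈ f i) → ∀ p → eval e p ≈ eval f p
        eval-ext h (con x) = R.refl
        eval-ext h (lst p) = evalL-ext h p

        evalL-ext : ∀ {n} {e f : Env (suc n)} → (∀ i → e i ≈ f i) → ∀ p → evalL e p ≈ evalL f p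
        evalL-ext h [] = R.refl
        evalL-ext h (x ∷ p) = +-cong (eval-ext (h ∘ Fin.suc) x) (*-cong (h Fin.zero) (evalL-ext h p))

    module Naturality {a b a′ b′ : Level} (R : CommutativeRing a b) (R′ : CommutativeRing a′ b′)
      (ι : Hom K R) (ι′ : Hom K R′) (h : Hom R R′)
      (h-ι : ∀ x → CommutativeRing._≈_ R′ (Hom.⟦_⟧ h (Hom.⟦_⟧ ι x)) (Hom.⟦_⟧ ι′ x)) where
      private
        module R′ = CommutativeRing R′
        module E = Evaluate R ι
        module E′ = Evaluate R′ ι′
        module h = Hom h

      mutual
        -- Needed twice: to commute evaluation with adding a variable, and to evaluate a substituted
        -- polynomial at a point.
        eval-hom : ∀ {n} (e : E.Env n) p → h.⟦ E.eval e p ⟧ R′.≈ E′.eval (λ i → h.⟦ e i ⟧) p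
        eval-hom e (con x) = h-ι x
        eval-hom e (lst p) = evalL-hom e p

        evalL-hom : ∀ {n} (e : E.Env (suc n)) p → h.⟦ E.evalL e p ⟧ R′.≈ E′.evalL (λ i → h.⟦ e i ⟧) p
        evalL-hom e [] = h.0-homo
        evalL-hom e (x ∷ p) = R′.trans (h.+-homo _ _)
          (R′.+-cong (eval-hom _ x) (R′.trans (h.*-homo _ _) (R′.*-congˡ (evalL-hom e p))))

    private
      module P {n : ℕ} = CommutativeRing (PolyRing n)

    IsZero⇒≈0 : ∀ {n} {p : Pol n} → IsZero p → p ≈P 0P
    IsZero⇒≈0 {n} = PolRing.IsZero⇒≈0 (polRing n)

    ≈0⇒IsZero : ∀ {n} {p : Pol n} → p ≈P 0P → IsZero p
    ≈0⇒IsZero {n} = PolRing.≈0⇒IsZero (polRing n)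

    lst-cong : ∀ {n} {p q : Pol n} → p ≈P q → lst (p ∷ []) ≈P lst (q ∷ [])
    lst-cong {n} {p} {q} h = ≋⇒≈ {p ∷ []} {q ∷ []} (∷-cong h (λ k → P.refl {x = 0P}))
      where open PolRing-suc (polRing n)

    weaken : ∀ n → Hom (PolyRing n) (PolyRing (suc n))
    weaken n = record
      { ⟦_⟧ = λ p → lst (p ∷ [])
      ; ⟦⟧-cong = λ {p} {q} → lst-cong {n} {p} {q}
      ; +-homo = λ p q → P.refl {x = lst ((p +P q) ∷ [])}
      ; *-homo = λ p q → P.sym {x = lst ((p *P q +P 0P) ∷ [])} {y = lst ((p *P q) ∷ [])}
          (lst-cong {n} {p *P q +P 0P} {p *P q} (P.+-identityʳ (p *P q)))
      ; 1-homo = P.refl {x = 1P} }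

    const-cong : ∀ n {x y} → x K.≈ y → const {n} x ≈P const y
    const-cong zero {x} {y} h = lift (K.trans (K.+-congʳ h) (K.-‿inverseʳ y))
    const-cong (suc n) {x} {y} h = Hom.⟦⟧-cong (weaken n) {const x} {const y} (const-cong n h)

    const-+ : ∀ n x y → const {n} (x K.+ y) ≈P const x +P const y
    const-+ zero x y = P.refl {x = con (x K.+ y)}
    const-+ (suc n) x y = P.trans {i = const (x K.+ y)} {j = lst ((const x +P const y) ∷ [])} {k = const x +P const y}
      (W.⟦⟧-cong {const (x K.+ y)} {const x +P const y} (const-+ n x y)) (W.+-homo (const x) (const y))
      where module W = Hom (weaken n)

    const-* : ∀ n x y → const {n} (x K.* y) ≈P const x *P const y
    const-* zero x y = P.refl {x = con (x K.* y)}
    const-* (suc n) x y = P.trans {i = const (x K.* y)} {j = lst ((const x *P const y) ∷ [])} {k = const x *P const y}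
      (W.⟦⟧-cong {const (x K.* y)} {const x *P const y} (const-* n x y)) (W.*-homo (const x) (const y))
      where module W = Hom (weaken n)

    constHom : ∀ n → Hom K (PolyRing n)
    constHom n = record
      { ⟦_⟧ = const
      ; ⟦⟧-cong = const-cong n
      ; +-homo = const-+ n
      ; *-homo = const-* n
      ; 1-homo = P.refl {x = 1P} }

    module Id (n : ℕ) = Evaluate (PolyRing n) (constHom n)

    -- Makes a polynomial itself a value, so that `eval-diff` can compare it with the result of a
    -- substitution.
    eval-id : ∀ {n} (p : Pol n) → Id.eval n var p ≈P p
    eval-id (con x) = P.refl {x = con x}
    eval-id {suc n} (lst p) = go p
      where
      open PolRing-suc (polRing n)
      module N = Naturality (PolyRing n) (PolyRing (suc n)) (constHom n) (constHom (suc n)) (weaken n)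
        (λ x → P.refl {x = const x})

      head : ∀ (x : Pol n) → Id.eval (suc n) (var ∘ Fin.suc) x ≈P lst (x ∷ [])
      head x = P.trans {i = Id.eval (suc n) (var ∘ Fin.suc) x} {j = lst (Id.eval n var x ∷ [])} {k = lst (x ∷ [])}
        (P.sym {x = lst (Id.eval n var x ∷ [])} {y = Id.eval (suc n) (var ∘ Fin.suc) x} (N.eval-hom var x))
        (lst-cong (eval-id x))

      cons : ∀ x p → lst (x ∷ []) +P (var Fin.zero *P lst p) ≈P lst (x ∷ p)
      cons x p = ≋⇒≈ {(x ∷ []) ⊕ ((0P ∷ 1P ∷ []) ⊗ p)} {x ∷ p} λ k →
        P.trans (coef-⊕ (x ∷ []) ((0P ∷ 1P ∷ []) ⊗ p) k) (P.trans (P.+-congˡ (P.trans (0∷-⊗ (1P ∷ []) p k) (shift k))) (tail k))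
        where
        shift : ∀ k → coef (0P ∷ ((1P ∷ []) ⊗ p)) k ≈P coef (0P ∷ p) k
        shift zero = P.refl {x = 0P}
        shift (suc k) = ⊗-identityˡ p k
        tail : ∀ k → (coef (x ∷ []) k +P coef (0P ∷ p) k) ≈P coef (x ∷ p) k
        tail zero = P.+-identityʳ x
        tail (suc k) = P.+-identityˡ (coef p k)

      go : ∀ p → Id.evalL (suc n) var p ≈P lst p
      go [] = ≋⇒≈ {0P ∷ []} {[]} 0≋[]
      go (x ∷ p) = P.trans {i = Id.evalL (suc n) var (x ∷ p)} {j = lst (x ∷ []) +P (var Fin.zero *P lst p)} {k = lst (x ∷ p)}
        (P.+-cong {x = Id.eval (suc n) (var ∘ Fin.suc) x} {y = lst (x ∷ [])} {u = var Fin.zero *P Id.evalL (suc n) var p} {v = var Fin.zero *P lst p}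
          (head x) (P.*-cong {x = var Fin.zero} {y = var Fin.zero} {u = Id.evalL (suc n) var p} {v = lst p} (P.refl {x = var Fin.zero}) (go p)))
        (cons x p)

    module NonZeroDivisors where
      private module Kit {n : ℕ} = RingKit (PolyRing n)
      open Kit using (NZD; NZD-neg⁻; NZD-resp; minus-swap)

      -- Multiplication by a polynomial that is constant in the new variable acts coefficient by
      -- coefficient.
      NZD-weaken : ∀ {n} {α : Pol n} → NZD α → NZD (lst (α ∷ []))
      NZD-weaken {n} {α} h (lst p) e = ≋⇒≈ {p} {0P ∷ []} λ k → P.trans
        (h (coef p k) (P.trans (P.sym (R.trans (coef-⊗ α [] p k) (P.trans (P.+-congˡ (0≋[] k)) (P.+-identityʳ _))))
          (P.trans (≈⇒≋ {(α ∷ []) ⊗ p} {0P ∷ []} e k) (0≋[] k))))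
        (P.sym (0≋[] k))
        where
        open PolRing-suc (polRing n)
        module R = P {n}

      -- The top coefficient of (γ + x) p is that of p, then descend.
      NZD-monic : ∀ {n} (γ : Pol n) → NZD (lst (γ ∷ 1P ∷ []))
      NZD-monic {n} γ (lst p) e = ≋⇒≈ {p} {0P ∷ []} λ k → P.trans (vanish p eq k) (P.sym (0≋[] k))
        where
        open PolRing-suc (polRing n)

        eq : ∀ k → (γ *P coef p k) +P coef (0P ∷ p) k ≈P 0P
        eq k = P.trans (P.sym (P.trans (coef-⊗ γ (1P ∷ []) p k) (P.+-congˡ (shift k))))
          (P.trans (≈⇒≋ {(γ ∷ 1P ∷ []) ⊗ p} {0P ∷ []} e k) (0≋[] k))
          where
          shift : ∀ k → coef (0P ∷ ((1P ∷ []) ⊗ p)) k ≈P coef (0P ∷ p) k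
          shift zero = P.refl {x = 0P}
          shift (suc k) = ⊗-identityˡ p k

        absorb : ∀ {u v} → u ≈P 0P → γ *P u +P v ≈P 0P → v ≈P 0P
        absorb {u} {v} z h = P.trans (P.sym (P.+-identityˡ v))
          (P.trans (P.+-congʳ (P.sym (P.trans (P.*-congˡ z) (P.zeroʳ γ)))) h)

        vanish′ : ∀ b q → (∀ k → (γ *P coef q k) +P coef (b ∷ q) k ≈P 0P) → b ≈P 0P × (∀ k → coef q k ≈P 0P)
        vanish′ b [] h = absorb (P.refl {x = 0P}) (h 0) , λ k → P.refl {x = 0P}
        vanish′ b (d ∷ q) h with vanish′ d q (λ k → h (suc k))
        ... | d0 , q0 = absorb d0 (h 0) , λ { zero → d0 ; (suc k) → q0 k }

        vanish : ∀ q → (∀ k → (γ *P coef q k) +P coef (0P ∷ q) k ≈P 0P) → ∀ k → coef q k ≈P 0P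
        vanish q h = proj₂ (vanish′ 0P q h)

      NZD-var : ∀ {n} (i : Fin n) → NZD (var i)
      NZD-var Fin.zero = NZD-monic 0P
      NZD-var (Fin.suc i) = NZD-weaken (NZD-var i)

      -- The variable of index zero is the outermost one. If it occurs, the form is monic in it;
      -- otherwise the form is constant in it and the claim descends.
      NZD-var+var : ∀ {n} {i j : Fin n} → i ≢ j → NZD (var i +P var j)
      NZD-var+var {i = Fin.zero} {Fin.zero} i≢j = ⊥-elim (i≢j refl)
      NZD-var+var {i = Fin.zero} {Fin.suc j} i≢j = NZD-monic (0P +P var j)
      NZD-var+var {i = Fin.suc i} {Fin.zero} i≢j = NZD-monic (var i +P 0P)
      NZD-var+var {i = Fin.suc i} {Fin.suc j} i≢j = NZD-weaken (NZD-var+var (i≢j ∘ cong Fin.suc))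

      NZD-var-var : ∀ {n} {i j : Fin n} → i ≢ j → NZD (var i -P var j)
      NZD-var-var {i = Fin.zero} {Fin.zero} i≢j = ⊥-elim (i≢j refl)
      NZD-var-var {i = Fin.zero} {Fin.suc j} i≢j = NZD-monic (0P +P (-P var j))
      -- Here the outermost variable has coefficient -1, so it is the negated form that is monic.
      NZD-var-var {suc n} {i = Fin.suc i} {Fin.zero} i≢j = NZD-neg⁻
        (NZD-resp {suc n} {lst ((0P +P (-P var i)) ∷ 1P ∷ [])} { -P (var (Fin.suc i) -P var Fin.zero)}
          (minus-swap (var (Fin.suc i)) (var Fin.zero))
          (NZD-monic (0P +P (-P var i))))
      NZD-var-var {i = Fin.suc i} {Fin.suc j} i≢j = NZD-weaken (NZD-var-var (i≢j ∘ cong Fin.suc))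

-- Linear forms, their coprimality, and interpolation.

module Forms where
  open import Level using (_⊔_) renaming (suc to lsuc)
  open import Data.Fin using (Fin)
  import Data.Fin as Fin
  open import Data.List using ([]; _∷_; map)
  open import Data.List.Relation.Unary.All using (All; []; _∷_)
  import Data.List.Relation.Unary.All as All
  open import Data.List.Relation.Unary.Any using (here; there)
  open import Data.List.Membership.Propositional using (_∈_)
  open import Data.List.Relation.Unary.Unique.Propositional using (Unique)
  open import Data.List.Relation.Unary.AllPairs using ([]; _∷_)
  open import Data.Product using (proj₁; proj₂)
  open import Data.Empty using (⊥-elim)
  open import Function using (_∘_)
  open import Relation.Nullary using (yes; no)
  open import Relation.Binary.PropositionalEquality using (_≡_; _≢_; refl; cong)
  import Relation.Binary.PropositionalEquality as ≡
  import Algebra.Properties.Ring as RingProperties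
  import Relation.Binary.Reasoning.Setoid as SetoidReasoning
  open Signs
  open RingTools

  -- The interface through which the polynomial ring is seen: linear forms are non-zero-divisors, 2
  -- is invertible, and a variable can be replaced subject to the remainder theorem `≔-diff`.
  record FormRing (a b : Level) (ℓ : ℕ) : Set (lsuc (a ⊔ b)) where
    field
      S : CommutativeRing a b
    open CommutativeRing S using (Carrier; _≈_; _+_; _*_; _-_; 1#)
    open RingKit S using (_∣_; NZD)
    field
      x : Fin ℓ → Carrier
      half : Carrier
      2*half : (1# + 1#) * half ≈ 1#
      NZD-x : ∀ i → NZD (x i)
      NZD-x+x : ∀ {i j} → i ≢ j → NZD (x i + x j)
      NZD-x-x : ∀ {i j} → i ≢ j → NZD (x i - x j)
      _≔_ : Fin ℓ → Carrier → Hom S S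
      ≔-self : ∀ v r → Hom.⟦_⟧ (v ≔ r) (x v) ≈ r
      ≔-other : ∀ {v u} r → u ≢ v → Hom.⟦_⟧ (v ≔ r) (x u) ≈ x u
      ≔-diff : ∀ v r p → (x v - r) ∣ (p - Hom.⟦_⟧ (v ≔ r) p)

  module LinearForms {a b : Level} {ℓ : ℕ} (F : FormRing a b ℓ) where
    open FormRing F public
    open CommutativeRing S public using (Carrier; _≈_; _+_; _*_; -_; _-_; 0#; 1#; +-cong; +-congˡ; +-congʳ; *-congˡ; *-congʳ; *-cong; -‿cong; +-identityˡ; +-identityʳ; *-identityˡ; *-identityʳ; zeroˡ; zeroʳ; +-comm; *-comm; *-assoc; +-assoc; distribˡ; distribʳ; -‿inverseʳ; reflexive; ring; setoid)
      renaming (refl to ≈-refl; sym to ≈-sym; trans to ≈-trans)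
    open RingKit S public
    open IntegerSolver S public using (solve; _:=_; _:+_; _:*_; :-_; _:-_)
    open RingProperties ring public using (-‿involutive; -0#≈0#; x≈y⇒x∙y⁻¹≈ε; x∙y⁻¹≈ε⇒x≈y)
    open SetoidReasoning setoid

    infixr 8 _▹_
    _▹_ : Sign → Carrier → Carrier
    plus ▹ p = p
    minus ▹ p = - p

    ▹-cong : ∀ s {p q} → p ≈ q → s ▹ p ≈ s ▹ q
    ▹-cong plus e = e
    ▹-cong minus e = -‿cong e

    ▹-· : ∀ s t p → s ▹ t ▹ p ≈ (s · t) ▹ p
    ▹-· plus t p = ≈-refl
    ▹-· minus plus p = ≈-refl
    ▹-· minus minus p = -‿involutive p

    ▹-self : ∀ s p → s ▹ s ▹ p ≈ p
    ▹-self plus p = ≈-refl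
    ▹-self minus p = -‿involutive p

    ▹-minus : ∀ s p q → s ▹ (p - q) ≈ s ▹ p - s ▹ q
    ▹-minus plus p q = ≈-refl
    ▹-minus minus p q = solve 2 (λ p q → :- (p :- q) := :- p :- :- q) ≈-refl p q

    ∣-▹ : ∀ s {p q} → p ∣ q → p ∣ s ▹ q
    ∣-▹ plus h = h
    ∣-▹ minus h = ∣-neg h

    ▹-∣ : ∀ s {p q} → p ∣ q → s ▹ p ∣ q
    ▹-∣ plus h = h
    ▹-∣ minus h = neg-∣ h

    hom-▹ : ∀ (φ : Hom S S) s p → Hom.⟦_⟧ φ (s ▹ p) ≈ s ▹ Hom.⟦_⟧ φ p
    hom-▹ φ plus p = ≈-refl
    hom-▹ φ minus p = Hom.-‿homo φ p

    NZD-▹ : ∀ s {p} → NZD p → NZD (s ▹ p)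
    NZD-▹ plus h = h
    NZD-▹ minus h = NZD-neg h

    NZD-2 : NZD (1# + 1#)
    NZD-2 = NZD-unit 2*half

    ρ : Root ℓ → Carrier
    ρ (u , s) = s ▹ x u

    NZD-double : ∀ {p} → NZD p → NZD (p + p)
    NZD-double {p} h = NZD-resp (≈-trans (distribʳ p 1# 1#) (+-cong (*-identityˡ p) (*-identityˡ p))) (NZD-* NZD-2 h)

    NZD-ρ : ∀ r → NZD (ρ r)
    NZD-ρ (u , s) = NZD-▹ s (NZD-x u)

    NZD-ρ-ρ : ∀ {r t} → r ≢ t → NZD (ρ r - ρ t)
    NZD-ρ-ρ {u , s} {v , t} h with u Fin.≟ v
    NZD-ρ-ρ {u , plus} {v , plus} h | no u≢v = NZD-x-x u≢v
    NZD-ρ-ρ {u , plus} {v , minus} h | no u≢v =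
      NZD-resp (solve 2 (λ p q → p :+ q := p :- :- q) ≈-refl _ _) (NZD-x+x u≢v)
    NZD-ρ-ρ {u , minus} {v , plus} h | no u≢v =
      NZD-resp (solve 2 (λ p q → :- (p :+ q) := :- p :- q) ≈-refl _ _) (NZD-neg (NZD-x+x u≢v))
    NZD-ρ-ρ {u , minus} {v , minus} h | no u≢v =
      NZD-resp (solve 2 (λ p q → :- (p :- q) := :- p :- :- q) ≈-refl _ _) (NZD-neg (NZD-x-x u≢v))
    NZD-ρ-ρ {u , plus} {v , plus} h | yes refl = ⊥-elim (h refl)
    NZD-ρ-ρ {u , plus} {v , minus} h | yes refl =
      NZD-resp (solve 1 (λ p → p :+ p := p :- :- p) ≈-refl _) (NZD-double (NZD-x u))
    NZD-ρ-ρ {u , minus} {v , plus} h | yes refl =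
      NZD-resp (solve 1 (λ p → :- (p :+ p) := :- p :- p) ≈-refl _) (NZD-neg (NZD-double (NZD-x u)))
    NZD-ρ-ρ {u , minus} {v , minus} h | yes refl = ⊥-elim (h refl)

    ≔-ρ-self : ∀ v s r → Hom.⟦_⟧ (v ≔ r) (ρ (v , s)) ≈ s ▹ r
    ≔-ρ-self v s r = ≈-trans (hom-▹ (v ≔ r) s (x v)) (▹-cong s (≔-self v r))

    ≔-ρ-other : ∀ {v u} s r → u ≢ v → Hom.⟦_⟧ (v ≔ r) (ρ (u , s)) ≈ ρ (u , s)
    ≔-ρ-other {v} {u} s r h = ≈-trans (hom-▹ (v ≔ r) s (x u)) (▹-cong s (≔-other r h))

    -- Reduction modulo `ρ r - ρ t`, realised as an endomorphism of `S`: by `kills` and `diff` its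
    -- kernel is the ideal of that form, and `nzd` says that no other form at `r` becomes a zero
    -- divisor.
    record Kill (r t : Root ℓ) : Set (a ⊔ b) where
      field
        φ : Hom S S
      open Hom φ public
      field
        kills : ⟦ ρ r - ρ t ⟧ ≈ 0#
        diff : ∀ p → (ρ r - ρ t) ∣ (p - ⟦ p ⟧)
        nzd : ∀ {w} → w ≢ r → w ≢ t → NZD ⟦ ρ r - ρ w ⟧

    kill : ∀ {r t} → r ≢ t → Kill r t
    kill {u , s} {v , t} r≢t with u Fin.≟ v
    ... | no u≢v = record
      { φ = σ
      ; kills = ≈-trans (σ.minus-homo (ρ (u , s)) (ρ (v , t)))
          (≈-trans (+-cong (≔-ρ-other s _ u≢v) (-‿cong (≈-trans (≔-ρ-self v t _) (▹-self t _)))) (-‿inverseʳ _))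
      ; diff = λ p → conv t (≔-diff v _ p)
      ; nzd = nz }
      where
      σ : Hom S S
      σ = v ≔ (t ▹ ρ (u , s))
      module σ = Hom σ

      conv : ∀ t {q} → (x v - t ▹ ρ (u , s)) ∣ q → (ρ (u , s) - ρ (v , t)) ∣ q
      conv plus h = ∣-resp (solve 2 (λ p q → :- (p :- q) := q :- p) ≈-refl _ _) ≈-refl (neg-∣ h)
      conv minus h = ∣-resp (solve 2 (λ p q → p :- :- q := q :- :- p) ≈-refl _ _) ≈-refl h

      nz : ∀ {w} → w ≢ (u , s) → w ≢ (v , t) → NZD σ.⟦ ρ (u , s) - ρ w ⟧
      nz {w , z} h h′ with w Fin.≟ v
      ... | no w≢v = NZD-resp (≈-sym (≈-trans (σ.minus-homo _ _)
            (+-cong (≔-ρ-other s _ u≢v) (-‿cong (≔-ρ-other z _ w≢v))))) (NZD-ρ-ρ (h ∘ ≡.sym))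
      -- The root `w` is opposite to `(v , t)` and is sent to `- ρ (u , s)`, so the form becomes
      -- twice a root.
      ... | yes refl = NZD-resp (≈-sym (≈-trans (σ.minus-homo _ _)
            (≈-trans (+-cong (≔-ρ-other s _ u≢v) (-‿cong
              (≈-trans (≔-ρ-self v z _) (≈-trans (▹-· z t _) (reflexive (cong (_▹ ρ (u , s)) z·t))))))
              (+-congˡ (-‿involutive _))))) (NZD-double (NZD-ρ (u , s)))
        where
        z·t : z · t ≡ minus
        z·t = ≢⇒·≡minus (λ z≡t → h′ (cong (v ,_) z≡t))
    -- Opposite roots at one vertex: up to sign the form is `2 x_u`, so reduction sets `x_u` to
    -- zero, and `half` recovers divisibility by the doubled form.
    ... | yes refl = record
      { φ = σ
      ; kills = ≈-trans (σ.minus-homo (ρ (u , s)) (ρ (u , t)))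
          (≈-trans (+-cong (toZero s) (-‿cong (toZero t))) (-‿inverseʳ 0#))
      ; diff = λ p → conv s t r≢t (≔-diff u 0# p)
      ; nzd = nz }
      where
      σ : Hom S S
      σ = u ≔ 0#
      module σ = Hom σ

      ▹-0 : ∀ s → s ▹ 0# ≈ 0#
      ▹-0 plus = ≈-refl
      ▹-0 minus = -0#≈0#

      toZero : ∀ s → σ.⟦ ρ (u , s) ⟧ ≈ 0#
      toZero s = ≈-trans (≔-ρ-self u s 0#) (▹-0 s)

      halve : ∀ {p q} → (p - 0#) ∣ q → (p + p) ∣ q
      halve {p} {q} (r , e) = half * r , (begin
        q ≈⟨ e ⟩
        (p - 0#) * r ≈⟨ *-congʳ (≈-trans (+-congˡ -0#≈0#) (+-identityʳ p)) ⟩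
        p * r ≈⟨ *-congˡ (≈-trans (≈-sym (*-identityˡ r)) (*-congʳ (≈-sym 2*half))) ⟩
        p * (((1# + 1#) * half) * r) ≈⟨ solve 4 (λ p i h r → p :* (((i :+ i) :* h) :* r) := ((p :* i) :+ (p :* i)) :* (h :* r)) ≈-refl p 1# half r ⟩
        (p * 1# + p * 1#) * (half * r) ≈⟨ *-congʳ (+-cong (*-identityʳ p) (*-identityʳ p)) ⟩
        (p + p) * (half * r) ∎)

      conv : ∀ s t → (u , s) ≢ (u , t) → ∀ {q} → (x u - 0#) ∣ q → (ρ (u , s) - ρ (u , t)) ∣ q
      conv plus plus h = ⊥-elim (h refl)
      conv plus minus h d = ∣-resp (solve 1 (λ p → p :+ p := p :- :- p) ≈-refl _) ≈-refl (halve d)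
      conv minus plus h d = ∣-resp (solve 1 (λ p → :- (p :+ p) := :- p :- p) ≈-refl _) ≈-refl (neg-∣ (halve d))
      conv minus minus h = ⊥-elim (h refl)

      nz : ∀ {w} → w ≢ (u , s) → w ≢ (u , t) → NZD σ.⟦ ρ (u , s) - ρ w ⟧
      nz {w , z} h h′ with w Fin.≟ u
      ... | no w≢u = NZD-resp (≈-sym (≈-trans (σ.minus-homo _ _)
            (≈-trans (+-cong (toZero s) (-‿cong (≔-ρ-other z _ w≢u))) (+-identityˡ _)))) (NZD-neg (NZD-ρ (w , z)))
      ... | yes refl = ⊥-elim (third s t z (λ e → r≢t (cong (u ,_) e)) (λ e → h (cong (u ,_) e)) (λ e → h′ (cong (u ,_) e)))
        where
        third : ∀ s t z → s ≢ t → z ≢ s → z ≢ t → Data.Empty.⊥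
        third plus plus z h _ _ = h refl
        third plus minus plus _ h _ = h refl
        third plus minus minus _ _ h = h refl
        third minus plus plus _ _ h = h refl
        third minus plus minus _ h _ = h refl
        third minus minus z h _ _ = h refl

    -- Modulo `ρ r - ρ t` the product vanishes while its first factor remains a non-zero-divisor, so
    -- the second factor vanishes.
    cancel : ∀ {r t w m} → r ≢ t → w ≢ r → w ≢ t → (ρ r - ρ t) ∣ ((ρ r - ρ w) * m) → (ρ r - ρ t) ∣ m
    cancel {r} {t} {w} {m} r≢t w≢r w≢t (q , e) =
      ∣-respʳ (≈-trans (+-congˡ (≈-trans (-‿cong φm≈0) -0#≈0#)) (+-identityʳ m)) (K.diff m)
      where
      module K = Kill (kill r≢t)
      φm≈0 : K.⟦ m ⟧ ≈ 0#
      φm≈0 = K.nzd w≢r w≢t _ (begin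
        K.⟦ ρ r - ρ w ⟧ * K.⟦ m ⟧ ≈⟨ K.*-homo _ _ ⟨
        K.⟦ (ρ r - ρ w) * m ⟧ ≈⟨ K.⟦⟧-cong e ⟩
        K.⟦ (ρ r - ρ t) * q ⟧ ≈⟨ K.*-homo _ _ ⟩
        K.⟦ ρ r - ρ t ⟧ * K.⟦ q ⟧ ≈⟨ *-congʳ K.kills ⟩
        0# * K.⟦ q ⟧ ≈⟨ zeroˡ _ ⟩
        0# ∎)

    cancel-∏ : ∀ {r t m} ws → r ≢ t → All (_≢ r) ws → All (_≢ t) ws →
      (ρ r - ρ t) ∣ (∏ (λ w → ρ r - ρ w) ws * m) → (ρ r - ρ t) ∣ m
    cancel-∏ [] r≢t [] [] h = ∣-respʳ (*-identityˡ _) h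
    cancel-∏ (w ∷ ws) r≢t (p ∷ ps) (q ∷ qs) h =
      cancel-∏ ws r≢t ps qs (cancel r≢t p q (∣-respʳ (*-assoc _ _ _) h))

    -- The forms at `r` are pairwise coprime: a further form divides the product of the others times
    -- the quotient `m`, and by `cancel-∏` it already divides `m`.
    ∏-∣ : ∀ {r h} ws → Unique ws → All (_≢ r) ws → All (λ w → (ρ r - ρ w) ∣ h) ws → ∏ (λ w → ρ r - ρ w) ws ∣ h
    ∏-∣ [] _ _ _ = _ , ≈-sym (*-identityˡ _)
    ∏-∣ {r} {h} (w ∷ ws) (u ∷ us) (p ∷ ps) (d ∷ ds) with ∏-∣ ws us ps ds
    ... | m , e with cancel-∏ {r} {w} {m} ws (p ∘ ≡.sym) ps (All.map (λ z → z ∘ ≡.sym) u) (∣-respʳ e d)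
    ... | q , e′ = q , (begin
      h ≈⟨ e ⟩
      ∏ (λ w → ρ r - ρ w) ws * m ≈⟨ *-congˡ e′ ⟩
      ∏ (λ w → ρ r - ρ w) ws * ((ρ r - ρ w) * q) ≈⟨ solve 3 (λ u v w → u :* (v :* w) := (v :* u) :* w) ≈-refl _ _ _ ⟩
      ((ρ r - ρ w) * ∏ (λ w → ρ r - ρ w) ws) * q ∎)

    ∈-∏ : ∀ {i} {I : Set i} {f : I → Carrier} {w ws} → w ∈ ws → f w ∣ ∏ f ws
    ∈-∏ (here refl) = ∣-*ʳ _ ∣-refl
    ∈-∏ (there h) = ∣-*ˡ _ (∈-∏ h)

    ∏-diff : ∀ {i} {I : Set i} {α} (f g : I → Carrier) ws → (∀ w → α ∣ (f w - g w)) → α ∣ (∏ f ws - ∏ g ws)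
    ∏-diff f g [] h = ∣-diff-≈ ≈-refl
    ∏-diff f g (w ∷ ws) h = ∣-diff-* (h w) (∏-diff f g ws h)

    -- Newton interpolation.
    interpolate : ∀ v (h : Root ℓ → Carrier) rs → Unique rs → All (λ r → proj₁ r ≢ v) rs →
      (∀ {r t} → r ∈ rs → t ∈ rs → r ≢ t → (ρ r - ρ t) ∣ (h r - h t)) →
      Σ Carrier λ g → ∀ {r} → r ∈ rs → (x v - ρ r) ∣ (g - h r)
    interpolate v h [] _ _ _ = 0# , λ ()
    interpolate v h (r ∷ rs) (u ∷ us) (p ∷ ps) c with interpolate v h rs us ps (λ i j → c (there i) (there j))
    -- The product vanishes modulo `x v - ρ t` for the earlier roots `t`, so their congruences
    -- survive; `μ` is chosen to correct the value at `x v = ρ r`.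
    ... | g , gs = g - μ * ∏ f rs , λ { (here refl) → at-r ; (there i) → at-rs i }
      where
      f : Root ℓ → Carrier
      f t = x v - ρ t
      σ : Hom S S
      σ = v ≔ ρ r
      module σ = Hom σ

      -- At `x v = ρ r` the congruence of `g` at `t` and the compatibility of `h` both hold modulo
      -- `ρ r - ρ t`; subtract them.
      div : ∀ {t} → t ∈ rs → (ρ r - ρ t) ∣ σ.⟦ g - h r ⟧
      div {t} i with gs i | c (here refl) (there i) (All.lookup u i)
      ... | m , e | m′ , e′ = ∣-respʳ eq (∣-minus (∣-*ʳ σ.⟦ m ⟧ ∣-refl) (∣-*ʳ σ.⟦ m′ ⟧ ∣-refl))
        where
        σt : σ.⟦ ρ t ⟧ ≈ ρ t
        σt = ≔-ρ-other (proj₂ t) _ (All.lookup ps i)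
        σr : σ.⟦ ρ r ⟧ ≈ ρ r
        σr = ≔-ρ-other (proj₂ r) _ p
        eq : (ρ r - ρ t) * σ.⟦ m ⟧ - (ρ r - ρ t) * σ.⟦ m′ ⟧ ≈ σ.⟦ g - h r ⟧
        eq = begin
          (ρ r - ρ t) * σ.⟦ m ⟧ - (ρ r - ρ t) * σ.⟦ m′ ⟧
            ≈⟨ +-cong (*-congʳ (≈-sym (≈-trans (σ.minus-homo _ _) (+-cong (≔-self v _) (-‿cong σt)))))
                  (-‿cong (*-congʳ (≈-sym (≈-trans (σ.minus-homo _ _) (+-cong σr (-‿cong σt)))))) ⟩
          σ.⟦ x v - ρ t ⟧ * σ.⟦ m ⟧ - σ.⟦ ρ r - ρ t ⟧ * σ.⟦ m′ ⟧
            ≈⟨ +-cong (≈-trans (≈-sym (σ.*-homo _ _)) (σ.⟦⟧-cong (≈-sym e)))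
                  (-‿cong (≈-trans (≈-sym (σ.*-homo _ _)) (σ.⟦⟧-cong (≈-sym e′)))) ⟩
          σ.⟦ g - h t ⟧ - σ.⟦ h r - h t ⟧ ≈⟨ σ.minus-homo _ _ ⟨
          σ.⟦ (g - h t) - (h r - h t) ⟧
            ≈⟨ σ.⟦⟧-cong (solve 3 (λ g r t → (g :- t) :- (r :- t) := g :- r) ≈-refl g (h r) (h t)) ⟩
          σ.⟦ g - h r ⟧ ∎

      quotient : ∏ (λ t → ρ r - ρ t) rs ∣ σ.⟦ g - h r ⟧
      quotient = ∏-∣ rs us (All.map (λ z → z ∘ ≡.sym) u) (All.tabulate div)
      μ : Carrier
      μ = proj₁ quotient

      at-r : (x v - ρ r) ∣ ((g - μ * ∏ f rs) - h r)
      at-r = ∣-respʳ (begin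
        ((g - h r) - σ.⟦ g - h r ⟧) - (∏ f rs * μ - ∏ (λ t → ρ r - ρ t) rs * μ)
          ≈⟨ +-congʳ (+-congˡ (-‿cong (proj₂ quotient))) ⟩
        ((g - h r) - ∏ (λ t → ρ r - ρ t) rs * μ) - (∏ f rs * μ - ∏ (λ t → ρ r - ρ t) rs * μ)
          ≈⟨ solve 5 (λ g h m P Q → ((g :- h) :- Q :* m) :- (P :* m :- Q :* m) := (g :- m :* P) :- h) ≈-refl g (h r) μ (∏ f rs) (∏ (λ t → ρ r - ρ t) rs) ⟩
        (g - μ * ∏ f rs) - h r ∎)
        (∣-minus (≔-diff v (ρ r) (g - h r))
          (∣-diff-* (∏-diff f (λ t → ρ r - ρ t) rs
            (λ t → ∣-respʳ (solve 3 (λ a b c → a :- b := (a :- c) :- (b :- c)) ≈-refl (x v) (ρ r) (ρ t)) ∣-refl))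
            (∣-diff-≈ ≈-refl)))

      at-rs : ∀ {t} → t ∈ rs → (x v - ρ t) ∣ ((g - μ * ∏ f rs) - h t)
      at-rs {t} i = ∣-respʳ (solve 4 (λ g h m P → (g :- h) :- m :* P := (g :- m :* P) :- h) ≈-refl g (h t) μ (∏ f rs))
        (∣-minus (gs i) (∣-*ˡ μ (∈-∏ {f = f} i)))

-- Vertex sets and signed adjacency.

module VertexSets where
  open import Data.Fin using (Fin)
  import Data.Fin as Fin
  import Data.Fin.Properties as Fin
  open import Data.Sum using (_⊎_)
  open import Data.Empty using (⊥)
  open import Data.Unit using (⊤; tt)
  open import Relation.Nullary using (¬_; Dec; yes; no)
  open import Relation.Nullary.Decidable using (_×-dec_; _⊎-dec_; ¬?)
  open import Relation.Binary.PropositionalEquality using (_≡_; _≢_)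
  open Signs

  record VSet (ℓ : ℕ) : Set₁ where
    constructor _by_
    field
      Mem : Fin ℓ → Set
      mem? : ∀ i → Dec (Mem i)
  open VSet public

  infix 4 _∈_ _∉_ _⊆_
  _∈_ _∉_ : ∀ {ℓ} → Fin ℓ → VSet ℓ → Set
  i ∈ W = Mem W i
  i ∉ W = ¬ (i ∈ W)

  _⊆_ : ∀ {ℓ} → VSet ℓ → VSet ℓ → Set
  U ⊆ W = ∀ {i} → i ∈ U → i ∈ W

  infixl 7 _∖_ _∖ˢ_
  infixl 6 _∪_ _⊹_
  _∖_ _∪_ : ∀ {ℓ} → VSet ℓ → VSet ℓ → VSet ℓ
  U ∖ W = (λ i → i ∈ U × i ∉ W) by (λ i → mem? U i ×-dec ¬? (mem? W i))
  U ∪ W = (λ i → i ∈ U ⊎ i ∈ W) by (λ i → mem? U i ⊎-dec mem? W i)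

  ∅ full : ∀ {ℓ} → VSet ℓ
  ∅ = (λ _ → ⊥) by (λ _ → no λ ())
  full = (λ _ → ⊤) by (λ _ → yes tt)

  _⊹_ _∖ˢ_ : ∀ {ℓ} → VSet ℓ → Fin ℓ → VSet ℓ
  W ⊹ v = (λ i → i ∈ W ⊎ i ≡ v) by (λ i → mem? W i ⊎-dec (i Fin.≟ v))
  W ∖ˢ v = (λ i → i ∈ W × i ≢ v) by (λ i → mem? W i ×-dec ¬? (i Fin.≟ v))

  -- `E-plus` is the inclusion of the negative in the positive edges. Both signs share one relation
  -- so that signs of walks are products.
  record Adjacency (ℓ : ℕ) : Set₁ where
    field
      E : Sign → Fin ℓ → Fin ℓ → Set
      E? : ∀ s i j → Dec (E s i j)
      E-sym : ∀ {s i j} → E s i j → E s j i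
      E-irrefl : ∀ {s i j} → E s i j → i ≢ j
      E-plus : ∀ {s i j} → E s i j → E plus i j

  module Graph {ℓ : ℕ} (A : Adjacency ℓ) where
    open Adjacency A public

    FullyNeg : VSet ℓ → Set
    FullyNeg K = ∀ {i j} → i ∈ K → j ∈ K → i ≢ j → E minus i j

    FullyNeg⇒E : ∀ {K i j} → FullyNeg K → i ∈ K → j ∈ K → i ≢ j → ∀ s → E s i j
    FullyNeg⇒E h i∈ j∈ i≢j plus = E-plus (h i∈ j∈ i≢j)
    FullyNeg⇒E h i∈ j∈ i≢j minus = h i∈ j∈ i≢j

    -- The sign `s · t` is the one that closes two edges at `v` to a balanced triangle.
    Simplicial : VSet ℓ → Fin ℓ → Set
    Simplicial W v = ∀ {i j s t} → i ∈ W → j ∈ W → E s v i → E t v j → i ≢ j → E (s · t) i j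

-- Splines on signed graphs and relatively free modules.

module SplineModules where
  open import Level using (_⊔_)
  open import Data.Nat using (zero; suc)
  import Data.Nat as ℕ
  open import Data.Fin using (Fin; splitAt; _↑ˡ_; _↑ʳ_)
  import Data.Fin as Fin
  import Data.Fin.Properties as Fin
  open import Data.List using (List; []; _∷_; map; filter; allFin; cartesianProduct)
  open import Data.List.Relation.Unary.All using (All; []; _∷_)
  import Data.List.Relation.Unary.All as All
  open import Data.List.Relation.Unary.Any using (here; there)
  open import Data.List.Membership.Propositional using () renaming (_∈_ to _∈ₗ_)
  open import Data.List.Membership.Propositional.Properties using (∈-filter⁺; ∈-filter⁻; ∈-allFin; ∈-cartesianProduct⁺)
  open import Data.List.Relation.Unary.Unique.Propositional using (Unique)
  open import Data.List.Relation.Unary.Unique.Propositional.Properties using (filter⁺; allFin⁺; cartesianProduct⁺)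
  open import Data.List.Relation.Unary.AllPairs using ([]; _∷_)
  open import Data.Product using (proj₁; proj₂)
  open import Data.Sum using (inj₁; inj₂; [_,_]′)
  open import Data.Empty using (⊥-elim)
  open import Function using (_∘_)
  open import Relation.Nullary using (Dec; yes; no)
  open import Relation.Nullary.Decidable using (_×-dec_)
  open import Relation.Binary.PropositionalEquality using (_≡_; _≢_; refl; cong)
  import Relation.Binary.PropositionalEquality as ≡
  import Relation.Binary.Reasoning.Setoid as SetoidReasoning
  open Signs
  open Forms
  open VertexSets

  module Splines {a b : Level} {ℓ : ℕ} (F : FormRing a b ℓ) (A : Adjacency ℓ) where
    open LinearForms F
    open Graph A
    open SetoidReasoning setoid

    -- The sign occurs in the form but not in front of `g j`: modulo `x i - s ▹ x j`, the value
    -- `s ▹ (x j * g j)` is `x i * g j`.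
    record Spline (W : VSet ℓ) (g : Fin ℓ → Carrier) : Set (a ⊔ b) where
      constructor spline
      field
        at : ∀ {i j s} → i ∈ W → j ∈ W → E s i j → (x i - s ▹ x j) ∣ (g i - g j)
    open Spline public

    Spline-⊆ : ∀ {U W g} → U ⊆ W → Spline W g → Spline U g
    Spline-⊆ U⊆W h = spline λ i j e → at h (U⊆W i) (U⊆W j) e

    swap-form : ∀ s i j → x j - s ▹ x i ≈ - (s ▹ (x i - s ▹ x j))
    swap-form s i j = begin
      x j - s ▹ x i ≈⟨ solve 2 (λ p q → q :- p := :- (p :- q)) ≈-refl (s ▹ x i) (x j) ⟩
      - (s ▹ x i - x j) ≈⟨ -‿cong (+-congˡ (-‿cong (▹-self s (x j)))) ⟨
      - (s ▹ x i - s ▹ s ▹ x j) ≈⟨ -‿cong (▹-minus s (x i) (s ▹ x j)) ⟨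
      - (s ▹ (x i - s ▹ x j)) ∎

    swap-∣ : ∀ s i j {p q} → (x i - s ▹ x j) ∣ (p - q) → (x j - s ▹ x i) ∣ (q - p)
    swap-∣ s i j h = ∣-resp (≈-sym (swap-form s i j)) ≈-refl (neg-∣ (▹-∣ s (∣-diff-sym h)))

    -- "Relatively free": splines on C extend to W, and those on W that vanish on C
    -- have a basis; both together make such bases add up along C ⊆ U ⊆ W.
    record RF (W C : VSet ℓ) : Set (a ⊔ b) where
      field
        ext : ∀ g → Spline C g → Σ (Fin ℓ → Carrier) λ g′ → Spline W g′ × (∀ {i} → i ∈ C → g′ i ≈ g i)
        rank : ℕ
        basis : Fin rank → Fin ℓ → Carrier
        basis-spline : ∀ k → Spline W (basis k)
        basis-zero : ∀ k {i} → i ∈ C → basis k i ≈ 0#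
        span : ∀ g → Spline W g → (∀ {i} → i ∈ C → g i ≈ 0#) →
          Σ (Fin rank → Carrier) λ f → ∀ {i} → i ∈ W → g i ≈ ∑ (λ k → f k * basis k i)
        indep : ∀ (f : Fin rank → Carrier) → (∀ {i} → i ∈ W → ∑ (λ k → f k * basis k i) ≈ 0#) → ∀ k → f k ≈ 0#

    RF-refl : ∀ {W C} → W ⊆ C → RF W C
    RF-refl {W} {C} W⊆C = record
      { ext = λ g h → g , Spline-⊆ W⊆C h , λ _ → ≈-refl
      ; rank = 0
      ; basis = λ ()
      ; basis-spline = λ ()
      ; basis-zero = λ ()
      ; span = λ g h z → (λ ()) , λ i → z (W⊆C i)
      ; indep = λ f h → λ () }

    RF-resp : ∀ {W C C′} → C ⊆ C′ → C′ ⊆ C → RF W C → RF W C′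
    RF-resp {W} {C} {C′} C⊆C′ C′⊆C R = record
      { ext = λ g h → let g′ , h′ , e = R.ext g (Spline-⊆ C⊆C′ h) in g′ , h′ , λ i → e (C′⊆C i)
      ; rank = R.rank
      ; basis = R.basis
      ; basis-spline = R.basis-spline
      ; basis-zero = λ k i → R.basis-zero k (C′⊆C i)
      ; span = λ g h z → R.span g h (λ i → z (C⊆C′ i))
      ; indep = R.indep }
      where module R = RF R

    comb : ∀ {r} → (Fin r → Carrier) → (Fin r → Fin ℓ → Carrier) → Fin ℓ → Carrier
    comb f B i = ∑ (λ k → f k * B k i)

    Spline-comb : ∀ {W r} (f : Fin r → Carrier) B → (∀ k → Spline W (B k)) → Spline W (comb f B)
    Spline-comb f B h = spline λ {i} {j} i∈ j∈ e → ∣-respʳ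
      (≈-trans (∑-+ (λ k → f k * B k i) _) (+-congˡ (∑-neg (λ k → f k * B k j))))
      (∣-∑ (λ k → f k * B k i - f k * B k j) (λ k → ∣-diff-*ˡ (f k) (at (h k) i∈ j∈ e)))

    Spline-minus : ∀ {W g h} → Spline W g → Spline W h → Spline W (λ i → g i - h i)
    Spline-minus {g = g} {h} p q = spline λ {i} {j} i∈ j∈ e → ∣-respʳ
      (solve 4 (λ g h g′ h′ → (g :- g′) :- (h :- h′) := (g :- h) :- (g′ :- h′)) ≈-refl (g i) (h i) (g j) (h j))
      (∣-minus (at p i∈ j∈ e) (at q i∈ j∈ e))

    Spline-*ˡ : ∀ {W g} c → Spline W g → Spline W (λ i → c * g i)
    Spline-*ˡ c p = spline λ i j e → ∣-diff-*ˡ c (at p i j e)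

    ∑-↑ : ∀ m {n} (f : Fin (m ℕ.+ n) → Carrier) → ∑ f ≈ ∑ (λ k → f (k ↑ˡ n)) + ∑ (λ k → f (m ↑ʳ k))
    ∑-↑ zero f = ≈-sym (+-identityˡ _)
    ∑-↑ (suc m) f = ≈-trans (+-congˡ (∑-↑ m (f ∘ Fin.suc))) (≈-sym (+-assoc _ _ _))

    -- The basis for `W` over `U`, followed by lifts of the basis for `U` over `C`: restriction from
    -- `W` to `U` is onto by `ext`, and its kernel is spanned by the first family.
    RF-trans : ∀ {W U C} → C ⊆ U → U ⊆ W → RF W U → RF U C → RF W C
    RF-trans {W} {U} {C} C⊆U U⊆W R T = record
      { ext = λ g h → let g′ , h′ , e = T.ext g h ; g″ , h″ , e′ = R.ext g′ h′
                      in g″ , h″ , λ i → ≈-trans (e′ (C⊆U i)) (e i)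
      ; rank = R.rank ℕ.+ T.rank
      ; basis = B
      ; basis-spline = λ k → spl (splitAt R.rank k)
      ; basis-zero = λ k → zer (splitAt R.rank k)
      ; span = span
      ; indep = indep }
      where
      module R = RF R
      module T = RF T
      lifted : Fin T.rank → Fin ℓ → Carrier
      lifted k = proj₁ (R.ext (T.basis k) (T.basis-spline k))
      lifted-spline : ∀ k → Spline W (lifted k)
      lifted-spline k = proj₁ (proj₂ (R.ext (T.basis k) (T.basis-spline k)))
      lifted-≈ : ∀ k {i} → i ∈ U → lifted k i ≈ T.basis k i
      lifted-≈ k = proj₂ (proj₂ (R.ext (T.basis k) (T.basis-spline k)))

      B : Fin (R.rank ℕ.+ T.rank) → Fin ℓ → Carrier
      B k = [ R.basis , lifted ]′ (splitAt R.rank k)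

      spl : ∀ z → Spline W ([ R.basis , lifted ]′ z)
      spl (inj₁ k) = R.basis-spline k
      spl (inj₂ k) = lifted-spline k

      zer : ∀ z {i} → i ∈ C → [ R.basis , lifted ]′ z i ≈ 0#
      zer (inj₁ k) i = R.basis-zero k (C⊆U i)
      zer (inj₂ k) i = ≈-trans (lifted-≈ k (C⊆U i)) (T.basis-zero k i)

      split : ∀ f i → comb f B i ≈ comb (λ k → f (k ↑ˡ T.rank)) R.basis i + comb (λ k → f (R.rank ↑ʳ k)) lifted i
      split f i = ≈-trans (∑-↑ R.rank (λ k → f k * B k i)) (+-cong
        (∑-cong (λ k → reflexive (cong (λ z → f (k ↑ˡ T.rank) * [ R.basis , lifted ]′ z i) (Fin.splitAt-↑ˡ R.rank k T.rank))))
        (∑-cong (λ k → reflexive (cong (λ z → f (R.rank ↑ʳ k) * [ R.basis , lifted ]′ z i) (Fin.splitAt-↑ʳ R.rank T.rank k)))))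

      on-U : ∀ (f : Fin T.rank → Carrier) {i} → i ∈ U → comb f lifted i ≈ comb f T.basis i
      on-U f i = ∑-cong (λ k → *-congˡ (lifted-≈ k i))

      span : ∀ g → Spline W g → (∀ {i} → i ∈ C → g i ≈ 0#) →
        Σ (Fin (R.rank ℕ.+ T.rank) → Carrier) λ f → ∀ {i} → i ∈ W → g i ≈ comb f B i
      span g h z = f , λ {i} i∈ → begin
        g i ≈⟨ solve 2 (λ g c → g := (g :- c) :+ c) ≈-refl (g i) (comb f₂ lifted i) ⟩
        (g i - comb f₂ lifted i) + comb f₂ lifted i ≈⟨ +-congʳ (proj₂ first i∈) ⟩
        comb f₁ R.basis i + comb f₂ lifted i
          ≈⟨ +-cong (∑-cong (λ k → *-congʳ (reflexive (cong [ f₁ , f₂ ]′ (Fin.splitAt-↑ˡ R.rank k T.rank)))))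
                    (∑-cong (λ k → *-congʳ (reflexive (cong [ f₁ , f₂ ]′ (Fin.splitAt-↑ʳ R.rank T.rank k))))) ⟨
        comb (λ k → f (k ↑ˡ T.rank)) R.basis i + comb (λ k → f (R.rank ↑ʳ k)) lifted i ≈⟨ split f i ⟨
        comb f B i ∎
        where
        second : Σ (Fin T.rank → Carrier) λ f → ∀ {i} → i ∈ U → g i ≈ comb f T.basis i
        second = T.span g (Spline-⊆ U⊆W h) z
        f₂ : Fin T.rank → Carrier
        f₂ = proj₁ second
        first : Σ (Fin R.rank → Carrier) λ f → ∀ {i} → i ∈ W → g i - comb f₂ lifted i ≈ comb f R.basis i
        first = R.span (λ i → g i - comb f₂ lifted i) (Spline-minus h (Spline-comb f₂ lifted lifted-spline))
          (λ i → x≈y⇒x∙y⁻¹≈ε (≈-trans (proj₂ second i) (≈-sym (on-U f₂ i))))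
        f₁ : Fin R.rank → Carrier
        f₁ = proj₁ first
        f : Fin (R.rank ℕ.+ T.rank) → Carrier
        f k = [ f₁ , f₂ ]′ (splitAt R.rank k)

      indep : ∀ f → (∀ {i} → i ∈ W → comb f B i ≈ 0#) → ∀ k → f k ≈ 0#
      indep f h k = ≈-trans (reflexive (cong f (≡.sym (Fin.join-splitAt R.rank T.rank k)))) (both (splitAt R.rank k))
        where
        second : ∀ k → f (R.rank ↑ʳ k) ≈ 0#
        second = T.indep _ λ {i} i∈ → begin
          comb (λ k → f (R.rank ↑ʳ k)) T.basis i ≈⟨ on-U _ i∈ ⟨
          comb (λ k → f (R.rank ↑ʳ k)) lifted i ≈⟨ +-identityˡ _ ⟨
          0# + comb (λ k → f (R.rank ↑ʳ k)) lifted i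
            ≈⟨ +-congʳ (∑-0 (λ k → ≈-trans (*-congˡ (R.basis-zero k i∈)) (zeroʳ _))) ⟨
          comb (λ k → f (k ↑ˡ T.rank)) R.basis i + comb (λ k → f (R.rank ↑ʳ k)) lifted i ≈⟨ split f i ⟨
          comb f B i ≈⟨ h (U⊆W i∈) ⟩
          0# ∎
        first : ∀ k → f (k ↑ˡ T.rank) ≈ 0#
        first = R.indep _ λ {i} i∈ → begin
          comb (λ k → f (k ↑ˡ T.rank)) R.basis i ≈⟨ +-identityʳ _ ⟨
          comb (λ k → f (k ↑ˡ T.rank)) R.basis i + 0#
            ≈⟨ +-congˡ (∑-0 (λ k → ≈-trans (*-congʳ (second k)) (zeroˡ _))) ⟨
          comb (λ k → f (k ↑ˡ T.rank)) R.basis i + comb (λ k → f (R.rank ↑ʳ k)) lifted i ≈⟨ split f i ⟨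
          comb f B i ≈⟨ h i∈ ⟩
          0# ∎
        both : ∀ z → f (Fin.join R.rank T.rank z) ≈ 0#
        both (inj₁ k) = first k
        both (inj₂ k) = second k

    patch : VSet ℓ → (Fin ℓ → Carrier) → (Fin ℓ → Carrier) → Fin ℓ → Carrier
    patch Y g h i with mem? Y i
    ... | yes _ = g i
    ... | no _ = h i

    patch-∈ : ∀ Y g h {i} → i ∈ Y → patch Y g h i ≈ g i
    patch-∈ Y g h {i} i∈ with mem? Y i
    ... | yes _ = ≈-refl
    ... | no i∉ = ⊥-elim (i∉ i∈)

    patch-∉ : ∀ Y g h {i} → i ∉ Y → patch Y g h i ≈ h i
    patch-∉ Y g h {i} i∉ with mem? Y i
    ... | yes i∈ = ⊥-elim (i∉ i∈)
    ... | no _ = ≈-refl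

    Spline-patch : ∀ {W Y C g h} →
      (∀ {i j s} → i ∈ Y → j ∈ W → j ∉ Y → E s i j → j ∈ C) → (∀ {i} → i ∈ C → g i ≈ h i) →
      Spline (Y ∪ C) g → Spline (W ∖ Y) h → Spline W (patch Y g h)
    Spline-patch {W} {Y} {C} {g} {h} bd agree sg sh = spline form
      where
      form : ∀ {i j s} → i ∈ W → j ∈ W → E s i j → (x i - s ▹ x j) ∣ (patch Y g h i - patch Y g h j)
      form {i} {j} {s} i∈ j∈ e with mem? Y i | mem? Y j
      ... | yes p | yes q = at sg (inj₁ p) (inj₁ q) e
      ... | yes p | no q = ∣-respʳ (+-congˡ (-‿cong (agree j∈C))) (at sg (inj₁ p) (inj₂ j∈C) e)
        where j∈C = bd p j∈ q e
      ... | no p | yes q = swap-∣ s j i (∣-respʳ (+-congˡ (-‿cong (agree i∈C))) (at sg (inj₁ q) (inj₂ i∈C) (E-sym e)))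
        where i∈C = bd q i∈ p (E-sym e)
      ... | no p | no q = at sh (i∈ , p) (j∈ , q) e

    -- Edges leave `Y` only towards `C`, so a spline on `W` is a pair of splines, on `Y ∪ C` and off
    -- `Y`, that agree on `C`. Those vanishing off `Y` are the splines on `Y ∪ C` that vanish on
    -- `C`.
    RF-glue : ∀ {W Y C} → Y ⊆ W → C ⊆ W ∖ Y → (∀ {i j s} → i ∈ Y → j ∈ W → j ∉ Y → E s i j → j ∈ C) →
      RF (Y ∪ C) C → RF W (W ∖ Y)
    RF-glue {W} {Y} {C} Y⊆W C⊆ bd R = record
      { ext = λ g h → let g′ , h′ , e = R.ext g (Spline-⊆ C⊆ h) in
          patch Y g′ g , Spline-patch {W} {Y} {C} bd e h′ h , λ i → patch-∉ Y g′ g (proj₂ i)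
      ; rank = R.rank
      ; basis = B
      ; basis-spline = λ k → Spline-patch {W} {Y} {C} bd (R.basis-zero k) (R.basis-spline k) (spline λ _ _ _ → ∣-0 (-‿inverseʳ 0#))
      ; basis-zero = λ k i → patch-∉ Y (R.basis k) zeros (proj₂ i)
      ; span = λ g h z → let f , e = R.span g (Spline-⊆ sub h) (λ i → z (C⊆ i)) in
          f , λ {i} i∈ → on-W g z f e i∈ (mem? Y i)
      ; indep = λ f h → R.indep f λ {i} → λ where
          (inj₁ i∈) → ≈-trans (∑-cong (λ k → *-congˡ (≈-sym (patch-∈ Y (R.basis k) zeros i∈)))) (h (Y⊆W i∈))
          (inj₂ i∈) → ∑-0 (λ k → ≈-trans (*-congˡ (R.basis-zero k i∈)) (zeroʳ _)) }
      where
      module R = RF R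
      zeros : Fin ℓ → Carrier
      zeros _ = 0#
      B : Fin R.rank → Fin ℓ → Carrier
      B k = patch Y (R.basis k) zeros
      sub : Y ∪ C ⊆ W
      sub (inj₁ i) = Y⊆W i
      sub (inj₂ i) = proj₁ (C⊆ i)
      on-W : ∀ g → (∀ {i} → i ∈ W ∖ Y → g i ≈ 0#) → ∀ f → (∀ {i} → i ∈ Y ∪ C → g i ≈ comb f R.basis i) →
        ∀ {i} → i ∈ W → Dec (i ∈ Y) → g i ≈ comb f B i
      on-W g z f e i∈ (yes y) = ≈-trans (e (inj₁ y)) (∑-cong (λ k → *-congˡ (≈-sym (patch-∈ Y (R.basis k) zeros y))))
      on-W g z f e i∈ (no y) = ≈-trans (z (i∈ , y))
        (≈-sym (∑-0 (λ k → ≈-trans (*-congˡ (patch-∉ Y (R.basis k) zeros y)) (zeroʳ _))))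

    allRoots : List (Root ℓ)
    allRoots = cartesianProduct (allFin ℓ) (plus ∷ minus ∷ [])

    ∈-allRoots : ∀ r → r ∈ₗ allRoots
    ∈-allRoots (u , plus) = ∈-cartesianProduct⁺ (∈-allFin u) (here refl)
    ∈-allRoots (u , minus) = ∈-cartesianProduct⁺ (∈-allFin u) (there (here refl))

    allRoots-unique : Unique allRoots
    allRoots-unique = cartesianProduct⁺ (allFin⁺ ℓ) (((λ ()) ∷ []) ∷ [] ∷ [])

    NZD-∏ : ∀ {i} {I : Set i} {f : I → Carrier} {ws} → All (λ w → NZD (f w)) ws → NZD (∏ f ws)
    NZD-∏ [] = NZD-1
    NZD-∏ (p ∷ ps) = NZD-* p (NZD-∏ ps)

    -- Splines extend to `v` by interpolation at its neighbours, whose values are compatible because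
    -- `v` is simplicial. By coprimality, a spline that vanishes off `v` is a multiple of `bump` at
    -- `v`.
    module Eliminate {W : VSet ℓ} {v : Fin ℓ} (v∈W : v ∈ W) (simp : Simplicial W v) where
      Link : Root ℓ → Set
      Link (u , s) = u ∈ W × E s v u

      link? : ∀ r → Dec (Link r)
      link? (u , s) = mem? W u ×-dec E? s v u

      links : List (Root ℓ)
      links = filter link? allRoots

      links-unique : Unique links
      links-unique = filter⁺ link? allRoots-unique

      ∈-links⁻ : ∀ {r} → r ∈ₗ links → Link r
      ∈-links⁻ = proj₂ ∘ ∈-filter⁻ link? {xs = allRoots}

      ∈-links⁺ : ∀ {r} → Link r → r ∈ₗ links
      ∈-links⁺ {r} = ∈-filter⁺ link? (∈-allRoots r)

      links-≢v : All (λ r → proj₁ r ≢ v) links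
      links-≢v = All.tabulate λ r∈ → E-irrefl (proj₂ (∈-links⁻ r∈)) ∘ ≡.sym

      links-≢ : All (_≢ (v , plus)) links
      links-≢ = All.map (λ h e → h (cong proj₁ e)) links-≢v

      bump : Carrier
      bump = ∏ (λ r → x v - ρ r) links

      compatible : ∀ g → Spline (W ∖ˢ v) g → ∀ {r t} → r ∈ₗ links → t ∈ₗ links → r ≢ t →
        (ρ r - ρ t) ∣ (g (proj₁ r) - g (proj₁ t))
      compatible g h {i , s} {j , t} r∈ t∈ r≢t with i Fin.≟ j
      -- A neighbour joined to `v` under both signs contributes two roots with the same value.
      ... | yes refl = ∣-0 (-‿inverseʳ _)
      ... | no i≢j = ∣-resp (begin
          s ▹ (x i - (s · t) ▹ x j) ≈⟨ ▹-minus s _ _ ⟩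
          s ▹ x i - s ▹ (s · t) ▹ x j ≈⟨ +-congˡ (-‿cong (≈-trans (▹-· s (s · t) _) (reflexive (cong (_▹ x j) (s·s·t s t))))) ⟩
          s ▹ x i - t ▹ x j ∎) ≈-refl
          (▹-∣ s (at h (i∈ , (λ e → E-irrefl ei (≡.sym e))) (j∈ , (λ e → E-irrefl ej (≡.sym e))) (simp i∈ j∈ ei ej i≢j)))
        where
        i∈ = proj₁ (∈-links⁻ r∈)
        ei = proj₂ (∈-links⁻ r∈)
        j∈ = proj₁ (∈-links⁻ t∈)
        ej = proj₂ (∈-links⁻ t∈)
        s·s·t : ∀ s t → s · (s · t) ≡ t
        s·s·t s t = ≡.trans (≡.sym (·-assoc s s t)) (cong (_· t) (·-self s))

      set : Carrier → (Fin ℓ → Carrier) → Fin ℓ → Carrier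
      set p g i with i Fin.≟ v
      ... | yes _ = p
      ... | no _ = g i

      set-≢ : ∀ p g {i} → i ≢ v → set p g i ≈ g i
      set-≢ p g {i} h with i Fin.≟ v
      ... | yes e = ⊥-elim (h e)
      ... | no _ = ≈-refl

      set-v : ∀ p g → set p g v ≈ p
      set-v p g with v Fin.≟ v
      ... | yes _ = ≈-refl
      ... | no h = ⊥-elim (h refl)

      Spline-set : ∀ p g → Spline (W ∖ˢ v) g → (∀ {r} → r ∈ₗ links → (x v - ρ r) ∣ (p - g (proj₁ r))) → Spline W (set p g)
      Spline-set p g h d = spline form
        where
        form : ∀ {i j s} → i ∈ W → j ∈ W → E s i j → (x i - s ▹ x j) ∣ (set p g i - set p g j)
        form {i} {j} {s} i∈ j∈ e with i Fin.≟ v | j Fin.≟ v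
        ... | yes refl | yes refl = ⊥-elim (E-irrefl e refl)
        ... | yes refl | no _ = d (∈-links⁺ (j∈ , e))
        ... | no _ | yes refl = swap-∣ s v i (d (∈-links⁺ (i∈ , E-sym e)))
        ... | no i≢ | no j≢ = at h (i∈ , i≢) (j∈ , j≢) e

      zeros : Fin ℓ → Carrier
      zeros _ = 0#

      rf : RF W (W ∖ˢ v)
      rf = record
        { ext = λ g h → let p , d = interpolate v (g ∘ proj₁) links links-unique links-≢v (compatible g h) in
            set p g , Spline-set p g h d , λ i → set-≢ p g (proj₂ i)
        ; rank = 1
        ; basis = λ _ → set bump zeros
        ; basis-spline = λ _ → Spline-set bump zeros (spline λ _ _ _ → ∣-0 (-‿inverseʳ 0#))
            (λ r∈ → ∣-respʳ (≈-sym (≈-trans (+-congˡ -0#≈0#) (+-identityʳ _))) (∈-∏ {f = λ r → x v - ρ r} r∈))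
        ; basis-zero = λ _ i → set-≢ bump zeros (proj₂ i)
        ; span = span
        ; indep = λ f h → λ { Fin.zero → NZD-∏ (All.map (λ n → NZD-ρ-ρ (n ∘ ≡.sym)) links-≢) (f Fin.zero)
            (≈-trans (*-comm _ _) (≈-trans (≈-trans (*-congˡ (≈-sym (set-v bump zeros))) (≈-sym (+-identityʳ _))) (h v∈W))) } }
        where
        span : ∀ g → Spline W g → (∀ {i} → i ∈ W ∖ˢ v → g i ≈ 0#) →
          Σ (Fin 1 → Carrier) λ f → ∀ {i} → i ∈ W → g i ≈ ∑ (λ k → f k * set bump zeros i)
        span g h z = (λ _ → proj₁ quotient) , λ {i} i∈ → ≈-trans (value i i∈) (≈-sym (+-identityʳ _))
          where
          quotient : bump ∣ g v
          quotient = ∏-∣ {v , plus} {g v} links links-unique links-≢ (All.tabulate λ r∈ →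
            ∣-respʳ (≈-trans (+-congˡ (≈-trans (-‿cong (z (proj₁ (∈-links⁻ r∈) , All.lookup links-≢v r∈))) -0#≈0#)) (+-identityʳ _))
              (at h v∈W (proj₁ (∈-links⁻ r∈)) (proj₂ (∈-links⁻ r∈))))
          value : ∀ i → i ∈ W → g i ≈ proj₁ quotient * set bump zeros i
          value i i∈ with i Fin.≟ v
          ... | yes refl = ≈-trans (proj₂ quotient) (*-comm _ _)
          ... | no i≢v = ≈-trans (z (i∈ , i≢v)) (≈-sym (zeroʳ _))

    open Eliminate public using () renaming (rf to RF-simplicial)

    elements : VSet ℓ → List (Fin ℓ)
    elements K = filter (mem? K) (allFin ℓ)

    elements-unique : ∀ K → Unique (elements K)
    elements-unique K = filter⁺ (mem? K) (allFin⁺ ℓ)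

    ∈-elements⁻ : ∀ K {i} → i ∈ₗ elements K → i ∈ K
    ∈-elements⁻ K = proj₂ ∘ ∈-filter⁻ (mem? K) {xs = allFin ℓ}

    ∈-elements⁺ : ∀ K {i} → i ∈ K → i ∈ₗ elements K
    ∈-elements⁺ K = ∈-filter⁺ (mem? K) (∈-allFin _)

    -- Values of even polynomials at the coordinates are splines on every signed graph.
    Even : (Fin ℓ → Carrier) → Set (a ⊔ b)
    Even q = ∀ i j s → (x i - s ▹ x j) ∣ (q i - q j)

    Even⇒Spline : ∀ {q} → Even q → ∀ {W} → Spline W q
    Even⇒Spline h = spline λ {i} {j} {s} _ _ _ → h i j s

    -- The Newton products in the squared variable, the even counterpart of `bump`.
    squares : List (Fin ℓ) → Fin ℓ → Carrier
    squares ds i = ∏ (λ d → x i * x i - x d * x d) ds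

    squares-even : ∀ ds → Even (squares ds)
    squares-even ds i j s = ∏-diff _ _ ds λ d → ∣-respʳ
      (solve 3 (λ p q r → p :- q := (p :- r) :- (q :- r)) ≈-refl (x i * x i) (x j * x j) (x d * x d)) (factor s)
      where
      factor : ∀ s → (x i - s ▹ x j) ∣ (x i * x i - x j * x j)
      factor plus = x i + x j , solve 2 (λ p q → p :* p :- q :* q := (p :- q) :* (p :+ q)) ≈-refl _ _
      factor minus = x i - x j , solve 2 (λ p q → p :* p :- q :* q := (p :- :- q) :* (p :- q)) ≈-refl _ _

    signed : List (Fin ℓ) → List (Root ℓ)
    signed [] = []
    signed (d ∷ ds) = (d , plus) ∷ (d , minus) ∷ signed ds

    ∈-signed⁻ : ∀ {ds r} → r ∈ₗ signed ds → proj₁ r ∈ₗ ds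
    ∈-signed⁻ {d ∷ ds} (here refl) = here refl
    ∈-signed⁻ {d ∷ ds} (there (here refl)) = here refl
    ∈-signed⁻ {d ∷ ds} (there (there h)) = there (∈-signed⁻ h)

    signed-unique : ∀ {ds} → Unique ds → Unique (signed ds)
    signed-unique [] = []
    signed-unique {d ∷ ds} (p ∷ ps) =
      ((λ ()) ∷ All.tabulate (λ r∈ e → All.lookup p (∈-signed⁻ r∈) (cong proj₁ e)))
      ∷ All.tabulate (λ r∈ e → All.lookup p (∈-signed⁻ r∈) (cong proj₁ e)) ∷ signed-unique ps

    ∏-signed : ∀ ds i → ∏ (λ r → x i - ρ r) (signed ds) ≈ squares ds i
    ∏-signed [] i = ≈-refl
    ∏-signed (d ∷ ds) i = ≈-trans (*-congˡ (*-congˡ (∏-signed ds i)))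
      (solve 3 (λ p q r → (p :- q) :* ((p :- :- q) :* r) := (p :* p :- q :* q) :* r) ≈-refl _ _ _)

    squares-∣ : ∀ {ds k p} → Unique ds → All (_≢ k) ds → (∀ {d} → d ∈ₗ ds → ∀ s → (x k - s ▹ x d) ∣ p) → squares ds k ∣ p
    squares-∣ {ds} {k} u n h = ∣-resp (∏-signed ds k) ≈-refl (∏-∣ {k , plus} (signed ds) (signed-unique u)
      (All.tabulate (λ r∈ e → All.lookup n (∈-signed⁻ r∈) (cong proj₁ e)))
      (All.tabulate (λ {r} r∈ → h (∈-signed⁻ r∈) (proj₂ r))))

    squares-NZD : ∀ {ds k} → All (_≢ k) ds → NZD (squares ds k)
    squares-NZD {ds} {k} n = NZD-resp (∏-signed ds k)
      (NZD-∏ (All.tabulate (λ {r} r∈ → NZD-ρ-ρ {k , plus} {r} (λ e → All.lookup n (∈-signed⁻ r∈) (≡.sym (cong proj₁ e))))))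

    squares-zero : ∀ {ds d} → d ∈ₗ ds → squares ds d ≈ 0#
    squares-zero {d ∷ ds} (here refl) = ≈-trans (*-congʳ (-‿inverseʳ _)) (zeroˡ _)
    squares-zero {_ ∷ ds} (there h) = ≈-trans (*-congˡ (squares-zero h)) (zeroʳ _)

    -- Newton interpolation in the squared variable: divisibility under both signs makes up
    -- divisibility by `x k * x k - x d * x d`. The interpolant gives values at all vertices at
    -- once, not only at `ks`.
    even-interpolate : ∀ (g : Fin ℓ → Carrier) ks → Unique ks → (∀ {i j} → i ∈ₗ ks → j ∈ₗ ks → i ≢ j → ∀ s → (x i - s ▹ x j) ∣ (g i - g j)) →
      Σ (Fin ℓ → Carrier) λ q → Even q × (∀ {k} → k ∈ₗ ks → q k ≈ g k)
    even-interpolate g [] _ _ = (λ _ → 0#) , (λ _ _ _ → ∣-0 (-‿inverseʳ 0#)) , λ ()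
    even-interpolate g (k ∷ ks) (u ∷ us) c = (λ i → q i + μ * squares ks i) , even , agree
      where
      previous : Σ (Fin ℓ → Carrier) λ q → Even q × (∀ {k} → k ∈ₗ ks → q k ≈ g k)
      previous = even-interpolate g ks us (λ i j → c (there i) (there j))
      q : Fin ℓ → Carrier
      q = proj₁ previous
      q-even : Even q
      q-even = proj₁ (proj₂ previous)
      q-ks : ∀ {k} → k ∈ₗ ks → q k ≈ g k
      q-ks = proj₂ (proj₂ previous)
      quotient : squares ks k ∣ (g k - q k)
      quotient = squares-∣ {ks} {k} {g k - q k} us (All.map (λ n → n ∘ ≡.sym) u) λ {d} d∈ s →
        ∣-respʳ (≈-trans (+-congˡ (-‿cong (+-congˡ (-‿cong (q-ks d∈)))))
          (solve 3 (λ p q r → (p :- r) :- (q :- r) := p :- q) ≈-refl (g k) (q k) (g d)))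
          (∣-minus (c (here refl) (there d∈) (All.lookup u d∈) s) (q-even k d s))
      μ : Carrier
      μ = proj₁ quotient
      even : Even (λ i → q i + μ * squares ks i)
      even i j s = ∣-diff-+ (q-even i j s) (∣-diff-*ˡ μ (squares-even ks i j s))
      agree : ∀ {i} → i ∈ₗ k ∷ ks → q i + μ * squares ks i ≈ g i
      agree (here refl) = begin
        q k + μ * squares ks k ≈⟨ +-congˡ (*-comm μ _) ⟩
        q k + squares ks k * μ ≈⟨ +-congˡ (proj₂ quotient) ⟨
        q k + (g k - q k) ≈⟨ solve 2 (λ q g → q :+ (g :- q) := g) ≈-refl (q k) (g k) ⟩
        g k ∎
      agree {i} (there i∈) = begin
        q i + μ * squares ks i ≈⟨ +-congˡ (≈-trans (*-congˡ (squares-zero i∈)) (zeroʳ μ)) ⟩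
        q i + 0# ≈⟨ +-identityʳ _ ⟩
        q i ≈⟨ q-ks i∈ ⟩
        g i ∎

    FullyNeg-ext : ∀ {W K} → FullyNeg K → ∀ g → Spline K g →
      Σ (Fin ℓ → Carrier) λ g′ → Spline W g′ × (∀ {i} → i ∈ K → g′ i ≈ g i)
    FullyNeg-ext {W} {K} neg g h = proj₁ q , Even⇒Spline (proj₁ (proj₂ q)) , λ i → proj₂ (proj₂ q) (∈-elements⁺ K i)
      where
      q : Σ (Fin ℓ → Carrier) λ q → Even q × (∀ {k} → k ∈ₗ elements K → q k ≈ g k)
      q = even-interpolate g (elements K) (elements-unique K)
        (λ i j i≢j s → at h (∈-elements⁻ K i) (∈-elements⁻ K j) (FullyNeg⇒E {K} neg (∈-elements⁻ K i) (∈-elements⁻ K j) i≢j s))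

    -- The even spline `e` vanishes on `D`, and every spline vanishing on `D` is a multiple of `e`
    -- at `k` and at `k′`. So `e` splits off from these splines in two ways, with complements the
    -- splines vanishing on `D ⊹ k` and on `D ⊹ k′`. Both represent the quotient by `e`, and the new
    -- basis is the old one projected along `e`.
    module Exchange {W D : VSet ℓ} {k k′ : Fin ℓ} (k∉D : k ∉ D) (k′∉D : k′ ∉ D)
      (neg : FullyNeg (D ⊹ k)) (neg′ : FullyNeg (D ⊹ k′)) (sub : D ⊹ k ⊆ W) (sub′ : D ⊹ k′ ⊆ W) (R : RF W (D ⊹ k)) where
      private module R = RF R

      e : Fin ℓ → Carrier
      e = squares (elements D)

      e-D : ∀ {i} → i ∈ D → e i ≈ 0#
      e-D i∈ = squares-zero (∈-elements⁺ D i∈)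

      ≢-elements : ∀ {v} → v ∉ D → All (_≢ v) (elements D)
      ≢-elements v∉D = All.tabulate λ { d∈ refl → v∉D (∈-elements⁻ D d∈) }

      e-∣ : ∀ {v g} → v ∉ D → FullyNeg (D ⊹ v) → D ⊹ v ⊆ W → Spline W g → (∀ {i} → i ∈ D → g i ≈ 0#) → e v ∣ g v
      e-∣ {v} v∉D ng sb h z = squares-∣ (elements-unique D) (≢-elements v∉D) λ {d} d∈ s →
        let d∈D = ∈-elements⁻ D d∈ in
        ∣-respʳ (≈-trans (+-congˡ (≈-trans (-‿cong (z d∈D)) -0#≈0#)) (+-identityʳ _))
          (at h (sb (inj₂ refl)) (sb (inj₁ d∈D)) (FullyNeg⇒E {D ⊹ v} ng (inj₂ refl) (inj₁ d∈D) (λ { refl → v∉D d∈D }) s))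

      μ : Fin R.rank → Carrier
      μ j = proj₁ (e-∣ k′∉D neg′ sub′ (R.basis-spline j) (λ i → R.basis-zero j (inj₁ i)))

      μ-eq : ∀ j → R.basis j k′ ≈ e k′ * μ j
      μ-eq j = proj₂ (e-∣ k′∉D neg′ sub′ (R.basis-spline j) (λ i → R.basis-zero j (inj₁ i)))

      B : Fin R.rank → Fin ℓ → Carrier
      B j i = R.basis j i - μ j * e i

      comb-B : ∀ f i → comb f B i ≈ comb f R.basis i - ∑ (λ j → f j * μ j) * e i
      comb-B f i = begin
        ∑ (λ j → f j * (R.basis j i - μ j * e i))
          ≈⟨ ∑-cong (λ j → solve 4 (λ f b m e → f :* (b :- m :* e) := f :* b :+ (:- e) :* (f :* m)) ≈-refl (f j) (R.basis j i) (μ j) (e i)) ⟩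
        ∑ (λ j → f j * R.basis j i + (- e i) * (f j * μ j)) ≈⟨ ∑-+ (λ j → f j * R.basis j i) _ ⟩
        comb f R.basis i + ∑ (λ j → (- e i) * (f j * μ j)) ≈⟨ +-congˡ (∑-*ˡ (- e i) (λ j → f j * μ j)) ⟩
        comb f R.basis i + (- e i) * ∑ (λ j → f j * μ j)
          ≈⟨ +-congˡ (solve 2 (λ e s → (:- e) :* s := :- (s :* e)) ≈-refl (e i) _) ⟩
        comb f R.basis i - ∑ (λ j → f j * μ j) * e i ∎

      comb-k′ : ∀ f → comb f R.basis k′ ≈ e k′ * ∑ (λ j → f j * μ j)
      comb-k′ f = ≈-trans (∑-cong (λ j → ≈-trans (*-congˡ (μ-eq j))
          (solve 3 (λ f e m → f :* (e :* m) := e :* (f :* m)) ≈-refl (f j) (e k′) (μ j))))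
        (∑-*ˡ (e k′) (λ j → f j * μ j))

      rf : RF W (D ⊹ k′)
      rf = record
        { ext = FullyNeg-ext {W} {D ⊹ k′} neg′
        ; rank = R.rank
        ; basis = B
        ; basis-spline = λ j → Spline-minus (R.basis-spline j) (Spline-*ˡ (μ j) (Even⇒Spline (squares-even (elements D))))
        ; basis-zero = λ j → λ where
            (inj₁ i∈) → x≈y⇒x∙y⁻¹≈ε (≈-trans (R.basis-zero j (inj₁ i∈)) (≈-sym (≈-trans (*-congˡ (e-D i∈)) (zeroʳ _))))
            (inj₂ refl) → x≈y⇒x∙y⁻¹≈ε (≈-trans (μ-eq j) (*-comm _ _))
        ; span = span
        ; indep = λ f h → R.indep f λ {i} i∈ → begin
            comb f R.basis i ≈⟨ +-identityʳ _ ⟨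
            comb f R.basis i + 0# ≈⟨ +-congˡ -0#≈0# ⟨
            comb f R.basis i - 0# ≈⟨ +-congˡ (-‿cong (≈-trans (*-congʳ (vanish f h)) (zeroˡ _))) ⟨
            comb f R.basis i - ∑ (λ j → f j * μ j) * e i ≈⟨ comb-B f i ⟨
            comb f B i ≈⟨ h i∈ ⟩
            0# ∎ }
        where
        -- At `k` all old basis elements vanish, which leaves a multiple of the non-zero-divisor
        -- `e k`.
        vanish : ∀ f → (∀ {i} → i ∈ W → comb f B i ≈ 0#) → ∑ (λ j → f j * μ j) ≈ 0#
        vanish f h = squares-NZD (≢-elements k∉D) _ (begin
          e k * ∑ (λ j → f j * μ j) ≈⟨ solve 2 (λ e s → e :* s := :- (:- (s :* e))) ≈-refl (e k) _ ⟩
          - (- (∑ (λ j → f j * μ j) * e k)) ≈⟨ -‿cong (+-identityˡ _) ⟨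
          - (0# - ∑ (λ j → f j * μ j) * e k)
            ≈⟨ -‿cong (+-congʳ (∑-0 (λ j → ≈-trans (*-congˡ (R.basis-zero j (inj₂ refl))) (zeroʳ _)))) ⟨
          - (comb f R.basis k - ∑ (λ j → f j * μ j) * e k) ≈⟨ -‿cong (comb-B f k) ⟨
          - comb f B k ≈⟨ -‿cong (h (sub (inj₂ refl))) ⟩
          - 0# ≈⟨ -0#≈0# ⟩
          0# ∎)

        span : ∀ g → Spline W g → (∀ {i} → i ∈ D ⊹ k′ → g i ≈ 0#) →
          Σ (Fin R.rank → Carrier) λ f → ∀ {i} → i ∈ W → g i ≈ comb f B i
        span g h z = f , λ {i} i∈ → begin
          g i ≈⟨ solve 3 (λ g l e → g := (g :- l :* e) :- (:- l) :* e) ≈-refl (g i) ν (e i) ⟩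
          (g i - ν * e i) - (- ν) * e i ≈⟨ +-cong (proj₂ reduced i∈) (-‿cong (*-congʳ sum-μ)) ⟩
          comb f R.basis i - ∑ (λ j → f j * μ j) * e i ≈⟨ comb-B f i ⟨
          comb f B i ∎
          where
          quotient : e k ∣ g k
          quotient = e-∣ k∉D neg sub h (λ i → z (inj₁ i))
          ν : Carrier
          ν = proj₁ quotient
          reduced : Σ (Fin R.rank → Carrier) λ f → ∀ {i} → i ∈ W → g i - ν * e i ≈ comb f R.basis i
          reduced = R.span (λ i → g i - ν * e i) (Spline-minus h (Spline-*ˡ ν (Even⇒Spline (squares-even (elements D))))) λ where
            (inj₁ i∈) → x≈y⇒x∙y⁻¹≈ε (≈-trans (z (inj₁ i∈)) (≈-sym (≈-trans (*-congˡ (e-D i∈)) (zeroʳ _))))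
            (inj₂ refl) → x≈y⇒x∙y⁻¹≈ε (≈-trans (proj₂ quotient) (*-comm _ _))
          f : Fin R.rank → Carrier
          f = proj₁ reduced
          -- Evaluating `reduced` at `k′`, where `g` vanishes, identifies the multiple removed at
          -- `k` with the one introduced by the projections.
          sum-μ : - ν ≈ ∑ (λ j → f j * μ j)
          sum-μ = NZD-cancel (squares-NZD (≢-elements k′∉D)) (begin
            e k′ * - ν ≈⟨ solve 2 (λ e l → e :* (:- l) := :- (l :* e)) ≈-refl (e k′) ν ⟩
            - (ν * e k′) ≈⟨ +-identityˡ _ ⟨
            0# - ν * e k′ ≈⟨ +-congʳ (z (inj₂ refl)) ⟨
            g k′ - ν * e k′ ≈⟨ proj₂ reduced (sub′ (inj₂ refl)) ⟩
            comb f R.basis k′ ≈⟨ comb-k′ f ⟩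
            e k′ * ∑ (λ j → f j * μ j) ∎)

    open Exchange public using () renaming (rf to RF-exchange)

-- Balanced cycles as signed walks.

module BalancedCycles where
  open import Data.Bool using (Bool; true; false; _∧_; if_then_else_)
  open import Data.Nat as ℕ using (zero; suc; _+_; _≤_; _<_; _≤ᵇ_; _<ᵇ_; s≤s)
  import Data.Nat.Properties as ℕ
  open import Data.Nat.DivMod using (_%_; m<n⇒m%n≡m; n%n≡0)
  open import Data.Nat.Divisibility using (_∣_; divides; ∣m∣n⇒∣m+n; ∣-refl; _∣0)
  open import Data.Nat.ListAction using (sum)
  open import Data.Fin using (Fin; zero; suc; toℕ)
  import Data.Fin.Properties as Fin
  open import Data.List using (List; []; _∷_; _++_; length; tabulate)
  open import Data.List.Properties using (map-tabulate; length-++)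
  open import Data.List.Relation.Unary.AllPairs using (AllPairs; []; _∷_)
  open import Data.List.Relation.Unary.All using (All; []; _∷_)
  open import Data.Product using (proj₁; proj₂)
  open import Data.Sum using (_⊎_; inj₁; inj₂)
  open import Data.Empty using (⊥-elim)
  open import Function using (_∘_)
  open import Relation.Nullary using (¬_)
  open import Relation.Nullary.Decidable using (T?)
  open import Relation.Binary.PropositionalEquality using (_≡_; _≢_; refl; cong; cong₂; sym; trans; subst)
  open Signs
  open VertexSets

  -- Counts of negative edges matter modulo two; read as signs, their sums along arcs become
  -- products.
  parity : ℕ → Sign
  parity zero = plus
  parity (suc n) = minus · parity n

  parity-+ : ∀ m n → parity (m + n) ≡ parity m · parity n
  parity-+ zero n = refl
  parity-+ (suc m) n = trans (cong (minus ·_) (parity-+ m n)) (sym (·-assoc minus (parity m) (parity n)))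

  2∣⇒parity : ∀ {n} → 2 ∣ n → parity n ≡ plus
  2∣⇒parity (divides q refl) = even q
    where
    even : ∀ q → parity (q ℕ.* 2) ≡ plus
    even zero = refl
    even (suc q) = trans (sym (·-assoc minus minus _)) (even q)

  parity⇒2∣ : ∀ n → parity n ≡ plus → 2 ∣ n
  parity⇒2∣ zero _ = 2 ∣0
  parity⇒2∣ (suc (suc n)) h = ∣m∣n⇒∣m+n ∣-refl (parity⇒2∣ n (trans (·-assoc minus minus (parity n)) h))

  parity-signVal : ∀ s → parity (signVal s) ≡ s
  parity-signVal plus = refl
  parity-signVal minus = refl

  pick : Bool → Sign → Sign
  pick true s = s
  pick false s = plus

  parity-if : ∀ b s → parity (if b ∧ isMinus s then 1 else 0) ≡ pick b s
  parity-if true plus = refl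
  parity-if true minus = refl
  parity-if false s = refl

  toℕ-nextF-< : ∀ {m} (i : Fin (suc m)) → toℕ i < m → toℕ (nextF i) ≡ suc (toℕ i)
  toℕ-nextF-< {m} i h = trans (Fin.toℕ-fromℕ< _) (m<n⇒m%n≡m (s≤s h))

  toℕ-nextF-last : ∀ {m} (i : Fin (suc m)) → toℕ i ≡ m → toℕ (nextF i) ≡ 0
  toℕ-nextF-last {m} i h = trans (Fin.toℕ-fromℕ< _) (trans (cong (λ k → suc k % suc m) h) (n%n≡0 (suc m)))

  signedGraphAdjacency : ∀ {ℓ} (G : SignedGraph ℓ) → NegInPos G → Adjacency ℓ
  signedGraphAdjacency G sub = record
    { E = Edge G
    ; E? = λ { plus i j → T? _ ; minus i j → T? _ }
    ; E-sym = λ { {plus} → pos-sym G _ _ ; {minus} → neg-sym G _ _ }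
    ; E-irrefl = λ { {plus} {i} e refl → pos-irrefl G i e ; {minus} {i} e refl → neg-irrefl G i e }
    ; E-plus = λ { {plus} e → e ; {minus} e → sub _ _ e } }

  ≤ᵇ-suc : ∀ m n → (suc m ≤ᵇ suc n) ≡ (m ≤ᵇ n)
  ≤ᵇ-suc zero n = refl
  ≤ᵇ-suc (suc m) n = refl

  module Walks {ℓ : ℕ} (Γ : Adjacency ℓ) where
    open Graph Γ

    Step : Set
    Step = Sign × Fin ℓ

    sgn : List Step → Sign
    sgn [] = plus
    sgn ((s , _) ∷ L) = s · sgn L

    sgn-++ : ∀ L M → sgn (L ++ M) ≡ sgn L · sgn M
    sgn-++ [] M = refl
    sgn-++ ((s , _) ∷ L) M = trans (cong (s ·_) (sgn-++ L M)) (sym (·-assoc s (sgn L) (sgn M)))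

    -- Each interior vertex carries the sign of the edge leading to it; the index r
    -- is the sign of the last edge.
    data Walk : Fin ℓ → List Step → Sign → Fin ℓ → Set where
      edge : ∀ {u v r} → E r u v → Walk u [] r v
      step : ∀ {u y L v s r} → E s u y → Walk y L r v → Walk u ((s , y) ∷ L) r v

    Distinct : List Step → Set
    Distinct = AllPairs (λ p q → proj₂ p ≢ proj₂ q)

    -- `B ≢ []` excludes consecutive vertices, and `D ≢ []` the closing edge of the walk. The sign
    -- `sgn B · t` is that of the bypassed arc, including its last edge into `q`; this is what makes
    -- the chord balanced.
    data Chord (u : Fin ℓ) (L : List Step) : Set where
      first : ∀ {t q} B D → L ≡ B ++ (t , q) ∷ D → B ≢ [] → D ≢ [] → E (sgn B · t) u q → Chord u L
      inner : ∀ {s p t q} A B D → L ≡ A ++ (s , p) ∷ B ++ (t , q) ∷ D → B ≢ [] → E (sgn B · t) p q → Chord u L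

    -- `L` lists the vertices other than `u`, so `3 ≤ length L` means a cycle of length at least
    -- four.
    ChordProperty : Set
    ChordProperty = ∀ {u L r} → Walk u L r u → sgn L · r ≡ plus → All (λ p → u ≢ proj₂ p) L → Distinct L →
      3 ≤ length L → Chord u L

    signs : List Step → Sign → ℕ → Sign
    signs [] r _ = r
    signs ((s , _) ∷ L) r zero = s
    signs ((s , _) ∷ L) r (suc i) = signs L r i

    total : List Step → Sign → (ℕ → Bool) → Sign
    total [] r P = pick (P 0) r
    total ((s , _) ∷ L) r P = pick (P 0) s · total L r (P ∘ suc)

    total-cong : ∀ L {r} {P Q : ℕ → Bool} → (∀ i → P i ≡ Q i) → total L r P ≡ total L r Q
    total-cong [] {r} h = cong (λ b → pick b r) (h 0)
    total-cong ((s , _) ∷ L) h = cong₂ _·_ (cong (λ b → pick b s) (h 0)) (total-cong L (h ∘ suc))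

    total-true : ∀ L {r} → total L r (λ _ → true) ≡ sgn L · r
    total-true [] = refl
    total-true ((s , _) ∷ L) {r} = trans (cong (s ·_) (total-true L)) (sym (·-assoc s (sgn L) r))

    total-false : ∀ L {r} → total L r (λ _ → false) ≡ plus
    total-false [] = refl
    total-false (_ ∷ L) = total-false L

    parity-total : ∀ L r (P : ℕ → Bool) →
      parity (sum (tabulate {n = suc (length L)} (λ i → if P (toℕ i) ∧ isMinus (signs L r (toℕ i)) then 1 else 0))) ≡ total L r P
    parity-total [] r P =
      trans (parity-+ (if P 0 ∧ isMinus r then 1 else 0) 0) (trans (·-identityʳ _) (parity-if (P 0) r))
    parity-total ((s , _) ∷ L) r P =
      trans (parity-+ (if P 0 ∧ isMinus s then 1 else 0) _) (cong₂ _·_ (parity-if (P 0) s) (parity-total L r (P ∘ suc)))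

    vert : Fin ℓ → (L : List Step) → Fin (suc (length L)) → Fin ℓ
    vert u L zero = u
    vert u ((_ , y) ∷ L) (suc i) = vert y L i

    vert-∈ : ∀ {P : Fin ℓ → Set} {u L} → P u → All (λ p → P (proj₂ p)) L → ∀ i → P (vert u L i)
    vert-∈ pu _ zero = pu
    vert-∈ {L = _ ∷ _} pu (py ∷ ps) (suc i) = vert-∈ py ps i

    vert-injective : ∀ {u L} → All (λ p → u ≢ proj₂ p) L → Distinct L → ∀ i j → vert u L i ≡ vert u L j → i ≡ j
    vert-injective h d zero zero _ = refl
    vert-injective {u} {_ ∷ L} (h ∷ hs) d zero (suc j) e = ⊥-elim (vert-∈ {P = u ≢_} h hs j e)
    vert-injective {u} {_ ∷ L} (h ∷ hs) d (suc i) zero e = ⊥-elim (vert-∈ {P = u ≢_} h hs i (sym e))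
    vert-injective {u} {_ ∷ L} _ (h ∷ d) (suc i) (suc j) e = cong suc (vert-injective h d i j e)

    -- The head of each edge, by recursion on the list; `after-nextF` reconciles it with the cyclic
    -- successor.
    after : (L : List Step) → Fin ℓ → Fin (suc (length L)) → Fin ℓ
    after [] v _ = v
    after ((_ , y) ∷ L) v zero = y
    after (_ ∷ L) v (suc i) = after L v i

    walk-edges : ∀ {u L r v} → Walk u L r v → ∀ i → E (signs L r (toℕ i)) (vert u L i) (after L v i)
    walk-edges (edge e) zero = e
    walk-edges (step e w) zero = e
    walk-edges (step e w) (suc i) = walk-edges w i

    after-< : ∀ {u} L {v} (i j : Fin (suc (length L))) → toℕ j ≡ suc (toℕ i) → after L v i ≡ vert u L j
    after-< (_ ∷ L) zero (suc zero) _ = refl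
    after-< (_ ∷ L) (suc i) (suc j) e = after-< L i j (ℕ.suc-injective e)

    after-last : ∀ L {v} (i : Fin (suc (length L))) → toℕ i ≡ length L → after L v i ≡ v
    after-last [] zero _ = refl
    after-last (_ ∷ L) (suc i) e = after-last L i (ℕ.suc-injective e)

    after-nextF : ∀ {u} L (i : Fin (suc (length L))) → after L u i ≡ vert u L (nextF i)
    after-nextF {u} L i with ℕ.m≤n⇒m<n∨m≡n (ℕ.≤-pred (Fin.toℕ<n i))
    ... | inj₁ i<m = after-< L i (nextF i) (toℕ-nextF-< i i<m)
    ... | inj₂ e = trans (after-last L i e) (zeroth (nextF i) (toℕ-nextF-last i e))
      where
      zeroth : ∀ (j : Fin (suc (length L))) → toℕ j ≡ 0 → u ≡ vert u L j
      zeroth zero _ = refl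

    -- Edge number `b` enters `q`, so the arc up to `q` consists of the edges `0` to `b`; hence the
    -- bound `suc b`.
    record ArcFrom (u : Fin ℓ) (L : List Step) (r : Sign) (b : ℕ) : Set where
      field
        {B D} : List Step
        {t} : Sign
        {q} : Fin ℓ
        split : L ≡ B ++ (t , q) ∷ D
        length-B : length B ≡ b
        sign : total L r (λ i → i <ᵇ suc b) ≡ sgn B · t

    arcFrom : ∀ u L r b → b < length L → ArcFrom u L r b
    arcFrom u ((s , y) ∷ L) r zero _ = record
      { B = [] ; split = refl ; length-B = refl ; sign = trans (cong (s ·_) (total-false L)) (·-identityʳ s) }
    arcFrom u ((s , y) ∷ L) r (suc b) (s≤s h) with arcFrom y L r b h
    ... | record { B = B ; t = t ; split = sp ; length-B = lB ; sign = sg } = record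
      { B = (s , y) ∷ B ; split = cong ((s , y) ∷_) sp ; length-B = cong suc lB
      ; sign = trans (cong (s ·_) sg) (sym (·-assoc s (sgn B) t)) }

    vert-++ : ∀ u B {t q D} (j : Fin (suc (length (B ++ (t , q) ∷ D)))) → toℕ j ≡ suc (length B) → vert u (B ++ (t , q) ∷ D) j ≡ q
    vert-++ u [] (suc zero) _ = refl
    vert-++ u ((_ , y) ∷ B) (suc j) e = vert-++ y B j (ℕ.suc-injective e)

    -- Indices turn into splittings of the list: steps are peeled off until `i` is zero, then the
    -- rest is cut at `j`.
    findChord : ∀ {u L τ} r (i j : Fin (suc (length L))) → toℕ i + 2 ≤ toℕ j → ¬ (toℕ i ≡ 0 × toℕ j ≡ length L) →
      total L r (λ k → (toℕ i ≤ᵇ k) ∧ (k <ᵇ toℕ j)) ≡ τ → E τ (vert u L i) (vert u L j) → Chord u L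
    findChord {u} {L} r zero (suc j) gap wrap eq e with arcFrom u L r (toℕ j) (Fin.toℕ<n j)
    ... | record { B = B ; D = D ; t = t ; split = refl ; length-B = lB ; sign = sg } = first B D refl
      (λ { refl → ℕ.<⇒≢ (ℕ.≤-pred gap) lB })
      (λ { refl → wrap (refl , trans (cong suc (sym lB)) (sym (trans (length-++ B) (ℕ.+-comm (length B) 1)))) })
      (subst (λ σ → E σ u _) (trans (sym eq) sg) (subst (E _ u) (vert-++ u B (suc j) (cong suc (sym lB))) e))
    findChord {u} {(s , y) ∷ L} {τ} r (suc i) (suc j) gap wrap eq e = shift (search i j (ℕ.≤-pred gap) eq′ e)
      where
      eq′ : total L r (λ k → (toℕ i ≤ᵇ k) ∧ (k <ᵇ toℕ j)) ≡ τ
      eq′ = trans (total-cong L (λ k → cong (_∧ (k <ᵇ toℕ j)) (sym (≤ᵇ-suc (toℕ i) k)))) eq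

      -- The closing edge ends at `u`, not at `y`, so a chord from `y` may reach the last vertex;
      -- the condition `D ≢ []` of `first` is therefore dropped.
      InnerOrFirst : Set
      InnerOrFirst = (Σ (List Step) λ B → Σ (List Step) λ D → Σ Step λ z →
        L ≡ B ++ z ∷ D × B ≢ [] × E (sgn B · proj₁ z) y (proj₂ z)) ⊎ Chord y L

      search : ∀ (i j : Fin (suc (length L))) → toℕ i + 2 ≤ toℕ j →
        total L r (λ k → (toℕ i ≤ᵇ k) ∧ (k <ᵇ toℕ j)) ≡ τ → E τ (vert y L i) (vert y L j) → InnerOrFirst
      search zero (suc j′) gap eq e with arcFrom y L r (toℕ j′) (Fin.toℕ<n j′)
      ... | record { B = B ; D = D ; t = t ; split = refl ; length-B = lB ; sign = sg } =
        inj₁ (B , D , _ , refl , (λ { refl → ℕ.<⇒≢ (ℕ.≤-pred gap) lB }) ,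
          subst (λ σ → E σ y _) (trans (sym eq) sg) (subst (E _ y) (vert-++ y B (suc j′) (cong suc (sym lB))) e))
      search (suc i) j gap eq e = inj₂ (findChord r (suc i) j gap (λ ()) eq e)

      shift : InnerOrFirst → Chord u ((s , y) ∷ L)
      shift (inj₁ (B , D , z , refl , B≢ , e)) = inner [] B D refl B≢ e
      shift (inj₂ (first B D refl B≢ _ e)) = inner [] B D refl B≢ e
      shift (inj₂ (inner A B D refl B≢ e)) = inner ((s , y) ∷ A) B D refl B≢ e

  module ListChords {ℓ : ℕ} (G : SignedGraph ℓ) (sub : NegInPos G) where
    open Walks (signedGraphAdjacency G sub)

    balancedChordal⇒chordProperty : BalancedChordal G → ChordProperty
    balancedChordal⇒chordProperty bc {u} {L} {r} w sg u∉ dist 3≤L = chord (bc C balanced (s≤s 3≤L))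
      where
      C : Cycle G
      C = record
        { m = length L
        ; len≥3 = ℕ.≤-trans 3≤L (ℕ.n≤1+n _)
        ; v = vert u L
        ; v-inj = vert-injective u∉ dist _ _
        ; s = λ i → signs L r (toℕ i)
        ; edges = λ i → subst (Edge G (signs L r (toℕ i)) (vert u L i)) (after-nextF L i) (walk-edges w i) }

      parity-negCount : ∀ (P : ℕ → Bool) → parity (negCount C (λ i → P (toℕ i))) ≡ total L r P
      parity-negCount P = trans
        (cong (λ l → parity (sum l)) (map-tabulate {n = suc (length L)} (λ i → i)
          (λ i → if P (toℕ i) ∧ isMinus (signs L r (toℕ i)) then 1 else 0)))
        (parity-total L r P)

      balanced : Balanced C
      balanced = parity⇒2∣ _ (trans (parity-negCount (λ _ → true)) (trans (total-true L) sg))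

      chord : BalancedChord C → Chord u L
      chord record { a = a ; b = b ; gap = gap ; notWrap = notWrap ; t = t ; chord = e ; bal₁ = bal₁ } =
        findChord r a b gap notWrap arc≡t e
        where
        arc≡t : total L r (λ k → (toℕ a ≤ᵇ k) ∧ (k <ᵇ toℕ b)) ≡ t
        arc≡t = ·≡plus⇒≡ _ t (trans (cong₂ _·_ (sym (parity-negCount _)) (sym (parity-signVal t)))
          (trans (sym (parity-+ (negCount C (inArc a b)) (signVal t))) (2∣⇒parity bal₁)))

-- Simple signed paths and separators.

module SimplePaths where
  open import Data.Nat as ℕ using (zero; suc; _+_; _≤_; _<_; z≤n; s≤s)
  import Data.Nat.Properties as ℕ
  open import Data.Fin using (Fin)
  import Data.Fin as Fin
  import Data.Fin.Properties as Fin
  open import Data.List using (List; []; _∷_; _++_; length; allFin)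
  open import Data.List.Properties using (length-++; ∷-injective; ++-assoc; ++-identityʳ)
  open import Data.List.Relation.Unary.AllPairs using (AllPairs; []; _∷_)
  import Data.List.Relation.Unary.AllPairs.Properties as AllPairs
  open import Data.List.Relation.Unary.All using (All; []; _∷_)
  import Data.List.Relation.Unary.All as All
  import Data.List.Relation.Unary.All.Properties as All
  open import Data.List.Relation.Unary.Any using (here; there)
  open import Data.List.Membership.Propositional using () renaming (_∈_ to _∈ₗ_)
  open import Data.List.Membership.Propositional.Properties using (∈-allFin)
  open import Data.Product using (proj₁; proj₂)
  open import Data.Sum using (_⊎_; inj₁; inj₂)
  open import Data.Empty using (⊥-elim)
  open import Function using (_∘_)
  open import Relation.Nullary using (¬_; yes; no)
  open import Relation.Binary.PropositionalEquality using (_≡_; _≢_; refl; cong; cong₂; sym; trans; subst; module ≡-Reasoning)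
  open Signs
  open VertexSets
  open BalancedCycles

  count : ∀ {ℓ} → VSet ℓ → List (Fin ℓ) → ℕ
  count W [] = 0
  count W (i ∷ is) with mem? W i
  ... | yes _ = suc (count W is)
  ... | no _ = count W is

  ∣_∣ : ∀ {ℓ} → VSet ℓ → ℕ
  ∣_∣ {ℓ} W = count W (allFin ℓ)

  count-≤ : ∀ {ℓ} {U W : VSet ℓ} → U ⊆ W → ∀ is → count U is ≤ count W is
  count-≤ U⊆W [] = z≤n
  count-≤ {U = U} {W} U⊆W (i ∷ is) with mem? U i | mem? W i
  ... | yes _ | yes _ = s≤s (count-≤ U⊆W is)
  ... | yes u | no w = ⊥-elim (w (U⊆W u))
  ... | no _ | yes _ = ℕ.m≤n⇒m≤1+n (count-≤ U⊆W is)
  ... | no _ | no _ = count-≤ U⊆W is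

  count-< : ∀ {ℓ} {U W : VSet ℓ} {v} → U ⊆ W → v ∈ W → v ∉ U → ∀ is → v ∈ₗ is → count U is < count W is
  count-< {U = U} {W} {v} U⊆W v∈W v∉U (i ∷ is) h with mem? U i | mem? W i
  ... | yes u | no w = ⊥-elim (w (U⊆W u))
  ... | no _ | yes _ = s≤s (count-≤ U⊆W is)
  count-< U⊆W v∈W v∉U (i ∷ is) (here refl) | yes u | yes _ = ⊥-elim (v∉U u)
  count-< U⊆W v∈W v∉U (i ∷ is) (there h) | yes _ | yes _ = s≤s (count-< U⊆W v∈W v∉U is h)
  count-< U⊆W v∈W v∉U (i ∷ is) (here refl) | no _ | no w = ⊥-elim (w v∈W)
  count-< U⊆W v∈W v∉U (i ∷ is) (there h) | no _ | no _ = count-< U⊆W v∈W v∉U is h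

  ∣∣-< : ∀ {ℓ} {U W : VSet ℓ} {v} → U ⊆ W → v ∈ W → v ∉ U → ∣ U ∣ < ∣ W ∣
  ∣∣-< {ℓ} U⊆W v∈W v∉U = count-< U⊆W v∈W v∉U (allFin ℓ) (∈-allFin _)

  module Paths {ℓ : ℕ} (Γ : Adjacency ℓ) where
    open Graph Γ
    open Walks Γ

    walk-++ : ∀ {u A s p D r v} → Walk u A s p → Walk p D r v → Walk u (A ++ (s , p) ∷ D) r v
    walk-++ (edge e) w = step e w
    walk-++ (step e w′) w = step e (walk-++ w′ w)

    walk-split : ∀ {u s p D r v} A → Walk u (A ++ (s , p) ∷ D) r v → Walk u A s p × Walk p D r v
    walk-split [] (step e w) = edge e , w
    walk-split (_ ∷ A) (step e w) = let w₁ , w₂ = walk-split A w in step e w₁ , w₂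

    -- Tells on which of two concatenated walks an end of a chord lies.
    locate : ∀ {x} {X : Set x} (xs : List X) {ys} A {a D} → xs ++ ys ≡ A ++ a ∷ D →
      (Σ (List X) λ M → xs ≡ A ++ a ∷ M × D ≡ M ++ ys) ⊎ (Σ (List X) λ M → A ≡ xs ++ M × ys ≡ M ++ a ∷ D)
    locate [] A eq = inj₂ (A , refl , eq)
    locate (x ∷ xs) [] refl = inj₁ (xs , refl , refl)
    locate (x ∷ xs) (b ∷ A) eq with ∷-injective eq
    ... | refl , eq′ with locate xs A eq′
    ... | inj₁ (M , e , e′) = inj₁ (M , cong (x ∷_) e , e′)
    ... | inj₂ (M , e , e′) = inj₂ (M , cong (x ∷_) e , e′)

    distinct-right : ∀ A {D} → Distinct (A ++ D) → Distinct D
    distinct-right [] d = d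
    distinct-right (_ ∷ A) (_ ∷ d) = distinct-right A d

    distinct-left : ∀ A {D} → Distinct (A ++ D) → Distinct A
    distinct-left [] d = []
    distinct-left (_ ∷ A) (h ∷ d) = All.++⁻ˡ A h ∷ distinct-left A d

    distinct-cross : ∀ A {D} → Distinct (A ++ D) → All (λ p → All (λ q → proj₂ p ≢ proj₂ q) D) A
    distinct-cross [] d = []
    distinct-cross (_ ∷ A) (h ∷ d) = All.++⁻ʳ A h ∷ distinct-cross A d

    all-resign : ∀ (P : Fin ℓ → Set) (A : List Step) {s t q D} → All (P ∘ proj₂) (A ++ (s , q) ∷ D) → All (P ∘ proj₂) (A ++ (t , q) ∷ D)
    all-resign P [] (h ∷ hs) = h ∷ hs
    all-resign P (_ ∷ A) (h ∷ hs) = h ∷ all-resign P A hs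

    distinct-resign : ∀ A {s t q D} → Distinct (A ++ (s , q) ∷ D) → Distinct (A ++ (t , q) ∷ D)
    distinct-resign [] (h ∷ d) = h ∷ d
    distinct-resign ((_ , a) ∷ A) (h ∷ d) = all-resign (a ≢_) A h ∷ distinct-resign A d

    all-drop : ∀ {P : Step → Set} A B {D} → All P (A ++ B ++ D) → All P (A ++ D)
    all-drop A B h = All.++⁺ (All.++⁻ˡ A h) (All.++⁻ʳ B (All.++⁻ʳ A h))

    distinct-drop : ∀ A B {D} → Distinct (A ++ B ++ D) → Distinct (A ++ D)
    distinct-drop [] B d = distinct-right B d
    distinct-drop (_ ∷ A) B (h ∷ d) = all-drop A B h ∷ distinct-drop A B d

    -- Only the interior vertices are asked to lie in `X`, and the sign counts every edge, including
    -- the last.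
    record Path (X : VSet ℓ) (u : Fin ℓ) (s : Sign) (v : Fin ℓ) : Set where
      constructor path
      field
        {steps} : List Step
        {last} : Sign
        walk : Walk u steps last v
        sign : sgn steps · last ≡ s
        distinct : Distinct steps
        inside : All (λ p → proj₂ p ∈ X) steps
      size : ℕ
      size = length steps
    open Path using (size)

    path-edge : ∀ {X u s v} → E s u v → Path X u s v
    path-edge e = path (edge e) refl [] []

    path-mono : ∀ {X X′ u s v} → X ⊆ X′ → Path X u s v → Path X′ u s v
    path-mono h (path w sg d ins) = path w sg d (All.map h ins)

    path-cons : ∀ {X u y s t v} → E t u y → y ∉ X → Path X y s v → Path (X ⊹ y) u (t · s) v
    path-cons {X} {t = t} e y∉ (path {L} w sg d ins) = path (step e w) (trans (·-assoc t (sgn L) _) (cong (t ·_) sg))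
      (All.map (λ {p} h e → y∉ (subst (_∈ X) (sym e) h)) ins ∷ d)
      (inj₂ refl ∷ All.map inj₁ ins)

    -- A step carries the sign of its incoming edge, so reversal shifts the signs by one place and
    -- is not plain list reversal; what later proofs need of the list is recorded instead.
    record Reversed (u : Fin ℓ) (L : List Step) (r : Sign) (v : Fin ℓ) : Set₁ where
      field
        {steps} : List Step
        {last} : Sign
        walk : Walk v steps last u
        sign : sgn steps · last ≡ sgn L · r
        distinct : Distinct L → Distinct steps
        inside : ∀ {P : Fin ℓ → Set} → All (P ∘ proj₂) L → All (P ∘ proj₂) steps

    reversed : ∀ {u L r v} → Walk u L r v → Reversed u L r v
    reversed (edge e) = record { walk = edge (E-sym e) ; sign = refl ; distinct = λ d → d ; inside = λ h → h }
    reversed (step {u} {y} {L} {v} {s} {r} e w) = record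
      { walk = walk-++ R.walk (edge (E-sym e))
      ; sign = begin
          sgn (R.steps ++ (R.last , y) ∷ []) · s ≡⟨ cong (_· s) (sgn-++ R.steps _) ⟩
          (sgn R.steps · (R.last · plus)) · s ≡⟨ cong (λ z → (sgn R.steps · z) · s) (·-identityʳ R.last) ⟩
          (sgn R.steps · R.last) · s ≡⟨ ·-comm _ s ⟩
          s · (sgn R.steps · R.last) ≡⟨ cong (s ·_) R.sign ⟩
          s · (sgn L · r) ≡⟨ ·-assoc s (sgn L) r ⟨
          (s · sgn L) · r ∎
      ; distinct = λ { (h ∷ d) → AllPairs.++⁺ (R.distinct d) ([] ∷ [])
          (All.map (λ n → (λ e → n (sym e)) ∷ []) (R.inside {P = y ≢_} h)) }
      ; inside = λ { {P} (h ∷ hs) → All.++⁺ (R.inside {P} hs) (h ∷ []) } }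
      where
      module R = Reversed (reversed w)
      open ≡-Reasoning

    path-sym : ∀ {X u s v} → Path X u s v → Path X v s u
    path-sym {X} (path w sg d ins) = path R.walk (trans R.sign sg) (R.distinct d) (R.inside {P = _∈ X} ins)
      where module R = Reversed (reversed w)

    path-snoc : ∀ {X u y s t v} → Path X u s y → y ∉ X → E t y v → Path (X ⊹ y) u (s · t) v
    path-snoc {s = s} {t} π y∉ e = path-sym (subst (λ σ → Path _ _ σ _) (·-comm t s) (path-cons (E-sym e) y∉ (path-sym π)))

    ·-solve : ∀ {a b s} → a · b ≡ s → b ≡ s · a
    ·-solve {plus} {plus} refl = refl
    ·-solve {plus} {minus} refl = refl
    ·-solve {minus} {plus} refl = refl
    ·-solve {minus} {minus} refl = refl

    sgn-mid : ∀ B {t q} D → sgn (B ++ (t , q) ∷ D) ≡ (sgn B · t) · sgn D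
    sgn-mid B {t} D = trans (sgn-++ B _) (sym (·-assoc (sgn B) t (sgn D)))

    length-grow : ∀ {x} {X : Set x} (B : List X) {D} → B ≢ [] → suc (length D) ≤ length (B ++ D)
    length-grow [] h = ⊥-elim (h refl)
    length-grow (_ ∷ B) {D} _ = s≤s (ℕ.≤-trans (ℕ.m≤n+m (length D) (length B)) (ℕ.≤-reflexive (sym (length-++ B))))

    distinct-cut : ∀ A {p B} → Distinct (A ++ p ∷ B) → Distinct (A ++ p ∷ [])
    distinct-cut [] (_ ∷ _) = [] ∷ []
    distinct-cut (_ ∷ A) (h ∷ d) = All.++⁺ (All.++⁻ˡ A h) (All.head (All.++⁻ʳ A h) ∷ []) ∷ distinct-cut A d

    all-cut : ∀ {P : Step → Set} A {p B} → All P (A ++ p ∷ B) → All P (A ++ p ∷ [])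
    all-cut A h = All.++⁺ (All.++⁻ˡ A h) (All.head (All.++⁻ʳ A h) ∷ [])

    at : ∀ {P : Fin ℓ → Set} {L A : List Step} {σ p B} → All (P ∘ proj₂) L → L ≡ A ++ (σ , p) ∷ B → P p
    at {A = A} h refl = All.head (All.++⁻ʳ A h)

    Shorter : ∀ {X u s v} → Path X u s v → Set
    Shorter {X} {u} {s} {v} π = Σ (Path X u s v) λ π′ → size π′ < size π

    -- A chord with the sign of the arc it bypasses leaves the sign of the path unchanged. This and
    -- the next two lemmas treat chords from the initial vertex, between interior vertices, and to
    -- the final vertex.
    shorten-first : ∀ {X u s v} (π : Path X u s v) {t q} B D → Path.steps π ≡ B ++ (t , q) ∷ D → B ≢ [] →
      E (sgn B · t) u q → Shorter π
    shorten-first (path {last = r} w sg d ins) {t} B D refl B≢ e =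
      path (step e (proj₂ (walk-split B w))) (trans (cong (_· r) (sym (sgn-mid B D))) sg)
        (distinct-resign [] (distinct-right B d)) (all-resign _ [] (All.++⁻ʳ B ins))
      , length-grow B B≢

    shorten-inner : ∀ {X u s v} (π : Path X u s v) {σ p t q} A B D → Path.steps π ≡ A ++ (σ , p) ∷ B ++ (t , q) ∷ D → B ≢ [] →
      E (sgn B · t) p q → Shorter π
    shorten-inner (path {last = r} w sg d ins) {σ} {p} {t} {q} A B D refl B≢ e =
      path (walk-++ (proj₁ (walk-split A w)) (step e (proj₂ (walk-split B (proj₂ (walk-split A w))))))
        (trans (cong (_· r) sgn-eq) sg)
        (distinct-reassoc (distinct-resign (A ++ (σ , p) ∷ []) (distinct-drop (A ++ (σ , p) ∷ []) B (distinct-assoc d))))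
        (all-reassoc (all-resign _ (A ++ (σ , p) ∷ []) (all-drop (A ++ (σ , p) ∷ []) B (all-assoc ins))))
      , bound A
      where
      distinct-assoc : ∀ {D} → Distinct (A ++ (σ , p) ∷ D) → Distinct ((A ++ (σ , p) ∷ []) ++ D)
      distinct-assoc {D} = subst Distinct (sym (++-assoc A _ D))
      distinct-reassoc : ∀ {D} → Distinct ((A ++ (σ , p) ∷ []) ++ D) → Distinct (A ++ (σ , p) ∷ D)
      distinct-reassoc {D} = subst Distinct (++-assoc A _ D)
      all-assoc : ∀ {P : Step → Set} {D} → All P (A ++ (σ , p) ∷ D) → All P ((A ++ (σ , p) ∷ []) ++ D)
      all-assoc {P} {D} = subst (All P) (sym (++-assoc A _ D))
      all-reassoc : ∀ {P : Step → Set} {D} → All P ((A ++ (σ , p) ∷ []) ++ D) → All P (A ++ (σ , p) ∷ D)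
      all-reassoc {P} {D} = subst (All P) (++-assoc A _ D)
      sgn-eq : sgn (A ++ (σ , p) ∷ (sgn B · t , q) ∷ D) ≡ sgn (A ++ (σ , p) ∷ B ++ (t , q) ∷ D)
      sgn-eq = trans (sgn-mid A _) (trans (cong ((sgn A · σ) ·_) (sym (sgn-mid B D))) (sym (sgn-mid A _)))
      bound : ∀ A → suc (length (A ++ (σ , p) ∷ (sgn B · t , q) ∷ D)) ≤ length (A ++ (σ , p) ∷ B ++ (t , q) ∷ D)
      bound [] = s≤s (length-grow B B≢)
      bound (_ ∷ A) = s≤s (bound A)

    shorten-last : ∀ {X u s v} (π : Path X u s v) {σ p} A B → Path.steps π ≡ A ++ (σ , p) ∷ B → B ≢ [] →
      E (sgn B · Path.last π) p v → Shorter π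
    shorten-last (path {last = r} w sg d ins) {σ} {p} A B refl B≢ e =
      path (walk-++ (proj₁ (walk-split A w)) (edge e)) sgn-eq
        (distinct-cut A d) (all-cut A ins)
      , bound A B B≢
      where
      open ≡-Reasoning
      sgn-eq : sgn (A ++ (σ , p) ∷ []) · (sgn B · r) ≡ _
      sgn-eq = begin
        sgn (A ++ (σ , p) ∷ []) · (sgn B · r) ≡⟨ cong (_· (sgn B · r)) (trans (sgn-mid A []) (·-identityʳ _)) ⟩
        (sgn A · σ) · (sgn B · r) ≡⟨ ·-assoc (sgn A · σ) (sgn B) r ⟨
        ((sgn A · σ) · sgn B) · r ≡⟨ cong (_· r) (sgn-mid A B) ⟨
        sgn (A ++ (σ , p) ∷ B) · r ≡⟨ sg ⟩
        _ ∎
      bound : ∀ A B → B ≢ [] → suc (length (A ++ (σ , p) ∷ [])) ≤ length (A ++ (σ , p) ∷ B)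
      bound [] [] h = ⊥-elim (h refl)
      bound [] (_ ∷ B) _ = s≤s (s≤s z≤n)
      bound (_ ∷ A) B h = s≤s (bound A B h)

    -- The two arcs between vertices of a balanced closed walk have the same sign; a chord found
    -- with the sign of one arc can thus replace the other.
    crossing : ∀ {ys B D xs : List Step} {t g r s τ q} → sgn ys · t ≡ s → xs ≡ B ++ (τ , q) ∷ D → sgn xs · r ≡ s →
      sgn (ys ++ (t , g) ∷ B) · τ ≡ sgn D · r
    crossing {ys} {B} {D} {t = t} {g} {r} {s} {τ} sg refl sg′ = begin
      sgn (ys ++ (t , g) ∷ B) · τ ≡⟨ cong (_· τ) (sgn-mid ys B) ⟩
      ((sgn ys · t) · sgn B) · τ ≡⟨ ·-assoc (sgn ys · t) (sgn B) τ ⟩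
      (sgn ys · t) · (sgn B · τ) ≡⟨ cong (_· (sgn B · τ)) sg ⟩
      s · (sgn B · τ) ≡⟨ ·-solve {sgn B · τ} {sgn D · r} (trans (sym (·-assoc (sgn B · τ) (sgn D) r)) (trans (cong (_· r) (sym (sgn-mid B D))) sg′)) ⟨
      sgn D · r ∎
      where open ≡-Reasoning

    Separated : VSet ℓ → VSet ℓ → Set
    Separated X Y = (∀ {i} → i ∈ X → i ∉ Y) × (∀ {i j s} → i ∈ X → j ∈ Y → ¬ E s i j)

    Avoids : Fin ℓ → VSet ℓ → VSet ℓ → Set
    Avoids v X Y = v ∉ X × v ∉ Y

    all-≢ : ∀ X {v} {L : List Step} → v ∉ X → All (λ p → proj₂ p ∈ X) L → All (λ p → v ≢ proj₂ p) L
    all-≢ X v∉ = All.map (λ h e → v∉ (subst (_∈ X) (sym e) h))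

    -- Two paths with the same sign on both sides of a separator: the chords of the
    -- closed walk they form shorten one of them, until one is a single edge.
    module Separation (cp : ChordProperty) {X Y : VSet ℓ} (sep : Separated X Y) where
      private
        cross : ∀ {i j s} → i ∈ X → j ∈ Y → ¬ E s i j
        cross = proj₂ sep

      opposite : ∀ n {f f₀ s} → Avoids f X Y → Avoids f₀ X Y → f ≢ f₀ →
        (π : Path X f s f₀) (κ : Path Y f₀ s f) → size π + size κ ≤ n → E s f f₀
      opposite n _ _ _ (path (edge e) refl _ _) κ _ = e
      opposite n _ _ _ (path (step _ _) _ _ _) (path (edge e) refl _ _) _ = E-sym e
      opposite zero _ _ _ (path (step _ _) _ _ _) (path (step _ _) _ _ _) ()
      opposite (suc n) {f} {f₀} {s} af af₀ f≢f₀
        π@(path {xs@(x ∷ xs′)} {r} w₁@(step _ _) sg₁ d₁ in₁) κ@(path {ys@(y ∷ ys′)} {t} w₂@(step _ _) sg₂ d₂ in₂) bound =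
        resolve (cp (walk-++ w₂ w₁) closed-sign (All.++⁺ (all-≢ Y (proj₂ af₀) in₂) ((f≢f₀ ∘ sym) ∷ all-≢ X (proj₁ af₀) in₁))
          (AllPairs.++⁺ d₂ (all-≢ X (proj₁ af) in₁ ∷ d₁)
            (All.map (λ h → (λ e → proj₂ af (subst (_∈ Y) e h)) ∷ all-≢ X (λ h′ → proj₁ sep h′ h) in₁) in₂))
          (s≤s (ℕ.≤-trans (s≤s (s≤s z≤n)) (ℕ.≤-trans (ℕ.m≤n+m _ (length ys′)) (ℕ.≤-reflexive (sym (length-++ ys′)))))))
        where
        closed-sign : sgn (ys ++ (t , f) ∷ xs) · r ≡ plus
        closed-sign = begin
          sgn (ys ++ (t , f) ∷ xs) · r ≡⟨ cong (_· r) (sgn-mid ys xs) ⟩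
          ((sgn ys · t) · sgn xs) · r ≡⟨ ·-assoc (sgn ys · t) (sgn xs) r ⟩
          (sgn ys · t) · (sgn xs · r) ≡⟨ cong₂ _·_ sg₂ sg₁ ⟩
          s · s ≡⟨ ·-self s ⟩
          plus ∎
          where open ≡-Reasoning

        again₁ : Shorter π → E s f f₀
        again₁ (π′ , lt) = opposite n af af₀ f≢f₀ π′ κ (ℕ.≤-pred (ℕ.≤-trans (ℕ.+-monoˡ-≤ (size κ) lt) bound))

        again₂ : Shorter κ → E s f f₀
        again₂ (κ′ , lt) = opposite n af af₀ f≢f₀ π κ′
          (ℕ.≤-pred (ℕ.≤-trans (ℕ.≤-reflexive (sym (ℕ.+-suc (size π) (size κ′)))) (ℕ.≤-trans (ℕ.+-monoʳ-≤ (size π) lt) bound)))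

        resolve : Chord f₀ (ys ++ (t , f) ∷ xs) → E s f f₀
        resolve (first B D eq B≢ D≢ e) with locate ys B eq
        ... | inj₁ (M , eq′ , _) = again₂ (shorten-first κ B M eq′ B≢ e)
        -- The chord joins `f₀` to `f` and bypasses all of `κ`, so it has the wanted sign.
        ... | inj₂ ([] , refl , refl) = subst (λ σ → E σ f f₀) sg₂′ (E-sym e)
          where
          sg₂′ : sgn (ys ++ []) · t ≡ s
          sg₂′ = trans (cong (_· t) (trans (sgn-++ ys []) (·-identityʳ _))) sg₂
        ... | inj₂ (_ ∷ M , refl , eq′) with ∷-injective eq′
        ... | refl , eq″ = again₁ (shorten-last π M D eq″ D≢ (E-sym (subst (λ σ → E σ f₀ _) (crossing {ys} sg₂ eq″ sg₁) e)))
        resolve (inner A B D eq B≢ e) with locate ys A eq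
        ... | inj₂ ([] , _ , eq′) with ∷-injective eq′
        ... | refl , eq″ = again₁ (shorten-first π B D eq″ B≢ e)
        resolve (inner A B D eq B≢ e) | inj₂ (_ ∷ M , _ , eq′) with ∷-injective eq′
        ... | refl , eq″ = again₁ (shorten-inner π M B D eq″ B≢ e)
        resolve (inner A B D eq B≢ e) | inj₁ (M , eq₁ , eq₂) with locate M B (sym eq₂)
        ... | inj₁ (M′ , refl , _) = again₂ (shorten-inner κ A B M′ eq₁ B≢ e)
        ... | inj₂ ([] , refl , eq₃) with ∷-injective eq₃
        ... | refl , _ = again₂ (shorten-last κ A M eq₁ (λ { refl → B≢ refl }) (subst (λ σ → E (sgn σ · t) _ _) (++-identityʳ M) e))
        resolve (inner A B D eq B≢ e) | inj₁ (M , eq₁ , eq₂) | inj₂ (_ ∷ M′ , refl , eq₃) with ∷-injective eq₃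
        ... | refl , eq₄ = ⊥-elim (cross (at in₁ eq₄) (at in₂ eq₁) (E-sym e))

      -- The argument of `opposite` with the positive edge `g f` closing the gap between the paths.
      -- Chords inside a path shorten it, and a chord from `g` into `X` or from `f` into `Y`
      -- produces two paths with common ends, to which `opposite` applies.
      adjacent : ∀ n {f g f₀ s} → Avoids f X Y → Avoids g X Y → Avoids f₀ X Y → f ≢ f₀ → g ≢ f₀ → E plus g f →
        (π : Path X f s f₀) (κ : Path Y f₀ s g) → size π + size κ ≤ n → E s f f₀ ⊎ E s f₀ g
      adjacent n _ _ _ _ _ _ (path (edge e) refl _ _) κ _ = inj₁ e
      adjacent n _ _ _ _ _ _ (path (step _ _) _ _ _) (path (edge e) refl _ _) _ = inj₂ e
      adjacent zero _ _ _ _ _ _ (path (step _ _) _ _ _) (path (step _ _) _ _ _) ()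
      adjacent (suc n) {f} {g} {f₀} {s} af ag af₀ f≢f₀ g≢f₀ gf
        π@(path {xs@(x ∷ xs′)} {r} w₁@(step _ _) sg₁ d₁ in₁) κ@(path {ys@(y ∷ ys′)} {t} w₂@(step _ _) sg₂ d₂ in₂) bound =
        resolve (cp (walk-++ w₂ (step gf w₁)) closed-sign
          (All.++⁺ (all-≢ Y (proj₂ af₀) in₂) ((g≢f₀ ∘ sym) ∷ (f≢f₀ ∘ sym) ∷ all-≢ X (proj₁ af₀) in₁))
          (AllPairs.++⁺ d₂ ((E-irrefl gf ∷ all-≢ X (proj₁ ag) in₁) ∷ all-≢ X (proj₁ af) in₁ ∷ d₁)
            (All.map (λ h → (λ e → proj₂ ag (subst (_∈ Y) e h)) ∷ (λ e → proj₂ af (subst (_∈ Y) e h)) ∷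
              all-≢ X (λ h′ → proj₁ sep h′ h) in₁) in₂))
          (s≤s (ℕ.≤-trans (s≤s (s≤s z≤n)) (ℕ.≤-trans (ℕ.m≤n+m _ (length ys′)) (ℕ.≤-reflexive (sym (length-++ ys′)))))))
        where
        closed-sign : sgn (ys ++ (t , g) ∷ (plus , f) ∷ xs) · r ≡ plus
        closed-sign = begin
          sgn (ys ++ (t , g) ∷ (plus , f) ∷ xs) · r ≡⟨ cong (_· r) (sgn-mid ys ((plus , f) ∷ xs)) ⟩
          ((sgn ys · t) · sgn xs) · r ≡⟨ ·-assoc (sgn ys · t) (sgn xs) r ⟩
          (sgn ys · t) · (sgn xs · r) ≡⟨ cong₂ _·_ sg₂ sg₁ ⟩
          s · s ≡⟨ ·-self s ⟩
          plus ∎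
          where open ≡-Reasoning

        again₁ : Shorter π → E s f f₀ ⊎ E s f₀ g
        again₁ (π′ , lt) = adjacent n af ag af₀ f≢f₀ g≢f₀ gf π′ κ (ℕ.≤-pred (ℕ.≤-trans (ℕ.+-monoˡ-≤ (size κ) lt) bound))

        again₂ : Shorter κ → E s f f₀ ⊎ E s f₀ g
        again₂ (κ′ , lt) = adjacent n af ag af₀ f≢f₀ g≢f₀ gf π κ′
          (ℕ.≤-pred (ℕ.≤-trans (ℕ.≤-reflexive (sym (ℕ.+-suc (size π) (size κ′)))) (ℕ.≤-trans (ℕ.+-monoʳ-≤ (size π) lt) bound)))

        end-sign : ∀ M → sgn (M ++ (t , g) ∷ []) · plus ≡ sgn M · t
        end-sign M = trans (·-identityʳ _) (trans (sgn-mid M []) (·-identityʳ _))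

        resolve : Chord f₀ (ys ++ (t , g) ∷ (plus , f) ∷ xs) → E s f f₀ ⊎ E s f₀ g
        resolve (first B D eq B≢ D≢ e) with locate ys B eq
        ... | inj₁ (M , eq′ , _) = again₂ (shorten-first κ B M eq′ B≢ e)
        ... | inj₂ ([] , refl , refl) = inj₂ (subst (λ σ → E σ f₀ g) (trans (cong (λ l → sgn l · t) (++-identityʳ ys)) sg₂) e)
        ... | inj₂ (_ ∷ [] , refl , refl) = inj₁ (subst (λ σ → E σ f f₀) (trans (end-sign ys) sg₂) (E-sym e))
        ... | inj₂ (_ ∷ _ ∷ M , refl , eq′) with ∷-injective eq′
        ... | refl , eq″ with ∷-injective eq″
        ... | refl , eq‴ = again₁ (shorten-last π M D eq‴ D≢
              (E-sym (subst (λ σ → E σ f₀ _) (crossing {ys} {(plus , f) ∷ M} sg₂ (cong ((plus , f) ∷_) eq‴) sg₁) e)))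
        resolve (inner A B D eq B≢ e) with locate ys A eq
        resolve (inner A B D eq B≢ e) | inj₂ ([] , _ , eq′) with ∷-injective eq′
        resolve (inner A [] D eq B≢ e) | inj₂ ([] , _ , eq′) | refl , eq″ = ⊥-elim (B≢ refl)
        resolve (inner A (_ ∷ B) D eq B≢ e) | inj₂ ([] , _ , eq′) | refl , eq″ with ∷-injective eq″
        -- The chord leads from `g` into `X`, so `g` and `f₀` are now joined with sign `s` on both
        -- sides.
        ... | refl , eq‴ = inj₂ (E-sym (opposite _ ag af₀ g≢f₀ π′ κ ℕ.≤-refl))
          where
          π′ : Path X g s f₀
          π′ = path (step e (proj₂ (walk-split B (subst (λ l → Walk f l r f₀) eq‴ w₁))))
            (trans (cong (_· r) (sym (sgn-mid B D))) (subst (λ l → sgn l · r ≡ s) eq‴ sg₁))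
            (distinct-resign [] (distinct-right B (subst Distinct eq‴ d₁)))
            (all-resign _ [] (All.++⁻ʳ B (subst (All _) eq‴ in₁)))
        resolve (inner A B D eq B≢ e) | inj₂ (_ ∷ [] , _ , eq′) with ∷-injective eq′
        ... | refl , eq″ with ∷-injective eq″
        ... | refl , eq‴ = again₁ (shorten-first π B D eq‴ B≢ e)
        resolve (inner A B D eq B≢ e) | inj₂ (_ ∷ _ ∷ M , _ , eq′) with ∷-injective eq′
        ... | refl , eq″ with ∷-injective eq″
        ... | refl , eq‴ = again₁ (shorten-inner π M B D eq‴ B≢ e)
        resolve (inner A B D eq B≢ e) | inj₁ (M , eq₁ , eq₂) with locate M B (sym eq₂)
        ... | inj₁ (M′ , refl , _) = again₂ (shorten-inner κ A B M′ eq₁ B≢ e)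
        ... | inj₂ ([] , refl , eq₃) with ∷-injective eq₃
        ... | refl , _ = again₂ (shorten-last κ A M eq₁ (λ { refl → B≢ refl }) (subst (λ l → E (sgn l · t) _ _) (++-identityʳ M) e))
        resolve (inner {s = σ} {p = p} A B D eq B≢ e) | inj₁ (M , eq₁ , eq₂) | inj₂ (_ ∷ [] , refl , eq₃) with ∷-injective eq₃
        ... | refl , eq₄ with ∷-injective eq₄
        -- The chord leads from `Y` to `f`, so `f` and `f₀` are now joined with sign `s` on both
        -- sides.
        ... | refl , _ = inj₁ (opposite _ af af₀ f≢f₀ π κ′ ℕ.≤-refl)
          where
          κ′ : Path Y f₀ s f
          κ′ = path (walk-++ (proj₁ (walk-split A (subst (λ l → Walk f₀ l t g) eq₁ w₂))) (edge e))
            (begin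
              sgn (A ++ (σ , p) ∷ []) · (sgn (M ++ (t , g) ∷ []) · plus)
                ≡⟨ cong₂ _·_ (trans (sgn-mid A []) (·-identityʳ _)) (end-sign M) ⟩
              (sgn A · σ) · (sgn M · t) ≡⟨ ·-assoc (sgn A · σ) (sgn M) t ⟨
              ((sgn A · σ) · sgn M) · t ≡⟨ cong (_· t) (sgn-mid A M) ⟨
              sgn (A ++ (σ , p) ∷ M) · t ≡⟨ subst (λ l → sgn l · t ≡ s) eq₁ sg₂ ⟩
              s ∎)
            (distinct-cut A (subst Distinct eq₁ d₂)) (all-cut A (subst (All _) eq₁ in₂))
            where open ≡-Reasoning
        resolve (inner A B D eq B≢ e) | inj₁ (M , eq₁ , eq₂) | inj₂ (_ ∷ _ ∷ M′ , refl , eq₃) with ∷-injective eq₃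
        ... | refl , eq₄ with ∷-injective eq₄
        ... | refl , eq₅ = ⊥-elim (cross (at in₁ eq₅) (at in₂ eq₁) (E-sym e))

      separation : ∀ {f g f₀ s} → Avoids f X Y → Avoids g X Y → Avoids f₀ X Y → f ≢ f₀ → g ≢ f₀ → f ≡ g ⊎ E plus g f →
        Path X f s f₀ → Path Y f₀ s g → E s f f₀ ⊎ E s f₀ g
      separation af ag af₀ f≢ g≢ (inj₁ refl) π κ = inj₁ (opposite _ af af₀ f≢ π κ ℕ.≤-refl)
      separation af ag af₀ f≢ g≢ (inj₂ gf) π κ = adjacent _ af ag af₀ f≢ g≢ gf π κ ℕ.≤-refl

-- Components, negative links, and the dichotomy between two sides.

module Connectivity where
  open import Data.Nat as ℕ using (zero; suc; _≤_; _<_; z≤n; s≤s)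
  import Data.Nat.Properties as ℕ
  open import Data.Fin using (Fin)
  import Data.Fin as Fin
  import Data.Fin.Properties as Fin
  open import Data.List using (List; []; _∷_; _++_)
  open import Data.List.Relation.Unary.AllPairs using (AllPairs; []; _∷_)
  import Data.List.Relation.Unary.AllPairs.Properties as AllPairs
  open import Data.List.Relation.Unary.All using (All; []; _∷_)
  import Data.List.Relation.Unary.All as All
  import Data.List.Relation.Unary.All.Properties as All
  open import Data.List.Membership.Propositional using () renaming (_∈_ to _∈ₗ_)
  open import Data.List.Relation.Unary.Any using (Any; here; there; any?)
  open import Data.Product using (proj₁; proj₂)
  open import Data.Sum using (_⊎_; inj₁; inj₂)
  import Data.Sum as Sum
  open import Data.List.Properties using (∷-injectiveʳ)
  open import Data.Empty using (⊥; ⊥-elim)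
  open import Function using (_∘_)
  open import Relation.Nullary using (¬_; Dec; yes; no)
  open import Relation.Nullary.Decidable using (map′; _×-dec_; _⊎-dec_)
  open import Relation.Binary.PropositionalEquality using (_≡_; _≢_; refl; cong; sym; trans; subst)
  open Signs
  open VertexSets
  open BalancedCycles
  open SimplePaths

  module Components {ℓ : ℕ} (Γ : Adjacency ℓ) where
    open Graph Γ
    open Walks Γ
    open Paths Γ

    path-step : ∀ {Y u s v t y} → y ∈ Y → E t u y → Path (Y ∖ˢ y) y (t · s) v → Path Y u s v
    path-step {s = s} {t = t} y∈ e (path {L} w sg d ins) =
      path (step e w) (trans (·-assoc t (sgn L) _) (trans (cong (t ·_) sg) (trans (sym (·-assoc t t s)) (cong (_· s) (·-self t)))))
        (All.map (λ h e → proj₂ h (sym e)) ins ∷ d) (y∈ ∷ All.map proj₁ ins)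

    path-unstep : ∀ {Y u s v} → Path Y u s v →
      E s u v ⊎ Σ (Fin ℓ) λ y → y ∈ Y × Σ Sign λ t → E t u y × Path (Y ∖ˢ y) y (t · s) v
    path-unstep (path (edge e) refl _ _) = inj₁ e
    path-unstep (path {(t , y) ∷ L} {r} (step e w) refl (h ∷ d) (y∈ ∷ ins)) =
      inj₂ (y , y∈ , t , e , path w
        (sym (trans (cong (t ·_) (·-assoc t (sgn L) r)) (trans (sym (·-assoc t t _)) (cong (_· (sgn L · r)) (·-self t))))) d
        (All.zipWith (λ { (h , h′) → h′ , λ e → h (sym e) }) (h , ins)))

    -- Depth-first search: every step removes its vertex from `Y`, which keeps the path simple and
    -- bounds the depth.
    path?′ : ∀ n Y → ∣ Y ∣ ≤ n → ∀ u s v → Dec (Path Y u s v)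
    path?′ zero Y h u s v = map′ path-edge (λ π → Sum.fromInj₁ (λ { (y , y∈ , _) →
      ⊥-elim (ℕ.<⇒≱ (∣∣-< {U = Y ∖ˢ y} {Y} proj₁ y∈ (λ h → proj₂ h refl)) (ℕ.≤-trans h z≤n)) }) (path-unstep π)) (E? s u v)
    path?′ (suc n) Y h u s v = map′
      (λ { (inj₁ e) → path-edge e ; (inj₂ (y , t , (y∈ , e) , π)) → path-step y∈ e (π y∈) })
      (λ π → Sum.map₂ (λ { (y , y∈ , t , e , π) → y , t , (y∈ , e) , λ _ → π }) (path-unstep π))
      (E? s u v ⊎-dec Fin.any? λ y → anySign? λ t → guarded y t)
      where
      -- The recursive call is made only for `y ∈ Y`, for otherwise removing `y` does not shrink the
      -- set.
      guarded : ∀ y t → Dec ((y ∈ Y × E t u y) × (y ∈ Y → Path (Y ∖ˢ y) y (t · s) v))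
      guarded y t with mem? Y y
      ... | no y∉ = no (y∉ ∘ proj₁ ∘ proj₁)
      ... | yes y∈ = map′ (λ { (e , π) → (y∈ , e) , λ _ → π }) (λ { ((_ , e) , π) → e , π y∈ })
        (E? t u y ×-dec path?′ n (Y ∖ˢ y)
          (ℕ.≤-pred (ℕ.≤-trans (∣∣-< {U = Y ∖ˢ y} {Y} proj₁ y∈ (λ h → proj₂ h refl)) h)) y (t · s) v)

    path? : ∀ Y u s v → Dec (Path Y u s v)
    path? Y = path?′ ∣ Y ∣ Y ℕ.≤-refl

    -- By `E-plus`, connectivity through positive edges is connectivity of the whole graph.
    data Reach (Y : VSet ℓ) : Fin ℓ → Fin ℓ → Set where
      here : ∀ {u} → Reach Y u u
      there : ∀ {u y v} → E plus u y → y ∈ Y → Reach Y y v → Reach Y u v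

    reach-mono : ∀ {Y Y′} → Y ⊆ Y′ → ∀ {u v} → Reach Y u v → Reach Y′ u v
    reach-mono h here = here
    reach-mono h (there e y∈ r) = there e (h y∈) (reach-mono h r)

    reach-trans : ∀ {Y u v w} → Reach Y u v → Reach Y v w → Reach Y u w
    reach-trans here q = q
    reach-trans (there e y∈ p) q = there e y∈ (reach-trans p q)

    reach-sym : ∀ {Y u v} → u ∈ Y → Reach Y u v → Reach Y v u
    reach-sym u∈ here = here
    reach-sym u∈ (there e y∈ r) = reach-trans (reach-sym y∈ r) (there (E-sym e) u∈ here)

    Connected : VSet ℓ → Set
    Connected Y = ∀ {u v} → u ∈ Y → v ∈ Y → Reach Y u v

    record Component (S : VSet ℓ) (b : Fin ℓ) : Set₁ where
      field
        Y : VSet ℓ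
        Y⊆S : Y ⊆ S
        b∈Y : b ∈ Y
        reach : ∀ {y} → y ∈ Y → Reach Y b y
        closed : ∀ {y v s} → y ∈ Y → v ∈ S → E s y v → v ∈ Y
      connected : Connected Y
      connected u∈ v∈ = reach-trans (reach-sym b∈Y (reach u∈)) (reach v∈)

    component : ∀ S b → b ∈ S → Component S b
    component S b b∈S = grow _ ((_≡ b) by (Fin._≟ b)) (λ { refl → b∈S }) refl (λ { refl → here }) ℕ.≤-refl
      where
      grow : ∀ n Y → Y ⊆ S → b ∈ Y → (∀ {y} → y ∈ Y → Reach Y b y) → ∣ S ∖ Y ∣ ≤ n → Component S b
      grow n Y sub b∈Y r h with Fin.any? (λ v → mem? (S ∖ Y) v ×-dec Fin.any? (λ y → mem? Y y ×-dec E? plus y v))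
      ... | no none = record { Y = Y ; Y⊆S = sub ; b∈Y = b∈Y ; reach = r ; closed = closed }
        where
        closed : ∀ {y v s} → y ∈ Y → v ∈ S → E s y v → v ∈ Y
        closed {y} {v} y∈ v∈ e with mem? Y v
        ... | yes v∈Y = v∈Y
        ... | no v∉Y = ⊥-elim (none (v , (v∈ , v∉Y) , y , y∈ , E-plus e))
      grow n Y sub b∈Y r h | yes (v , (v∈S , v∉Y) , y , y∈ , e) with n
      ... | zero = ⊥-elim (ℕ.<⇒≱ (shrink v v∈S v∉Y) (ℕ.≤-trans h z≤n))
        where
        shrink : ∀ v → v ∈ S → v ∉ Y → ∣ (S ∖ Y) ∖ˢ v ∣ < ∣ S ∖ Y ∣
        shrink v v∈S v∉Y = ∣∣-< {U = (S ∖ Y) ∖ˢ v} {S ∖ Y} proj₁ (v∈S , v∉Y) (λ h → proj₂ h refl)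
      ... | suc n = grow n (Y ⊹ v) (λ { (inj₁ h) → sub h ; (inj₂ refl) → v∈S }) (inj₁ b∈Y)
          (λ { (inj₁ h) → reach-mono inj₁ (r h) ; (inj₂ refl) → reach-trans (reach-mono inj₁ (r y∈)) (there e (inj₂ refl) here) })
          (ℕ.≤-pred (ℕ.≤-trans (∣∣-< {U = S ∖ (Y ⊹ v)} {S ∖ Y} (λ { (h , h′) → h , h′ ∘ inj₁ }) (v∈S , v∉Y) (λ h → proj₂ h (inj₂ refl))) h))

    distinct-at : ∀ A {s z D} → Distinct (A ++ (s , z) ∷ D) → All (λ p → z ≢ proj₂ p) D × Distinct D
    distinct-at [] (h ∷ d) = h , d
    distinct-at (_ ∷ A) (_ ∷ d) = distinct-at A d

    -- Loop erasure: a walk inside `Y` is made simple and stopped at its first vertex in `O`.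
    module FirstHit {Y : VSet ℓ} (O : Fin ℓ → Set) (O? : ∀ i → Dec (O i)) where
      record Tail (u : Fin ℓ) : Set where
        constructor tail
        field
          {y} : Fin ℓ
          {zs} : List Step
          y∈Y : y ∈ Y
          y∈O : O y
          walk : Walk u zs plus y
          pluses : All (λ p → proj₁ p ≡ plus) zs
          distinct : Distinct zs
          inside : All (λ p → proj₂ p ∈ Y × ¬ O (proj₂ p)) zs

        sgn-zs : sgn zs ≡ plus
        sgn-zs = go pluses
          where
          go : ∀ {L} → All (λ p → proj₁ p ≡ plus) L → sgn L ≡ plus
          go [] = refl
          go (refl ∷ h) = go h

      private
        data Position (u : Fin ℓ) : List Step → Set where
          absent : ∀ {L} → All (λ p → u ≢ proj₂ p) L → Position u L
          found : ∀ A {s D} → Position u (A ++ (s , u) ∷ D)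

        position : ∀ u L → Position u L
        position u [] = absent []
        position u ((s , y) ∷ L) with u Fin.≟ y | position u L
        ... | yes refl | _ = found []
        ... | no n | absent h = absent (n ∷ h)
        ... | no n | found A = found ((s , y) ∷ A)

        Fresh : Fin ℓ → Set
        Fresh z = ¬ O z × Σ (Tail z) λ T → All (λ p → z ≢ proj₂ p) (Tail.zs T)

        find : ∀ {z y₀} → z ∈ Y → Reach Y z y₀ → O y₀ → O z ⊎ Fresh z
        find z∈ here o = inj₁ o
        find {z} z∈ (there e y∈ r) o with O? z | find y∈ r o
        ... | yes oz | _ = inj₁ oz
        ... | no nz | inj₁ oy = inj₂ (nz , tail y∈ oy (edge e) [] [] [] , [])
        ... | no nz | inj₂ (ny , tail {zs = zs} y′∈ yO w pl d ins , fresh) with position z zs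
        ... | absent z∉ = inj₂ (nz , tail y′∈ yO (step e w) (refl ∷ pl) (fresh ∷ d) ((y∈ , ny) ∷ ins) , E-irrefl e ∷ z∉)
        -- `z` recurs in the tail, so everything before that occurrence is dropped.
        ... | found A = inj₂ (nz , tail y′∈ yO (proj₂ (walk-split A w)) (All.tail (All.++⁻ʳ A pl))
                (proj₂ (distinct-at A d)) (All.tail (All.++⁻ʳ A ins)) , proj₁ (distinct-at A d))

      hit : ∀ {c z y₀} → E plus c z → z ∈ Y → Reach Y z y₀ → O y₀ → Tail c
      hit e z∈ r o with find z∈ r o
      ... | inj₁ oz = tail z∈ oz (edge e) [] [] []
      ... | inj₂ (nz , tail y∈ yO w pl d ins , fresh) = tail y∈ yO (step e w) (refl ∷ pl) (fresh ∷ d) ((z∈ , nz) ∷ ins)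

    -- The walk stops at the first neighbour of `c′`; the earlier vertices are no neighbours and
    -- hence different from it.
    positive-path : ∀ {Y c z z′ c′} → E plus c z → z ∈ Y → Connected Y → z′ ∈ Y → E plus z′ c′ → Path Y c plus c′
    positive-path {Y} {c} {c′ = c′} e z∈ conn z′∈ e′ = build (FirstHit.hit {Y} (λ y → E plus y c′) (λ y → E? plus y c′) e z∈ (conn z∈ z′∈) e′)
      where
      build : FirstHit.Tail {Y} (λ y → E plus y c′) (λ y → E? plus y c′) c → Path Y c plus c′
      build T@(FirstHit.tail {zs = zs} y∈ yc′ w pl d ins) = path (walk-++ w (edge yc′))
        (trans (·-identityʳ _) (trans (sgn-mid zs []) (trans (·-identityʳ _) (trans (·-identityʳ _) (FirstHit.Tail.sgn-zs T)))))
        (AllPairs.++⁺ d ([] ∷ []) (All.map (λ { (_ , n) → (λ { refl → n yc′ }) ∷ [] }) ins))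
        (All.++⁺ (All.map proj₁ ins) (y∈ ∷ []))

    -- Where a path from v first meets a negative path between a and b, it continues
    -- with the two possible signs towards a and towards b.
    third-end : ∀ {Y a b v z} → Connected Y → ¬ E minus a b → Path Y a minus b → E plus v z → z ∈ Y →
      Path Y v minus a ⊎ Path Y v minus b
    third-end conn nn (path (edge e) refl _ _) _ _ = ⊥-elim (nn e)
    third-end {Y} {a} {b} {v} conn nn (path {L@((_ , y₀) ∷ _)} {r} w sg d (y₀∈ ∷ ins)) e z∈ =
      build (hit e z∈ (conn z∈ y₀∈) (here refl))
      where
      O : Fin ℓ → Set
      O i = Any (λ p → i ≡ proj₂ p) L
      open FirstHit {Y} O (λ i → any? (λ p → i Fin.≟ proj₂ p) L)

      occurs : ∀ {i M} → Any (λ p → i ≡ proj₂ p) M → Σ (List Step) λ A → Σ Sign λ s → Σ (List Step) λ D → M ≡ A ++ (s , i) ∷ D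
      occurs (here refl) = [] , _ , _ , refl
      occurs (there h) = let A , s , D , eq = occurs h in _ ∷ A , s , D , cong (_ ∷_) eq

      build : Tail v → Path Y v minus a ⊎ Path Y v minus b
      build T@(tail {y} {zs} y∈ yO w₀ pl d₀ ins₀) with occurs yO
      -- The two parts of the negative path at `y` have product minus, so one of them is negative,
      -- and the approach `w₀` is positive.
      ... | A , s , D , eq = Sum.map (λ e → subst (λ σ → Path Y v σ a) e toA) (λ e → subst (λ σ → Path Y v σ b) e toB) (·≡minus s₁ _ product)
        where
        wA : Walk a A s y
        wA = proj₁ (walk-split A (subst (λ M → Walk a M r b) eq w))
        wD : Walk y D r b
        wD = proj₂ (walk-split A (subst (λ M → Walk a M r b) eq w))
        dL : Distinct (A ++ (s , y) ∷ D)
        dL = subst Distinct eq d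
        inL : All (λ p → proj₂ p ∈ Y) (A ++ (s , y) ∷ D)
        inL = subst (All _) eq (y₀∈ ∷ ins)
        onL : All (λ p → O (proj₂ p)) (A ++ (s , y) ∷ D)
        onL = subst (All _) eq (All.tabulate λ p∈ → Any-map p∈)
          where
          Any-map : ∀ {p M} → p ∈ₗ M → Any (λ q → proj₂ p ≡ proj₂ q) M
          Any-map (here refl) = here refl
          Any-map (there h) = there (Any-map h)
        module R = Reversed (reversed wA)
        s₁ : Sign
        s₁ = sgn A · s

        product : s₁ · (sgn D · r) ≡ minus
        product = trans (sym (·-assoc s₁ (sgn D) r)) (trans (cong (_· r) (trans (sym (sgn-mid A D)) (cong sgn (sym eq)))) sg)

        y∉D : All (λ p → y ≢ proj₂ p) D
        y∉D = proj₁ (distinct-at A dL)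
        y∉A : All (λ p → y ≢ proj₂ p) A
        y∉A = All.map (λ h e → All.head h (sym e)) (distinct-cross A dL)

        join : ∀ {M σ c} → Walk y M σ c → All (λ p → y ≢ proj₂ p) M → Distinct M → All (λ p → proj₂ p ∈ Y) M →
          All (λ p → O (proj₂ p)) M → Path Y v (sgn M · σ) c
        join {M} {σ} wM yM dM inM oM = path (walk-++ w₀ wM)
          (cong (_· σ) (trans (sgn-mid zs M) (trans (cong (_· sgn M) (trans (·-identityʳ _) (Tail.sgn-zs T))) refl)))
          (AllPairs.++⁺ d₀ (yM ∷ dM) (All.map (λ { (_ , n) → (λ e → n (subst O (sym e) yO)) ∷ All.map (λ o e → n (subst O (sym e) o)) oM }) ins₀))
          (All.++⁺ (All.map proj₁ ins₀) (y∈ ∷ inM))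

        toA : Path Y v s₁ a
        toA = subst (λ σ → Path Y v σ a) R.sign (join R.walk (R.inside {y ≢_} y∉A) (R.distinct (distinct-left A dL))
          (R.inside {_∈ Y} (All.++⁻ˡ A inL)) (R.inside {O} (All.++⁻ˡ A onL)))
        toB : Path Y v (sgn D · r) b
        toB = join wD y∉D (distinct-right ((s , y) ∷ []) (distinct-right A dL)) (All.tail (All.++⁻ʳ A inL)) (All.tail (All.++⁻ʳ A onL))

    -- With two opposite negative edges the 4-cycle is balanced, and each diagonal bypasses one
    -- negative and one positive edge.
    four-cycle : ChordProperty → ∀ {a b c d} → E minus a b → E minus c d → E plus b c → E plus d a → a ≢ c → b ≢ d →
      E minus a c ⊎ E minus b d
    four-cycle cp {a} {b} {c} {d} ab cd bc da a≢c b≢d = resolve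
      (cp {a} {(minus , b) ∷ (plus , c) ∷ (minus , d) ∷ []} (step ab (step bc (step cd (edge da)))) refl
        (E-irrefl ab ∷ a≢c ∷ (E-irrefl da ∘ sym) ∷ []) ((E-irrefl bc ∷ b≢d ∷ []) ∷ (E-irrefl cd ∷ []) ∷ [] ∷ []) (s≤s (s≤s (s≤s z≤n))))
      where
      resolve : Chord a ((minus , b) ∷ (plus , c) ∷ (minus , d) ∷ []) → E minus a c ⊎ E minus b d
      resolve (first [] D refl B≢ D≢ e) = ⊥-elim (B≢ refl)
      resolve (first (_ ∷ []) D refl B≢ D≢ e) = inj₁ e
      resolve (first (_ ∷ _ ∷ []) D refl B≢ D≢ e) = ⊥-elim (D≢ refl)
      resolve (first (_ ∷ _ ∷ _ ∷ B) D eq B≢ D≢ e) = ⊥-elim (absurd B (∷-injectiveʳ (∷-injectiveʳ (∷-injectiveʳ eq))))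
        where
        absurd : ∀ {x} {X : Set x} (B : List X) {y D} → [] ≢ B ++ y ∷ D
        absurd [] ()
        absurd (_ ∷ B) ()
      resolve (inner [] [] D eq B≢ e) = ⊥-elim (B≢ refl)
      resolve (inner [] (_ ∷ []) D refl B≢ e) = inj₂ e
      resolve (inner [] (_ ∷ _ ∷ B) D eq B≢ e) = ⊥-elim (absurd B (∷-injectiveʳ (∷-injectiveʳ (∷-injectiveʳ eq))))
        where
        absurd : ∀ {x} {X : Set x} (B : List X) {y D} → [] ≢ B ++ y ∷ D
        absurd [] ()
        absurd (_ ∷ B) ()
      resolve (inner (_ ∷ A) B D eq B≢ e) = ⊥-elim (short A B B≢ (∷-injectiveʳ eq))
        where
        short : ∀ {x} {X : Set x} (A B : List X) {p q D a b} → B ≢ [] → a ∷ b ∷ [] ≢ A ++ p ∷ B ++ q ∷ D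
        short [] [] h _ = h refl
        short [] (_ ∷ []) _ ()
        short [] (_ ∷ _ ∷ _) _ ()
        short (_ ∷ []) [] h _ = h refl
        short (_ ∷ []) (_ ∷ _) _ ()
        short (_ ∷ _ ∷ []) B _ ()
        short (_ ∷ _ ∷ _ ∷ A) B _ ()

    Linked : VSet ℓ → Fin ℓ → Fin ℓ → Set
    Linked Y u v = u ≢ v × Path Y u minus v

    linked-sym : ∀ {Y u v} → Linked Y u v → Linked Y v u
    linked-sym (n , π) = n ∘ sym , path-sym π

    Clique : VSet ℓ → Set
    Clique C = ∀ {i j} → i ∈ C → j ∈ C → i ≢ j → E plus i j

    Touches : VSet ℓ → VSet ℓ → Set
    Touches Y C = ∀ {c} → c ∈ C → Σ (Fin ℓ) λ y → y ∈ Y × E plus c y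

    linked-third : ∀ {Y C a b v} → Connected Y → Touches Y C → v ∈ C → ¬ E minus a b → Linked Y a b →
      Linked Y a v ⊎ Linked Y b v
    linked-third {a = a} {b} {v} conn touch v∈ nn (a≢b , π) with v Fin.≟ a | v Fin.≟ b
    ... | yes refl | _ = inj₂ (a≢b ∘ sym , path-sym π)
    ... | no _ | yes refl = inj₁ (a≢b , π)
    ... | no v≢a | no v≢b with touch v∈
    ... | z , z∈ , e = Sum.map (λ κ → v≢a ∘ sym , path-sym κ) (λ κ → v≢b ∘ sym , path-sym κ) (third-end conn nn π e z∈)

    -- Two pairs of the clique without negative edge, one linked through `X` and one through `Y`,
    -- cannot coexist: `linked-third` moves one link until both share an end, where `separation`
    -- yields a forbidden negative edge. The patterns of negative edges between the pairs that
    -- prevent this are excluded by `four-cycle`.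
    module Dichotomy (cp : ChordProperty) {X Y C : VSet ℓ} (sep : Separated X Y) (clique : Clique C)
      (avoid : ∀ {c} → c ∈ C → Avoids c X Y) (connX : Connected X) (connY : Connected Y)
      (touchX : Touches X C) (touchY : Touches Y C) where

      pivot : ∀ {f g f₀} → f ∈ C → g ∈ C → f₀ ∈ C → Linked X f f₀ → ¬ E minus f f₀ → Linked Y f₀ g → ¬ E minus f₀ g → ⊥
      pivot {f} {g} f∈ g∈ f₀∈ (f≢ , π) nf (g≢ , κ) ng = Sum.[ nf , ng ] (Separation.separation cp sep
        (avoid f∈) (avoid g∈) (avoid f₀∈) f≢ (g≢ ∘ sym) same-or-adjacent π κ)
        where
        same-or-adjacent : f ≡ g ⊎ E plus g f
        same-or-adjacent with f Fin.≟ g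
        ... | yes e = inj₁ e
        ... | no n = inj₂ (clique g∈ f∈ (n ∘ sym))

      pivotX : ∀ {e e′ p q} → e ∈ C → e′ ∈ C → p ∈ C → q ∈ C → Linked X e e′ → ¬ E minus e e′ → Linked Y p q → ¬ E minus p q →
        ¬ E minus e p → ¬ E minus e′ p → ⊥
      pivotX e∈ e′∈ p∈ q∈ x nx y ny n n′ with linked-third {X} {C} connX touchX p∈ nx x
      ... | inj₁ z = pivot e∈ q∈ p∈ z n y ny
      ... | inj₂ z = pivot e′∈ q∈ p∈ z n′ y ny

      pivotY : ∀ {e e′ p q} → e ∈ C → e′ ∈ C → p ∈ C → q ∈ C → Linked X e e′ → ¬ E minus e e′ → Linked Y p q → ¬ E minus p q →
        ¬ E minus e p → ¬ E minus e q → ⊥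
      pivotY e∈ e′∈ p∈ q∈ x nx y ny n n′ with linked-third {Y} {C} connY touchY e∈ ny y
      ... | inj₁ z = pivot e′∈ p∈ e∈ (linked-sym x) (nx ∘ E-sym) (linked-sym z) n
      ... | inj₂ z = pivot e′∈ q∈ e∈ (linked-sym x) (nx ∘ E-sym) (linked-sym z) n′

      -- Negative edges that match the two pairs close up, through positive clique edges, to a
      -- balanced 4-cycle whose diagonals are the pairs themselves.
      alternating : ∀ {e e′ p q} → e ∈ C → e′ ∈ C → p ∈ C → q ∈ C → e ≢ e′ → p ≢ q → ¬ E minus e e′ → ¬ E minus p q →
        E minus e p → E minus e′ q → ⊥
      alternating e∈ e′∈ p∈ q∈ e≢e′ p≢q nx ny ep e′q = Sum.[ nx , ny ] (four-cycle cp ep e′q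
        (clique p∈ e′∈ (λ { refl → nx ep })) (clique q∈ e∈ (λ { refl → nx (E-sym e′q) })) e≢e′ p≢q)

      dichotomy : ∀ {e e′ p q} → e ∈ C → e′ ∈ C → p ∈ C → q ∈ C → Linked X e e′ → ¬ E minus e e′ → Linked Y p q → ¬ E minus p q → ⊥
      dichotomy {e} {e′} {p} {q} e∈ e′∈ p∈ q∈ x nx y ny with E? minus e p | E? minus e′ p | E? minus e q
      ... | no n | no n′ | _ = pivotX e∈ e′∈ p∈ q∈ x nx y ny n n′
      ... | no n | yes _ | no n′ = pivotY e∈ e′∈ p∈ q∈ x nx y ny n n′
      ... | no _ | yes e′p | yes eq = alternating e∈ e′∈ q∈ p∈ (proj₁ x) (proj₁ y ∘ sym) nx (ny ∘ E-sym) eq e′p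
      ... | yes ep | _ | no n = pivotX e∈ e′∈ q∈ p∈ x nx (linked-sym y) (ny ∘ E-sym) n
                                  (λ e′q → alternating e∈ e′∈ p∈ q∈ (proj₁ x) (proj₁ y) nx ny ep e′q)
      ... | yes ep | no n | yes eq = pivotY e′∈ e∈ p∈ q∈ (linked-sym x) (nx ∘ E-sym) y ny n
                                  (λ e′q → alternating e∈ e′∈ p∈ q∈ (proj₁ x) (proj₁ y) nx ny ep e′q)
      ... | yes ep | yes e′p | yes eq = alternating e∈ e′∈ q∈ p∈ (proj₁ x) (proj₁ y ∘ sym) nx (ny ∘ E-sym) eq e′p

-- Decomposition of a vertex set relative to a clique.

module CliqueDecompositions where
  open import Data.Nat as ℕ using (zero; suc; _+_; _≤_; _<_; z≤n; s≤s)
  import Data.Nat.Properties as ℕ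
  open import Data.Fin using (Fin)
  import Data.Fin as Fin
  import Data.Fin.Properties as Fin
  open import Data.List using ([]; _∷_; allFin)
  open import Data.List.Relation.Unary.All using (All; []; _∷_)
  import Data.List.Relation.Unary.All as All
  open import Data.List.Relation.Unary.AllPairs using ([]; _∷_)
  open import Data.List.Relation.Unary.Any using (here; there)
  open import Data.List.Membership.Propositional using () renaming (_∈_ to _∈ₗ_)
  open import Data.List.Relation.Unary.Unique.Propositional using (Unique)
  open import Data.List.Relation.Unary.Unique.Propositional.Properties using (allFin⁺)
  open import Data.Product using (proj₁; proj₂)
  open import Data.Sum using (_⊎_; inj₁; inj₂)
  import Data.Sum as Sum
  open import Data.Empty using (⊥-elim)
  open import Function using (_∘_)
  open import Relation.Nullary using (¬_; Dec; yes; no)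
  open import Relation.Nullary.Decidable using (_×-dec_; ¬?; decidable-stable)
  open import Relation.Binary.PropositionalEquality using (_≡_; _≢_; refl; sym)
  open VertexSets
  open BalancedCycles
  open SimplePaths
  open Connectivity

  count-≤-on : ∀ {ℓ} {U W : VSet ℓ} is → (∀ {i} → i ∈ₗ is → i ∈ U → i ∈ W) → count U is ≤ count W is
  count-≤-on [] h = z≤n
  count-≤-on {U = U} {W} (i ∷ is) h with mem? U i | mem? W i
  ... | yes _ | yes _ = s≤s (count-≤-on is (h ∘ there))
  ... | yes u | no w = ⊥-elim (w (h (here refl) u))
  ... | no _ | yes _ = ℕ.m≤n⇒m≤1+n (count-≤-on is (h ∘ there))
  ... | no _ | no _ = count-≤-on is (h ∘ there)

  count-∖ˢ : ∀ {ℓ} {U : VSet ℓ} {z} is → Unique is → count U is ≤ suc (count (U ∖ˢ z) is)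
  count-∖ˢ [] _ = z≤n
  count-∖ˢ {U = U} {z} (i ∷ is) (p ∷ ps) with mem? U i | mem? (U ∖ˢ z) i
  ... | yes u | yes _ = s≤s (count-∖ˢ is ps)
  ... | yes u | no w = s≤s (count-≤-on is (λ j∈ j∈U → j∈U , λ { refl → w (u , λ { refl → All.lookup p j∈ refl }) }))
  ... | no u | yes w = ⊥-elim (u (proj₁ w))
  ... | no _ | no _ = count-∖ˢ is ps

  ∣∣-∖ˢ : ∀ {ℓ} (U : VSet ℓ) z → ∣ U ∣ ≤ suc ∣ U ∖ˢ z ∣
  ∣∣-∖ˢ {ℓ} U z = count-∖ˢ {U = U} {z} (allFin ℓ) (allFin⁺ ℓ)

  module Decompositions {ℓ : ℕ} (Γ : Adjacency ℓ) where
    open Graph Γ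
    open Walks Γ
    open Paths Γ
    open Components Γ

    -- The interface between combinatorics and algebra: each constructor has its counterpart among
    -- the `RF` lemmas.
    data Decomposable : VSet ℓ → VSet ℓ → Set₁ where
      done : ∀ {W C} → W ⊆ C → Decomposable W C
      eliminate : ∀ {W C v} → v ∈ W → Simplicial W v → C ⊆ W ∖ˢ v → Decomposable (W ∖ˢ v) C → Decomposable W C
      separate : ∀ {W C Y K} → Y ⊆ W → K ⊆ W ∖ Y → (∀ {i j s} → i ∈ Y → j ∈ W → j ∉ Y → E s i j → j ∈ K) → C ⊆ W ∖ Y →
        Decomposable (Y ∪ K) K → Decomposable (W ∖ Y) C → Decomposable W C
      exchange : ∀ {W D k k′} → k ∉ D → k′ ∉ D → FullyNeg (D ⊹ k) → FullyNeg (D ⊹ k′) → D ⊹ k ⊆ W → D ⊹ k′ ⊆ W →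
        Decomposable W (D ⊹ k) → Decomposable W (D ⊹ k′)
      resp : ∀ {W C C′} → C ⊆ C′ → C′ ⊆ C → Decomposable W C → Decomposable W C′

    -- A negative path from i to j outside C forces x_i + x_j to divide g_i - g_j for
    -- every spline g on W, so splines on C extend to W only if C is calm.
    Calm : VSet ℓ → VSet ℓ → Set
    Calm W C = ∀ {i j} → i ∈ C → j ∈ C → i ≢ j → ¬ E minus i j → ¬ Path (W ∖ C) i minus j

    record Agitated (W C : VSet ℓ) : Set where
      field
        {i j} : Fin ℓ
        i∈C : i ∈ C
        j∈C : j ∈ C
        i≢j : i ≢ j
        nonneg : ¬ E minus i j
        negative : Path (W ∖ C) i minus j

    calm? : ∀ W C → Calm W C ⊎ Agitated W C
    calm? W C with Fin.any? (λ i → mem? C i ×-dec Fin.any? (λ j → mem? C j ×-dec (¬? (i Fin.≟ j) ×-dec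
      (¬? (E? minus i j) ×-dec path? (W ∖ C) i minus j))))
    ... | yes (i , i∈ , j , j∈ , n , nn , π) =
      inj₂ (record { i∈C = i∈ ; j∈C = j∈ ; i≢j = n ; nonneg = nn ; negative = π })
    ... | no none = inj₁ λ i∈ j∈ n nn π → none (_ , i∈ , _ , j∈ , n , nn , π)

    calm-⊆ : ∀ {W W′ C} → W′ ⊆ W → Calm W C → Calm W′ C
    calm-⊆ sub calm i∈ j∈ n nn π = calm i∈ j∈ n nn (path-mono (λ { (h , h′) → sub h , h′ }) π)

    fullyNeg⇒calm : ∀ {W C} → FullyNeg C → Calm W C
    fullyNeg⇒calm fully i∈ j∈ n nn _ = nn (fully i∈ j∈ n)

    module _ (cp : ChordProperty) where

      Decomposes : ℕ → Set₁
      Decomposes n = ∀ W C → ∣ W ∣ < n → C ⊆ W → Clique C → Calm W C → Decomposable W C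

      clique-⊆ : ∀ {C W} → C ⊆ W → Clique W → Clique C
      clique-⊆ sub cl i∈ j∈ = cl (sub i∈) (sub j∈)

      N⁻ : VSet ℓ → Fin ℓ → VSet ℓ
      N⁻ W z = (λ i → i ∈ W × E minus z i) by (λ i → mem? W i ×-dec E? minus z i)

      -- In a complete graph a vertex that is not simplicial is followed by one of
      -- smaller negative degree.
      module Complete {n : ℕ} (IH : Decomposes n) {W : VSet ℓ} (W<n : ∣ W ∣ ≤ n) (clique : Clique W) where

        -- In a complete graph the edge that `Simplicial` can miss is the negative `b c` for a
        -- negative `z b` and a positive `z c`.
        record Obstacle (z : Fin ℓ) : Set where
          field
            {b c} : Fin ℓ
            b∈W : b ∈ W
            c∈W : c ∈ W
            zb : E minus z b
            c≢z : c ≢ z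
            b≢c : b ≢ c
            nonneg : ¬ E minus b c

        obstacle? : ∀ z → Obstacle z ⊎ (∀ {b c} → b ∈ W → c ∈ W → E minus z b → c ≢ z → b ≢ c → E minus b c)
        obstacle? z with Fin.any? (λ b → (mem? W b ×-dec E? minus z b) ×-dec Fin.any? (λ c → mem? W c ×-dec
          (¬? (c Fin.≟ z) ×-dec (¬? (b Fin.≟ c) ×-dec ¬? (E? minus b c)))))
        ... | yes (b , (b∈ , zb) , c , c∈ , c≢z , b≢c , nn) =
          inj₁ (record { b∈W = b∈ ; c∈W = c∈ ; zb = zb ; c≢z = c≢z ; b≢c = b≢c ; nonneg = nn })
        ... | no none = inj₂ λ {b} {c} b∈ c∈ zb c≢z b≢c →
          decidable-stable (E? minus b c) (λ nn → none (b , (b∈ , zb) , c , c∈ , c≢z , b≢c , nn))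

        simplicial : ∀ {z} → (∀ {b c} → b ∈ W → c ∈ W → E minus z b → c ≢ z → b ≢ c → E minus b c) → Simplicial W z
        simplicial h {s = plus} {plus} i∈ j∈ _ _ i≢j = clique i∈ j∈ i≢j
        simplicial h {s = minus} {minus} i∈ j∈ _ _ i≢j = clique i∈ j∈ i≢j
        simplicial h {s = minus} {plus} i∈ j∈ ei ej i≢j = h i∈ j∈ ei (E-irrefl ej ∘ sym) i≢j
        simplicial h {s = plus} {minus} i∈ j∈ ei ej i≢j = E-sym (h j∈ i∈ ej (E-irrefl ei ∘ sym) (i≢j ∘ sym))

        -- The 4-cycle `z b e c` has negative edges `z b` and `e c`. Its diagonal `b c` is not
        -- negative, so `z e` is.
        inherited : ∀ {z e} (o : Obstacle z) → z ∈ W → e ∈ W → E minus (Obstacle.c o) e → e ≢ z → E minus z e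
        inherited {z} {e} o z∈ e∈ ce e≢z = Sum.fromInj₁ (⊥-elim ∘ nonneg)
          (four-cycle cp zb (E-sym ce) (clique b∈W e∈ (λ { refl → nonneg (E-sym ce) })) (clique c∈W z∈ c≢z) (e≢z ∘ sym) b≢c)
          where open Obstacle o

        degree-< : ∀ {z} (o : Obstacle z) → z ∈ W → ∣ N⁻ W (Obstacle.c o) ∣ < ∣ N⁻ W z ∣
        degree-< {z} o z∈ with E? minus z c
          where open Obstacle o
        ... | no zc = ∣∣-< {U = N⁻ W c} {N⁻ W z} (λ { (e∈ , ce) → e∈ , inherited o z∈ e∈ ce (λ { refl → zc (E-sym ce) }) })
            (b∈W , zb) (nonneg ∘ E-sym ∘ proj₂)
          where open Obstacle o
        -- Now `z` and `c` lie in each other's negative neighbourhoods and are removed before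
        -- comparing.
        ... | yes zc = ℕ.<-≤-trans (s≤s (∣∣-∖ˢ (N⁻ W c) z)) (ℕ.<-≤-trans
            (s≤s (∣∣-< {U = N⁻ W c ∖ˢ z} {N⁻ W z ∖ˢ c}
              (λ { ((e∈ , ce) , e≢z) → (e∈ , inherited o z∈ e∈ ce e≢z) , (E-irrefl ce ∘ sym) })
              ((b∈W , zb) , b≢c) (nonneg ∘ E-sym ∘ proj₂ ∘ proj₁)))
            (∣∣-< {U = N⁻ W z ∖ˢ c} {N⁻ W z} proj₁ (c∈W , zc) (λ h → proj₂ h refl)))
          where open Obstacle o

        decompose : ∀ d C z → ∣ N⁻ W z ∣ ≤ d → C ⊆ W → Calm W C → z ∈ W → z ∉ C → Decomposable W C
        decompose d C z h sub calm z∈ z∉ with obstacle? z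
        ... | inj₂ none = eliminate z∈ (simplicial none) sub′
              (IH (W ∖ˢ z) C (ℕ.<-≤-trans (∣∣-< {U = W ∖ˢ z} {W} proj₁ z∈ (λ h → proj₂ h refl)) W<n) sub′
                (clique-⊆ {C} {W} sub clique) (calm-⊆ {W} {W ∖ˢ z} {C} proj₁ calm))
          where
          sub′ : C ⊆ W ∖ˢ z
          sub′ i∈ = sub i∈ , λ { refl → z∉ i∈ }
        decompose zero C z h sub calm z∈ z∉ | inj₁ o = ⊥-elim (ℕ.<⇒≱ (degree-< o z∈) (ℕ.≤-trans h z≤n))
        decompose (suc d) C z h sub calm z∈ z∉ | inj₁ o = next (mem? C c)
          where
          open Obstacle o
          smaller : ∣ N⁻ W c ∣ ≤ d
          smaller = ℕ.≤-pred (ℕ.≤-trans (degree-< o z∈) h)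

          next : Dec (c ∈ C) → Decomposable W C
          next (no c∉) = decompose d C c smaller sub calm c∈W c∉
          -- The better vertex lies in `C`. Calmness then makes `C` fully negative, and trading `c`
          -- for `z` puts `c` outside the clique.
          next (yes c∈) = resp (λ { (inj₁ i) → proj₁ i ; (inj₂ refl) → c∈ }) back
              (exchange {D = D} (z∉ ∘ proj₁) (λ h → proj₂ h refl) neg-z neg-c sub-z
                (λ { (inj₁ i) → sub (proj₁ i) ; (inj₂ refl) → c∈W })
                (decompose d (D ⊹ z) c smaller sub-z (fullyNeg⇒calm {W} {D ⊹ z} neg-z) c∈W
                  (λ { (inj₁ i) → proj₂ i refl ; (inj₂ e) → c≢z e })))
            where
            D : VSet ℓ
            D = C ∖ˢ c
            z∈∖ : z ∈ W ∖ C
            z∈∖ = z∈ , z∉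
            b∉ : b ∉ C
            b∉ b∈ = calm b∈ c∈ b≢c nonneg (path (step (E-sym zb) (edge (clique z∈ c∈W (c≢z ∘ sym)))) refl ([] ∷ []) (z∈∖ ∷ []))
            -- Otherwise `u z b v` would be a negative path outside `C`.
            fully : FullyNeg C
            fully {u} {v} u∈ v∈ u≢v = decidable-stable (E? minus u v) λ nn → calm u∈ v∈ u≢v nn
              (path (step (clique (sub u∈) z∈ (λ { refl → z∉ u∈ })) (step zb (edge (clique b∈W (sub v∈) (λ { refl → b∉ v∈ })))))
                refl ((E-irrefl zb ∷ []) ∷ [] ∷ []) (z∈∖ ∷ (b∈W , b∉) ∷ []))
            to-z : ∀ {u} → u ∈ D → E minus z u
            to-z (u∈ , u≢c) = inherited o z∈ (sub u∈) (fully c∈ u∈ (u≢c ∘ sym)) (λ { refl → z∉ u∈ })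
            neg-z : FullyNeg (D ⊹ z)
            neg-z (inj₁ i) (inj₁ j) n = fully (proj₁ i) (proj₁ j) n
            neg-z (inj₁ i) (inj₂ refl) n = E-sym (to-z i)
            neg-z (inj₂ refl) (inj₁ j) n = to-z j
            neg-z (inj₂ refl) (inj₂ refl) n = ⊥-elim (n refl)
            back : C ⊆ D ⊹ c
            back {i} i∈ with i Fin.≟ c
            ... | yes e = inj₂ e
            ... | no n = inj₁ (i∈ , n)
            neg-c : FullyNeg (D ⊹ c)
            neg-c (inj₁ i) (inj₁ j) n = fully (proj₁ i) (proj₁ j) n
            neg-c (inj₁ i) (inj₂ refl) n = fully (proj₁ i) c∈ n
            neg-c (inj₂ refl) (inj₁ j) n = fully c∈ (proj₁ j) n
            neg-c (inj₂ refl) (inj₂ refl) n = ⊥-elim (n refl)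
            sub-z : D ⊹ z ⊆ W
            sub-z (inj₁ i) = sub (proj₁ i)
            sub-z (inj₂ refl) = z∈

      -- The two sides of the minimal clique separator K between a and b.
      record Sides (W : VSet ℓ) (a b : Fin ℓ) : Set₁ where
        field
          Y K X : VSet ℓ
          Y⊆W : Y ⊆ W
          K⊆W : K ⊆ W
          X⊆W : X ⊆ W
          b∈Y : b ∈ Y
          a∈X : a ∈ X
          clique : Clique K
          separated : Separated X Y
          avoid : ∀ {c} → c ∈ K → Avoids c X Y
          connX : Connected X
          connY : Connected Y
          touchX : Touches X K
          touchY : Touches Y K
          boundY : ∀ {i j s} → i ∈ Y → j ∈ W → j ∉ Y → E s i j → j ∈ K
          boundX : ∀ {i j s} → i ∈ X → j ∈ W → j ∉ X → E s i j → j ∈ K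
          a-Y : ∀ {y s} → y ∈ Y → y ≢ a × ¬ E s a y
          maximal : ∀ {U} → b ∈ U → Connected U → U ⊆ W → (∀ {u} → u ∈ U → u ≢ a × ¬ E plus a u) → U ⊆ Y

      -- `Y` is the component of `b` outside the closed neighbourhood of `a`, `K` its boundary, and
      -- `X` the component of `a` in the rest. `K` consists of neighbours of `a`, so two of its
      -- vertices are joined by positive paths through `a` and through `Y`, hence by an edge.
      sides : ∀ {W a b} → a ∈ W → b ∈ W → b ≢ a → ¬ E plus a b → Sides W a b
      sides {W} {a} {b} a∈ b∈ b≢a nab = record
        { Y = CY.Y ; K = K ; X = CX.Y
        ; Y⊆W = proj₁ ∘ CY.Y⊆S ; K⊆W = proj₁ ; X⊆W = proj₁ ∘ CX.Y⊆S
        ; b∈Y = CY.b∈Y ; a∈X = CX.b∈Y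
        ; clique = clique
        ; separated = (λ x∈ y∈ → proj₁ (proj₂ (CX.Y⊆S x∈)) y∈)
                    , (λ x∈ y∈ e → proj₂ (proj₂ (CX.Y⊆S x∈)) (toK y∈ (proj₁ (CX.Y⊆S x∈)) (proj₁ (proj₂ (CX.Y⊆S x∈))) (E-sym e)))
        ; avoid = λ c∈ → (λ x∈ → proj₂ (proj₂ (CX.Y⊆S x∈)) c∈) , proj₁ (proj₂ c∈)
        ; connX = CX.connected ; connY = CY.connected
        ; touchX = λ c∈ → a , CX.b∈Y , E-sym (K-a c∈)
        ; touchY = λ { (_ , _ , y , y∈ , e) → y , y∈ , E-sym e }
        ; boundY = toK
        ; boundX = toK′
        ; a-Y = λ y∈ → proj₁ (proj₂ (CY.Y⊆S y∈)) , proj₂ (proj₂ (CY.Y⊆S y∈)) ∘ E-plus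
        ; maximal = λ {U} b∈U conn sub h u∈ → inside {U} sub h CY.b∈Y (conn b∈U u∈) }
        where
        S : VSet ℓ
        S = (λ i → i ∈ W × i ≢ a × ¬ E plus a i) by (λ i → mem? W i ×-dec (¬? (i Fin.≟ a) ×-dec ¬? (E? plus a i)))
        module CY = Component (component S b (b∈ , b≢a , nab))
        K : VSet ℓ
        K = (λ i → i ∈ W × i ∉ CY.Y × Σ (Fin ℓ) λ y → y ∈ CY.Y × E plus y i)
          by (λ i → mem? W i ×-dec (¬? (mem? CY.Y i) ×-dec Fin.any? (λ y → mem? CY.Y y ×-dec E? plus y i)))
        a∉Y : a ∉ CY.Y
        a∉Y h = proj₁ (proj₂ (CY.Y⊆S h)) refl
        K-a : ∀ {i} → i ∈ K → E plus a i
        K-a {i} (i∈ , i∉ , y , y∈ , e) with i Fin.≟ a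
        ... | yes refl = ⊥-elim (proj₂ (proj₂ (CY.Y⊆S y∈)) (E-sym e))
        ... | no n = decidable-stable (E? plus a i) (λ nai → i∉ (CY.closed y∈ (i∈ , n , nai) e))
        a∉K : a ∉ K
        a∉K h = E-irrefl (K-a h) refl
        module CX = Component (component ((λ i → i ∈ W × i ∉ CY.Y × i ∉ K) by (λ i → mem? W i ×-dec (¬? (mem? CY.Y i) ×-dec ¬? (mem? K i)))) a (a∈ , a∉Y , a∉K))
        toK : ∀ {i j s} → i ∈ CY.Y → j ∈ W → j ∉ CY.Y → E s i j → j ∈ K
        toK i∈ j∈ j∉ e = j∈ , j∉ , _ , i∈ , E-plus e
        toK′ : ∀ {i j s} → i ∈ CX.Y → j ∈ W → j ∉ CX.Y → E s i j → j ∈ K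
        toK′ {i} {j} i∈ j∈ j∉ e = decidable-stable (mem? K j) λ j∉K → j∉ (CX.closed i∈ (j∈ , (λ j∈Y →
          proj₂ (proj₂ (CX.Y⊆S i∈)) (toK j∈Y (proj₁ (CX.Y⊆S i∈)) (proj₁ (proj₂ (CX.Y⊆S i∈))) (E-sym e))) , j∉K) e)

        ｛a｝ : VSet ℓ
        ｛a｝ = (_≡ a) by (Fin._≟ a)
        clique : Clique K
        clique {i} {j} i∈@(_ , i∉ , y , y∈ , e) j∈@(_ , j∉ , y′ , y′∈ , e′) i≢j =
          Separation.opposite cp {｛a｝} {CY.Y} ((λ { refl → a∉Y }) , λ { refl y∈ e → proj₂ (proj₂ (CY.Y⊆S y∈)) (E-plus e) })
            _ ((λ { refl → a∉K i∈ }) , i∉) ((λ { refl → a∉K j∈ }) , j∉) i≢j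
            (path (step (E-sym (K-a i∈)) (edge (K-a j∈))) refl ([] ∷ []) (refl ∷ []))
            (positive-path (E-sym e′) y′∈ CY.connected y∈ e) ℕ.≤-refl

        inside : ∀ {U} → U ⊆ W → (∀ {u} → u ∈ U → u ≢ a × ¬ E plus a u) → ∀ {u v} → u ∈ CY.Y → Reach U u v → v ∈ CY.Y
        inside sub h u∈ here = u∈
        inside {U} sub h u∈ (there e y∈ r) = inside {U} sub h (CY.closed u∈ (sub y∈ , h y∈) e) r

      module Separator {n : ℕ} (IH : Decomposes n) {W : VSet ℓ} (W≤n : ∣ W ∣ ≤ n) {a b : Fin ℓ} (T : Sides W a b) where
        open Sides T

        a∈W : a ∈ W
        a∈W = X⊆W a∈X
        b∈W : b ∈ W
        b∈W = Y⊆W b∈Y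

        lt : ∀ (U : VSet ℓ) {v} → U ⊆ W → v ∈ W → v ∉ U → ∣ U ∣ < n
        lt U sub v∈ v∉ = ℕ.<-≤-trans (∣∣-< {U = U} {W} sub v∈ v∉) W≤n

        bX : b ∉ X
        bX b∈X = proj₁ separated b∈X b∈Y
        aY : a ∉ Y
        aY = proj₁ separated a∈X
        bK : b ∉ K
        bK b∈K = proj₂ (avoid b∈K) b∈Y
        aK : a ∉ K
        aK a∈K = proj₁ (avoid a∈K) a∈X

        remove-Y : ∀ C → C ⊆ W ∖ Y → Clique C → Calm W C → Calm (Y ∪ K) K → Decomposable W C
        remove-Y C sub cl calm calmY = separate {Y = Y} {K} Y⊆W (λ k∈ → K⊆W k∈ , proj₂ (avoid k∈)) boundY sub
          (IH (Y ∪ K) K (lt (Y ∪ K) Sum.[ Y⊆W , K⊆W ] a∈W Sum.[ aY , aK ]) inj₂ clique calmY)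
          (IH (W ∖ Y) C (lt (W ∖ Y) proj₁ b∈W (λ h → proj₂ h b∈Y)) sub cl (calm-⊆ {W} {W ∖ Y} {C} proj₁ calm))

        remove-X : ∀ C → C ⊆ W ∖ X → Clique C → Calm W C → Calm (X ∪ K) K → Decomposable W C
        remove-X C sub cl calm calmX = separate {Y = X} {K} X⊆W (λ k∈ → K⊆W k∈ , proj₁ (avoid k∈)) boundX sub
          (IH (X ∪ K) K (lt (X ∪ K) Sum.[ X⊆W , K⊆W ] b∈W Sum.[ bX , bK ]) inj₂ clique calmX)
          (IH (W ∖ X) C (lt (W ∖ X) proj₁ a∈W (λ h → proj₂ h a∈X)) sub cl (calm-⊆ {W} {W ∖ X} {C} proj₁ calm))

        strip : ∀ {Z} → (Z ∪ K) ∖ K ⊆ Z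
        strip (inj₁ z , _) = z
        strip (inj₂ k , k∉) = ⊥-elim (k∉ k)

        opp : ∀ {u v} → u ∈ K → v ∈ K → u ≢ v → Path X u minus v → Path Y u minus v → E minus u v
        opp u∈ v∈ n π κ = Separation.opposite cp separated _ (avoid u∈) (avoid v∈) n π (path-sym κ) ℕ.≤-refl

        -- `Y` cannot be split off over `K`, so `X` has to be. A vertex `t` of `C` in `X` is in the
        -- way and is exchanged for an end of `π`.
        module _ (agitated : Agitated (Y ∪ K) K) where
          open Agitated agitated renaming (i to p; j to q; i∈C to p∈K; j∈C to q∈K; i≢j to p≢q)

          π : Path Y p minus q
          π = path-mono (strip {Y}) negative

          calmX : Calm (X ∪ K) K
          calmX i∈ j∈ n nn κ = Dichotomy.dichotomy cp {X} {Y} {K} separated clique avoid connX connY touchX touchY i∈ j∈ p∈K q∈K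
            (n , path-mono (strip {X}) κ) nn (p≢q , π) nonneg

          module _ {C : VSet ℓ} (sub : C ⊆ W ∖ Y) (cl : Clique C) (calm : Calm W C) {t : Fin ℓ} (t∈C : t ∈ C) (t∈X : t ∈ X)
            (full : ∀ {u c} → u ∈ C → u ∈ X → c ∈ K → E plus u c) where

            t∉K : t ∉ K
            t∉K t∈K = proj₁ (avoid t∈K) t∈X

            Y⊆ : Y ⊆ W ∖ C
            Y⊆ y∈ = Y⊆W y∈ , λ y∈C → proj₂ (sub y∈C) y∈

            -- A negative edge `t u` would give the negative path `v t u` through `X`, and together
            -- with `κ` the missing negative edge `u v`.
            t-nonneg : ∀ {u v} → u ∈ K → v ∈ K → u ≢ v → ¬ E minus u v → Path Y u minus v → ¬ E minus t u
            t-nonneg u∈ v∈ n nn κ tu = nn (E-sym (opp v∈ u∈ (n ∘ sym)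
              (path (step (E-sym (full t∈C t∈X v∈)) (edge tu)) refl ([] ∷ []) (t∈X ∷ [])) (path-sym κ)))

            -- If `u` were in `C`, the path `κ`, continued from `v` to `t` when `v` is outside `C`,
            -- would contradict calmness.
            end∉C : ∀ {u v} → u ∈ K → v ∈ K → u ≢ v → ¬ E minus u v → Path Y u minus v → u ∉ C
            end∉C {u} {v} u∈ v∈ n nn κ u∈C with mem? C v
            ... | yes v∈C = calm u∈C v∈C n nn (path-mono Y⊆ κ)
            ... | no v∉C = calm u∈C t∈C (λ { refl → t∉K u∈ }) (t-nonneg u∈ v∈ n nn κ ∘ E-sym)
                  (path-mono (λ { (inj₁ y∈) → Y⊆ y∈ ; (inj₂ refl) → K⊆W v∈ , v∉C })
                    (path-snoc κ (proj₂ (avoid v∈)) (E-sym (full t∈C t∈X v∈))))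

            p∉C : p ∉ C
            p∉C = end∉C p∈K q∈K p≢q nonneg π
            q∉C : q ∉ C
            q∉C = end∉C q∈K p∈K (p≢q ∘ sym) (nonneg ∘ E-sym) (path-sym π)

            place : ∀ {u} → u ∈ C → u ∈ X ⊎ u ∈ K
            place {u} u∈ with mem? X u | u Fin.≟ t
            ... | yes u∈X | _ = inj₁ u∈X
            ... | no u∉X | yes refl = ⊥-elim (u∉X t∈X)
            ... | no u∉X | no u≢t = inj₂ (boundX t∈X (proj₁ (sub u∈)) u∉X (cl t∈C u∈ (u≢t ∘ sym)))

            adj : ∀ {u c} → u ∈ C → c ∈ K → c ∉ C → E plus u c
            adj u∈ c∈ c∉ with place u∈
            ... | inj₁ u∈X = full u∈ u∈X c∈
            ... | inj₂ u∈K = clique u∈K c∈ (λ { refl → c∉ u∈ })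

            -- Through `p`, `π` and `q`, any two vertices of `C` are joined negatively outside `C`.
            fully : FullyNeg C
            fully {u} {v} u∈ v∈ u≢v = decidable-stable (E? minus u v) λ nn → calm u∈ v∈ u≢v nn
              (path-mono (λ { (inj₁ (inj₁ y∈)) → Y⊆ y∈ ; (inj₁ (inj₂ refl)) → K⊆W p∈K , p∉C ; (inj₂ refl) → K⊆W q∈K , q∉C })
                (path-snoc (path-cons (adj u∈ p∈K p∉C) (proj₂ (avoid p∈K)) π)
                  (λ { (inj₁ q∈Y) → proj₂ (avoid q∈K) q∈Y ; (inj₂ e) → p≢q (sym e) }) (E-sym (adj v∈ q∈K q∉C))))

            D : VSet ℓ
            D = C ∖ˢ t

            -- A second vertex `u` of `C` in `X` would give the negative path `p t u q` through `X`,
            -- and with `π` the missing edge `p q`.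
            D⊆K : D ⊆ K
            D⊆K {u} (u∈ , u≢t) with place u∈
            ... | inj₂ u∈K = u∈K
            ... | inj₁ u∈X = ⊥-elim (nonneg (opp p∈K q∈K p≢q
              (path (step (E-sym (full t∈C t∈X p∈K)) (step (fully t∈C u∈ (u≢t ∘ sym)) (edge (full u∈ u∈X q∈K)))) refl
                (((u≢t ∘ sym) ∷ []) ∷ [] ∷ []) (t∈X ∷ u∈X ∷ [])) π))

            link : ∀ {c v} → c ∈ D → v ∈ K → Linked Y v c → E minus c v
            link {c} (c∈ , c≢t) v∈ (n , κ) = opp (D⊆K (c∈ , c≢t)) v∈ (n ∘ sym)
              (path (step (fully c∈ t∈C c≢t) (edge (full t∈C t∈X v∈))) refl ([] ∷ []) (t∈X ∷ [])) (path-sym κ)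

            either : ∀ {c} → c ∈ D → E minus c p ⊎ E minus c q
            either c∈ = Sum.map (link c∈ p∈K) (link c∈ q∈K) (linked-third {Y} {K} connY touchY (D⊆K c∈) nonneg (p≢q , π))

            finish : ∀ f → f ∈ K → f ∉ C → (∀ {c} → c ∈ D → E minus c f) → Decomposable W C
            finish f f∈K f∉C D-f = resp (λ { (inj₁ i) → proj₁ i ; (inj₂ refl) → t∈C }) back
              (exchange {D = D} (f∉C ∘ proj₁) (λ h → proj₂ h refl) neg-f neg-t sub-f
                (λ { (inj₁ i) → proj₁ (sub (proj₁ i)) ; (inj₂ refl) → X⊆W t∈X })
                (remove-X (D ⊹ f) (λ i∈ → sub-f i∈ , proj₁ (avoid (in-K i∈))) (λ i∈ j∈ n → E-plus (neg-f i∈ j∈ n))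
                  (fullyNeg⇒calm {W} {D ⊹ f} neg-f) calmX))
              where
              neg-f : FullyNeg (D ⊹ f)
              neg-f (inj₁ i) (inj₁ j) n = fully (proj₁ i) (proj₁ j) n
              neg-f (inj₁ i) (inj₂ refl) n = D-f i
              neg-f (inj₂ refl) (inj₁ j) n = E-sym (D-f j)
              neg-f (inj₂ refl) (inj₂ refl) n = ⊥-elim (n refl)
              neg-t : FullyNeg (D ⊹ t)
              neg-t (inj₁ i) (inj₁ j) n = fully (proj₁ i) (proj₁ j) n
              neg-t (inj₁ i) (inj₂ refl) n = fully (proj₁ i) t∈C n
              neg-t (inj₂ refl) (inj₁ j) n = fully t∈C (proj₁ j) n
              neg-t (inj₂ refl) (inj₂ refl) n = ⊥-elim (n refl)
              in-K : D ⊹ f ⊆ K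
              in-K (inj₁ i) = D⊆K i
              in-K (inj₂ refl) = f∈K
              sub-f : D ⊹ f ⊆ W
              sub-f i = K⊆W (in-K i)
              back : C ⊆ D ⊹ t
              back {i} i∈ with i Fin.≟ t
              ... | yes e = inj₂ e
              ... | no n = inj₁ (i∈ , n)

            -- Each vertex of `D` is negatively joined to `p` or to `q`, but the exchange needs one
            -- end that serves all of them.
            swap : Decomposable W C
            swap with Fin.any? (λ c → mem? D c ×-dec ¬? (E? minus c p))
            ... | no none = finish p p∈K p∉C (λ {c} c∈ → decidable-stable (E? minus c p) (λ n → none (c , c∈ , n)))
            ... | yes (c₀ , c₀∈ , n₀) = finish q q∈K q∉C all-q
              where
              c₀q : E minus c₀ q
              c₀q = Sum.fromInj₂ (⊥-elim ∘ n₀) (either c₀∈)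
              all-q : ∀ {c} → c ∈ D → E minus c q
              all-q {c} c∈ with either c∈ | c Fin.≟ c₀
              ... | inj₂ cq | _ = cq
              ... | inj₁ cp′ | yes refl = c₀q
              -- The 4-cycle `c p q c₀` has negative edges `c p` and `q c₀`. Its diagonal `p c₀` is
              -- not negative, so `c q` is.
              ... | inj₁ cp′ | no n = Sum.fromInj₁ (λ pc₀ → ⊥-elim (n₀ (E-sym pc₀)))
                (four-cycle cp cp′ (E-sym c₀q) (clique p∈K q∈K p≢q) (clique (D⊆K c₀∈) (D⊆K c∈) (n ∘ sym))
                  (λ { refl → q∉C (proj₁ c∈) }) (λ { refl → p∉C (proj₁ c₀∈) }))

        decompose : ∀ C → C ⊆ W ∖ Y → Clique C → Calm W C → (∀ {u c} → u ∈ C → u ∈ X → c ∈ K → E plus u c) → Decomposable W C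
        decompose C sub cl calm full with calm? (Y ∪ K) K
        ... | inj₁ calmY = remove-Y C sub cl calm calmY
        ... | inj₂ ag with Fin.any? (λ t → mem? C t ×-dec mem? X t)
        ... | no none = remove-X C (λ i∈ → proj₁ (sub i∈) , λ i∈X → none (_ , i∈ , i∈X)) cl calm (calmX ag)
        ... | yes (t , t∈C , t∈X) = swap ag sub cl calm t∈C t∈X full

      module Incomplete {n : ℕ} (IH : Decomposes n) {W : VSet ℓ} (W≤n : ∣ W ∣ ≤ n) {C : VSet ℓ} (sub : C ⊆ W) (cl : Clique C) (calm : Calm W C) where

        -- Moving a within C enlarges the component Y until every vertex of C on the
        -- side X is adjacent to the whole separator.
        from-C : ∀ m a b (T : Sides W a b) → a ∈ C → ∣ W ∣ ≤ ∣ Sides.Y T ∣ + m → Decomposable W C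
        from-C m a b T a∈C h with Fin.any? (λ t → (mem? C t ×-dec mem? X t) ×-dec Fin.any? (λ c → mem? K c ×-dec ¬? (E? plus t c)))
          where open Sides T
        ... | no none = Separator.decompose IH W≤n T C C⊆ cl calm
                (λ {u} {c} u∈ u∈X c∈ → decidable-stable (E? plus u c) (λ nuc → none (u , (u∈ , u∈X) , c , c∈ , nuc)))
          where
          open Sides T
          C⊆ : C ⊆ W ∖ Y
          C⊆ {i} i∈ = sub i∈ , λ i∈Y → proj₂ (a-Y i∈Y) (cl a∈C i∈ (proj₁ (a-Y {s = plus} i∈Y) ∘ sym))
        from-C m a b T a∈C h | yes (t , (t∈C , t∈X) , c , c∈K , ntc) with m
        ... | zero = ⊥-elim (ℕ.<⇒≱ (∣∣-< {U = Sides.Y T} {W} Y⊆W (X⊆W a∈X) (proj₁ separated a∈X)) (ℕ.≤-trans h (ℕ.≤-reflexive (ℕ.+-identityʳ _))))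
          where open Sides T
        ... | suc m′ = from-C m′ t c T′ t∈C (ℕ.≤-trans h (ℕ.≤-trans (ℕ.≤-reflexive (ℕ.+-suc _ m′)) (ℕ.+-monoˡ-≤ m′ bigger)))
          where
          open Sides T
          T′ : Sides W t c
          T′ = sides (X⊆W t∈X) (K⊆W c∈K) (λ { refl → proj₁ (avoid c∈K) t∈X }) ntc
          grown : Y ⊹ c ⊆ Sides.Y T′
          grown = Sides.maximal T′ {Y ⊹ c} (inj₂ refl) conn (λ { (inj₁ y) → Y⊆W y ; (inj₂ refl) → K⊆W c∈K })
            (λ { (inj₁ y) → (λ { refl → proj₁ separated t∈X y }) , proj₂ separated t∈X y
               ; (inj₂ refl) → (λ { refl → proj₁ (avoid c∈K) t∈X }) , ntc })
            where
            to : ∀ {u} → u ∈ Y → Reach (Y ⊹ c) c u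
            to u∈ with touchY c∈K
            ... | y , y∈ , e = there e (inj₁ y∈) (reach-mono inj₁ (connY y∈ u∈))
            conn : Connected (Y ⊹ c)
            conn (inj₁ u∈) (inj₁ v∈) = reach-mono inj₁ (connY u∈ v∈)
            conn (inj₁ u∈) (inj₂ refl) = reach-sym (inj₂ refl) (to u∈)
            conn (inj₂ refl) (inj₁ v∈) = to v∈
            conn (inj₂ refl) (inj₂ refl) = here
          bigger : ∣ Y ∣ < ∣ Sides.Y T′ ∣
          bigger = ∣∣-< {U = Y} {Sides.Y T′} (grown ∘ inj₁) (grown (inj₂ refl)) (proj₂ (avoid c∈K))

        -- Vertices of `Y` are not adjacent to `a`, so none of them is in `C`.
        universal : (∀ {t i} → t ∈ C → i ∈ W → t ≢ i → E plus t i) → ∀ {a b} → Sides W a b → Decomposable W C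
        universal univ {a} T = Separator.decompose IH W≤n T C
          (λ {i} i∈ → sub i∈ , λ i∈Y → proj₂ (a-Y i∈Y) (E-sym (univ i∈ (X⊆W a∈X) (proj₁ (a-Y {s = plus} i∈Y))))) cl calm
          (λ u∈ u∈X c∈ → univ u∈ (K⊆W c∈) (λ { refl → proj₁ (avoid c∈) u∈X }))
          where open Sides T

      decomposes : ∀ n → Decomposes n
      decomposes (suc n) W C (s≤s W≤n) sub cl calm with Fin.any? (λ z → mem? W z ×-dec ¬? (mem? C z))
      ... | no none = done (λ {i} i∈ → decidable-stable (mem? C i) (λ i∉ → none (i , i∈ , i∉)))
      ... | yes (z , z∈ , z∉) with Fin.any? (λ a → mem? C a ×-dec Fin.any? (λ b → mem? W b ×-dec (¬? (b Fin.≟ a) ×-dec ¬? (E? plus a b))))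
      -- A non-adjacent pair with `a` in `C` comes first: then `C` lies in the neighbourhood of `a`,
      -- and `Y` avoids it.
      ... | yes (a , a∈ , b , b∈ , b≢a , nab) =
        Incomplete.from-C (decomposes n) W≤n sub cl calm ∣ W ∣ a b (sides (sub a∈) b∈ b≢a nab) a∈ (ℕ.m≤n+m ∣ W ∣ _)
      ... | no none with Fin.any? (λ a → mem? W a ×-dec Fin.any? (λ b → mem? W b ×-dec (¬? (b Fin.≟ a) ×-dec ¬? (E? plus a b))))
      ... | yes (a , a∈ , b , b∈ , b≢a , nab) = Incomplete.universal (decomposes n) W≤n sub cl calm
        (λ {t} {i} t∈ i∈ n′ → decidable-stable (E? plus t i) (λ nti → none (t , t∈ , i , i∈ , n′ ∘ sym , nti)))
        (sides a∈ b∈ b≢a nab)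
      ... | no none′ = Complete.decompose (decomposes n) W≤n
        (λ {i} {j} i∈ j∈ n′ → decidable-stable (E? plus i j) (λ nij → none′ (i , i∈ , j , j∈ , n′ ∘ sym , nij)))
        ∣ N⁻ W z ∣ C z ℕ.≤-refl sub calm z∈ z∉

      decomposable : Decomposable full ∅
      decomposable = decomposes (suc ∣ full {ℓ} ∣) full ∅ ℕ.≤-refl (λ ()) (λ ()) (λ ())

-- From decompositions to bases of logarithmic derivations.

module Derivations where
  open import Level using (_⊔_)
  open import Data.Bool using (T)
  open import Data.Nat using (zero; suc)
  open import Data.Fin using (Fin)
  import Data.Fin as Fin
  open import Data.Product using (proj₁; proj₂)
  open import Data.Unit using (tt)
  open import Data.Empty using (⊥-elim)
  open import Relation.Nullary using (yes; no)
  open import Relation.Binary.PropositionalEquality using (_≡_; _≢_; refl; cong)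
  import Relation.Binary.PropositionalEquality as ≡
  import Relation.Binary.Reasoning.Setoid as SetoidReasoning
  open RingTools
  open PolynomialEvaluation
  open Forms
  open VertexSets
  open SplineModules
  open BalancedCycles
  open SimplePaths
  open CliqueDecompositions

  module LogarithmicDerivations {a b : Level} {ℓ : ℕ} (F : FormRing a b ℓ) (Γ : Adjacency ℓ) where
    open LinearForms F
    open Graph Γ
    open Splines F Γ
    open Decompositions Γ
    open SetoidReasoning setoid

    decomposable⇒RF : ∀ {W C} → Decomposable W C → RF W C
    decomposable⇒RF (done sub) = RF-refl sub
    decomposable⇒RF (eliminate {W} {C} {v} v∈ simp sub d) =
      RF-trans {W} {W ∖ˢ v} {C} sub proj₁ (RF-simplicial v∈ simp) (decomposable⇒RF d)
    decomposable⇒RF (separate {W} {C} {Y} {K} Y⊆ K⊆ bd sub d d′) =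
      RF-trans {W} {W ∖ Y} {C} sub proj₁ (RF-glue {W} {Y} {K} Y⊆ K⊆ bd (decomposable⇒RF d)) (decomposable⇒RF d′)
    decomposable⇒RF (exchange {W} {D} k∉ k′∉ n n′ s s′ d) = RF-exchange {W} {D} k∉ k′∉ n n′ s s′ (decomposable⇒RF d)
    decomposable⇒RF (resp {W} {C} {C′} s s′ d) = RF-resp {W} {C} {C′} s s′ (decomposable⇒RF d)

    record Log (L : LoopSet ℓ) (θ : Fin ℓ → Carrier) : Set (a ⊔ b) where
      constructor log
      field
        along : ∀ {s} i j → E s i j → (x i - s ▹ x j) ∣ (θ i - s ▹ θ j)
        at-loop : ∀ i → T (L i) → x i ∣ θ i
    open Log public

    record LogBasis (L : LoopSet ℓ) : Set (a ⊔ b) where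
      field
        rank : ℕ
        basis : Fin rank → Fin ℓ → Carrier
        basis-log : ∀ k → Log L (basis k)
        span : ∀ θ → Log L θ → Σ (Fin rank → Carrier) λ f → ∀ i → θ i ≈ ∑ (λ k → f k * basis k i)
        indep : ∀ (f : Fin rank → Carrier) → (∀ i → ∑ (λ k → f k * basis k i) ≈ 0#) → ∀ k → f k ≈ 0#

    log-split : ∀ s i j g g′ → (x i * g - s ▹ (x j * g′)) ≈ x i * (g - g′) + (x i - s ▹ x j) * g′
    log-split plus i j g g′ =
      solve 4 (λ p q g h → p :* g :- q :* h := p :* (g :- h) :+ (p :- q) :* h) ≈-refl (x i) (x j) g g′
    log-split minus i j g g′ =
      solve 4 (λ p q g h → p :* g :- :- (q :* h) := p :* (g :- h) :+ (p :- :- q) :* h) ≈-refl (x i) (x j) g g′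

    spline⇒log : ∀ {g} → Spline full g → Log allLoops (λ i → x i * g i)
    spline⇒log {g} h = log (λ {s} i j e → ∣-respʳ (≈-sym (log-split s i j (g i) (g j)))
        (∣-+ (∣-*ˡ (x i) (at h {i} {j} {s} tt tt e)) (∣-*ʳ (g j) ∣-refl)))
      (λ i _ → ∣-*ʳ (g i) ∣-refl)

    log⇒spline : ∀ {θ} (l : Log allLoops θ) → Spline full (λ i → proj₁ (at-loop l i tt))
    log⇒spline {θ} (log l m) = spline form
      where
      g : Fin ℓ → Carrier
      g k = proj₁ (m k tt)
      form : ∀ {i j s} → i ∈ full → j ∈ full → E s i j → (x i - s ▹ x j) ∣ (g i - g j)
      form {i} {j} {s} _ _ e =
        -- `cancel` removes differences of roots, so `x i` is doubled to the difference of the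
        -- opposite roots at `i`.
        cancel {i , plus} {j , s} {i , minus} (λ r → E-irrefl e (cong proj₁ r)) (λ ()) (λ r → E-irrefl e (cong proj₁ r))
          (∣-respʳ eq (∣-+ d d))
        where
        d : (x i - s ▹ x j) ∣ (x i * (g i - g j))
        d = ∣-respʳ (begin
          (θ i - s ▹ θ j) - (x i - s ▹ x j) * g j
            ≈⟨ +-congʳ (≈-trans (+-cong (proj₂ (m i tt)) (-‿cong (▹-cong s (proj₂ (m j tt))))) (log-split s i j (g i) (g j))) ⟩
          (x i * (g i - g j) + (x i - s ▹ x j) * g j) - (x i - s ▹ x j) * g j
            ≈⟨ solve 2 (λ p q → (p :+ q) :- q := p) ≈-refl _ _ ⟩
          x i * (g i - g j) ∎) (∣-minus (l i j e) (∣-*ʳ (g j) ∣-refl))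
        eq : x i * (g i - g j) + x i * (g i - g j) ≈ (x i - - x i) * (g i - g j)
        eq = solve 2 (λ p q → p :* q :+ p :* q := (p :- :- p) :* q) ≈-refl (x i) (g i - g j)

    RF⇒LogBasis : RF full ∅ → LogBasis allLoops
    RF⇒LogBasis R = record
      { rank = R.rank
      ; basis = λ k i → x i * R.basis k i
      ; basis-log = λ k → spline⇒log (R.basis-spline k)
      ; span = λ θ l → let f , e = R.span (λ i → proj₁ (at-loop l i tt)) (log⇒spline l) (λ ()) in
          f , λ i → ≈-trans (proj₂ (at-loop l i tt)) (≈-trans (*-congˡ (e tt)) (≈-sym (pull f i)))
      ; indep = λ f h → R.indep f λ {i} _ → NZD-x i _ (≈-trans (≈-sym (pull f i)) (h i)) }
      where
      module R = RF R
      pull : ∀ f i → ∑ (λ k → f k * (x i * R.basis k i)) ≈ x i * ∑ (λ k → f k * R.basis k i)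
      pull f i = ≈-trans (∑-cong (λ k → solve 3 (λ f p q → f :* (p :* q) := p :* (f :* q)) ≈-refl (f k) (x i) (R.basis k i)))
        (∑-*ˡ (x i) (λ k → f k * R.basis k i))

  module PolynomialForms {c ℓ′ : Level} (K : CommutativeRing c ℓ′) (field₀ : IsFieldChar0 K) (ℓ : ℕ) where
    open Poly K
    open Evaluation K
    open NonZeroDivisors
    private
      module K = CommutativeRing K
      S : CommutativeRing c (c ⊔ ℓ′)
      S = PolyRing ℓ
      module S = CommutativeRing S
      module C = Hom (constHom ℓ)
      module I = Id ℓ

    inverse-2 : Σ K.Carrier λ y → (K.1# K.+ (K.1# K.+ K.0#)) K.* y K.≈ K.1#
    inverse-2 = proj₁ (proj₂ field₀) (natK K 2) (proj₂ (proj₂ field₀) 1)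

    half : Pol ℓ
    half = const (proj₁ inverse-2)

    half-spec : ((1P +P 1P) *P half) S.≈ 1P
    half-spec = S.trans {i = (1P +P 1P) *P half} {j = const ((K.1# K.+ K.1#) K.* proj₁ inverse-2)} {k = 1P}
      (S.sym {x = const ((K.1# K.+ K.1#) K.* proj₁ inverse-2)} {y = (1P +P 1P) *P half}
        (S.trans {i = const ((K.1# K.+ K.1#) K.* proj₁ inverse-2)} {j = const (K.1# K.+ K.1#) *P half} {k = (1P +P 1P) *P half}
          (C.*-homo (K.1# K.+ K.1#) (proj₁ inverse-2))
          (S.*-cong {x = const (K.1# K.+ K.1#)} {y = 1P +P 1P} {u = half} {v = half} (C.+-homo K.1# K.1#) (S.refl {x = half}))))
      (C.⟦⟧-cong (K.trans (K.*-congʳ (K.+-congˡ (K.sym (K.+-identityʳ K.1#)))) (proj₂ inverse-2)))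

    assign : Fin ℓ → Pol ℓ → Fin ℓ → Pol ℓ
    assign v r i with i Fin.≟ v
    ... | yes _ = r
    ... | no _ = var i

    assign-self : ∀ v r → assign v r v ≡ r
    assign-self v r with v Fin.≟ v
    ... | yes _ = refl
    ... | no n = ⊥-elim (n refl)

    assign-other : ∀ {v u} r → u ≢ v → assign v r u ≡ var u
    assign-other {v} {u} r n with u Fin.≟ v
    ... | yes e = ⊥-elim (n e)
    ... | no _ = refl

    open RingKit S using () renaming (_∣_ to _∣ₛ_; ∣-refl to ∣ₛ-refl; ∣-diff-≈ to ∣ₛ-diff-≈; ∣-respʳ to ∣ₛ-respʳ)

    assign-diff : ∀ v r i → (var v -P r) ∣ₛ (var i -P assign v r i)
    assign-diff v r i with i Fin.≟ v
    ... | yes refl = ∣ₛ-refl {var v -P r}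
    ... | no _ = ∣ₛ-diff-≈ {var v -P r} {var i} {var i} (S.refl {x = var i})

    polynomialForms : FormRing c (c ⊔ ℓ′) ℓ
    polynomialForms = record
      { S = S
      ; x = var
      ; half = half
      ; 2*half = half-spec
      ; NZD-x = NZD-var
      ; NZD-x+x = NZD-var+var
      ; NZD-x-x = NZD-var-var
      ; _≔_ = λ v r → I.evalHom (assign v r)
      ; ≔-self = λ v r → S.trans {i = I.eval (assign v r) (var v)} {j = assign v r v} {k = r}
          (I.eval-var (assign v r) v) (S.reflexive (assign-self v r))
      ; ≔-other = λ {v} {u} r n → S.trans {i = I.eval (assign v r) (var u)} {j = assign v r u} {k = var u}
          (I.eval-var (assign v r) u) (S.reflexive (assign-other r n))
      ; ≔-diff = λ v r p → ∣ₛ-respʳ {var v -P r} {I.eval var p -P I.eval (assign v r) p} {p -P I.eval (assign v r) p}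
          (S.+-cong {x = I.eval var p} {y = p} {u = -P I.eval (assign v r) p} {v = -P I.eval (assign v r) p}
            (eval-id p) (S.refl {x = -P I.eval (assign v r) p}))
          (I.eval-diff {α = var v -P r} var (assign v r) (assign-diff v r) p) }

    sumP≡∑ : ∀ {r} (f : Fin r → Pol ℓ) → sumP f ≡ RingKit.∑ S f
    sumP≡∑ {zero} f = refl
    sumP≡∑ {suc r} f = cong (f Fin.zero +P_) (sumP≡∑ (λ i → f (Fin.suc i)))

    module _ (G : SignedGraph ℓ) (sub : NegInPos G) where
      private
        Γ : Adjacency ℓ
        Γ = signedGraphAdjacency G sub
      open LogarithmicDerivations polynomialForms Γ
      open RingKit S using (∣-resp)
      open LinearForms polynomialForms using (-‿involutive)

      double-negation : ∀ p q → p -P (-P q) S.≈ p +P q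
      double-negation p q = S.+-cong {x = p} {y = p} {u = -P (-P q)} {v = q} (S.refl {x = p}) (-‿involutive q)

      log⇒InD : ∀ {L θ} → Log L θ → InD G L θ
      log⇒InD {L} {θ} (log l m) = (λ i j e → l {plus} i j e)
        , (λ i j e → ∣-resp {var i -P (-P var j)} {var i +P var j} {θ i -P (-P θ j)} {θ i +P θ j}
            (double-negation (var i) (var j)) (double-negation (θ i) (θ j)) (l {minus} i j e))
        , m

      InD⇒log : ∀ {L θ} → InD G L θ → Log L θ
      InD⇒log {L} {θ} (p , n , m) = log (λ { {plus} i j e → p i j e
          ; {minus} i j e → ∣-resp {var i +P var j} {var i -P (-P var j)} {θ i +P θ j} {θ i -P (-P θ j)}
            (S.sym {x = var i -P (-P var j)} {y = var i +P var j} (double-negation (var i) (var j)))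
            (S.sym {x = θ i -P (-P θ j)} {y = θ i +P θ j} (double-negation (θ i) (θ j))) (n i j e) }) m

      logBasis⇒free : ∀ {L} → LogBasis L → Free G L
      logBasis⇒free R = R.rank , R.basis , (λ k → log⇒InD (R.basis-log k))
        , (λ θ h → let f , e = R.span θ (InD⇒log h) in
            f , λ i → ≡.subst (λ z → θ i ≈P z) (≡.sym (sumP≡∑ (λ k → f k *P R.basis k i))) (e i))
        , λ f h k → ≈0⇒IsZero {p = f k} (R.indep f (λ i → IsZero⇒≈0
            (≡.subst IsZero (sumP≡∑ (λ k → f k *P R.basis k i)) (h i))) k)
        where module R = LogBasis R

      free⇒logBasis : ∀ {L} → Free G L → LogBasis L
      free⇒logBasis (r , B , B∈ , span , indep) = record
        { rank = r
        ; basis = B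
        ; basis-log = λ k → InD⇒log (B∈ k)
        ; span = λ θ l → let f , e = span θ (log⇒InD l) in
            f , λ i → ≡.subst (λ z → θ i ≈P z) (sumP≡∑ (λ k → f k *P B k i)) (e i)
        ; indep = λ f h k → IsZero⇒≈0 {p = f k} (indep f (λ i →
            ≡.subst IsZero (≡.sym (sumP≡∑ (λ k → f k *P B k i))) (≈0⇒IsZero (h i))) k) }

      balancedChordal⇒free : BalancedChordal G → Free G allLoops
      balancedChordal⇒free bc = logBasis⇒free (RF⇒LogBasis (decomposable⇒RF
        (Decompositions.decomposable Γ (ListChords.balancedChordal⇒chordProperty G sub bc))))

-- A balanced cycle without balanced chord obstructs freeness.

module CycleObstruction where
  open import Level using (_⊔_) renaming (suc to lsuc; zero to lzero)
  open import Data.Bool using (T)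
  open import Data.Nat as ℕ using (zero; suc; _≤_; _<_; z≤n; s≤s)
  import Data.Nat.Properties as ℕ
  open import Data.Fin using (Fin; zero; suc; toℕ)
  import Data.Fin as Fin
  import Data.Fin.Properties as Fin
  open import Data.List using (List; []; _∷_; allFin; cartesianProduct)
  open import Data.List.Membership.Propositional using () renaming (_∈_ to _∈ₗ_)
  open import Data.List.Membership.Propositional.Properties using (∈-allFin; ∈-cartesianProduct⁺)
  open import Data.List.Relation.Unary.Any using (here; there)
  open import Data.Product using (proj₁; proj₂)
  open import Data.Sum using (_⊎_; inj₁; inj₂)
  open import Data.Empty using (⊥-elim)
  open import Relation.Nullary using (¬_; Dec; yes; no)
  open import Relation.Binary.PropositionalEquality using (_≡_; _≢_; refl; cong)
  import Relation.Binary.PropositionalEquality as ≡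
  import Relation.Binary.Reasoning.Setoid as SetoidReasoning
  import Algebra.Properties.Ring as RingProperties
  open Signs
  open RingTools
  open Forms
  open VertexSets
  open BalancedCycles
  open Derivations

  -- In the coordinates yᵢ = εᵢ x_{vᵢ} the forms zᵢ = yᵢ - yᵢ₊₁ of the cycle cut out
  -- a flat, the only hyperplanes of the arrangement that contain it are those of the
  -- cycle, and ev is evaluation at a generic point of the flat.
  record CycleFlat {a b c d : Level} {ℓ : ℕ} (F : FormRing a b ℓ) (Γ : Adjacency ℓ) (K : CommutativeRing c d) : Set (lsuc lzero ⊔ a ⊔ b ⊔ c ⊔ d) where
    open LinearForms F
    open Graph Γ
    private module K = CommutativeRing K
    field
      subst : (Fin ℓ → Carrier) → Hom S S
      subst-x : ∀ e i → Hom.⟦_⟧ (subst e) (x i) ≈ e i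
      ev : Hom S K
    open Hom ev using () renaming (⟦_⟧ to ⟦_⟧ᵉ)
    field
      ev-subst : ∀ e → (∀ i → ⟦ e i ⟧ᵉ K.≈ ⟦ x i ⟧ᵉ) → ∀ p → ⟦ Hom.⟦_⟧ (subst e) p ⟧ᵉ K.≈ ⟦ p ⟧ᵉ
      ev-≔ : ∀ vtx r → ⟦ r ⟧ᵉ K.≈ ⟦ x vtx ⟧ᵉ → ∀ p → ⟦ Hom.⟦_⟧ (vtx ≔ r) p ⟧ᵉ K.≈ ⟦ p ⟧ᵉ
      1≉0 : ¬ (K.1# K.≈ K.0#)
      integral : ∀ {p q} → ¬ (p K.≈ K.0#) → ¬ (q K.≈ K.0#) → ¬ (p K.* q K.≈ K.0#)
      extra : ℕ
      vtx : Fin (suc (suc (suc (suc extra)))) → Fin ℓ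
      vtx-injective : ∀ {i j} → vtx i ≡ vtx j → i ≡ j
      ε : Fin (suc (suc (suc (suc extra)))) → Sign
      cycle-edge : ∀ i → E (ε i · ε (nextF i)) (vtx i) (vtx (nextF i))
      ev-flat : ∀ i j → ⟦ ρ (vtx i , ε i) ⟧ᵉ K.≈ ⟦ ρ (vtx j , ε j) ⟧ᵉ
      Contains : Sign → Fin ℓ → Fin ℓ → Set
      contains? : ∀ s i j → Dec (Contains s i j)
      generic : ∀ {s i j} → ¬ Contains s i j → ¬ (⟦ x i - s ▹ x j ⟧ᵉ K.≈ K.0#)
      contains-loop : ∀ {i} → ¬ Contains minus i i
      contains-edge : ∀ {s i j} → E s i j → Contains s i j →
        Σ (Fin (suc (suc (suc (suc extra))))) λ k → s ≡ ε k · ε (nextF k) ×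
          ((i ≡ vtx k × j ≡ vtx (nextF k)) ⊎ (j ≡ vtx k × i ≡ vtx (nextF k)))

  module NonFreeness {a b c d : Level} {ℓ : ℕ} (F : FormRing a b ℓ) (Γ : Adjacency ℓ) (K : CommutativeRing c d)
    (flat : CycleFlat F Γ K) (L : LoopSet ℓ) where
    open LinearForms F
    open Graph Γ
    open LogarithmicDerivations F Γ
    open CycleFlat flat
    open SetoidReasoning setoid
    private
      module K = CommutativeRing K
      module ev = Hom ev

    I : Set
    I = Fin (suc (suc (suc (suc extra))))

    i₀ i₁ i₂ i₃ : I
    i₀ = zero
    i₁ = suc zero
    i₂ = suc (suc zero)
    i₃ = suc (suc (suc zero))

    toℕ-next-< : ∀ (i : I) → toℕ i < suc (suc (suc extra)) → toℕ (nextF i) ≡ suc (toℕ i)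
    toℕ-next-< = toℕ-nextF-<

    next-i₀ : nextF i₀ ≡ i₁
    next-i₀ = Fin.toℕ-injective (toℕ-next-< i₀ (s≤s z≤n))
    next-i₁ : nextF i₁ ≡ i₂
    next-i₁ = Fin.toℕ-injective (toℕ-next-< i₁ (s≤s (s≤s z≤n)))
    next-i₂ : nextF i₂ ≡ i₃
    next-i₂ = Fin.toℕ-injective (toℕ-next-< i₂ (s≤s (s≤s (s≤s z≤n))))

    R : I → Root ℓ
    R i = vtx i , ε i

    y z : I → Carrier
    y i = ρ (R i)
    z i = y i - y (nextF i)

    z₀ z₁ z₂ : Carrier
    z₀ = y i₀ - y i₁
    z₁ = y i₁ - y i₂
    z₂ = y i₂ - y i₃

    R-≢ : ∀ {i j} → i ≢ j → R i ≢ R j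
    R-≢ h e = h (vtx-injective (cong proj₁ e))

    NZD-z : ∀ {i j} → i ≢ j → NZD (y i - y j)
    NZD-z h = NZD-ρ-ρ (R-≢ h)

    -- Values, in the coordinates y, of a derivation supported at v₁ and v₂.
    Y : Carrier → Carrier → I → Carrier
    Y α β zero = 0#
    Y α β (suc zero) = α
    Y α β (suc (suc zero)) = β
    Y α β (suc (suc (suc _))) = 0#

    Y-far : ∀ α β i → toℕ i ≢ 1 → toℕ i ≢ 2 → Y α β i ≈ 0#
    Y-far α β zero _ _ = ≈-refl
    Y-far α β (suc zero) h _ = ⊥-elim (h refl)
    Y-far α β (suc (suc zero)) _ h = ⊥-elim (h refl)
    Y-far α β (suc (suc (suc _))) _ _ = ≈-refl

    -- The sign `ε i` translates the value in the coordinate `y i` back to the direction of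
    -- `x (vtx i)`.
    M : Carrier → Carrier → Fin ℓ → Carrier
    M α β u with Fin.any? (λ i → vtx i Fin.≟ u)
    ... | yes (i , _) = ε i ▹ Y α β i
    ... | no _ = 0#

    M-v : ∀ α β i → M α β (vtx i) ≈ ε i ▹ Y α β i
    M-v α β i with Fin.any? (λ j → vtx j Fin.≟ vtx i)
    ... | yes (j , e) = reflexive (cong (λ k → ε k ▹ Y α β k) (vtx-injective e))
    ... | no h = ⊥-elim (h (i , refl))

    M-∉ : ∀ α β u → (∀ i → vtx i ≢ u) → M α β u ≈ 0#
    M-∉ α β u h with Fin.any? (λ j → vtx j Fin.≟ u)
    ... | yes (j , e) = ⊥-elim (h j e)
    ... | no _ = ≈-refl

    triples : List (Fin ℓ × Root ℓ)
    triples = cartesianProduct (allFin ℓ) (cartesianProduct (allFin ℓ) (plus ∷ minus ∷ []))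

    ∈-triples : ∀ s i j → (i , j , s) ∈ₗ triples
    ∈-triples s i j = ∈-cartesianProduct⁺ (∈-allFin i) (∈-cartesianProduct⁺ (∈-allFin j) (∈-signs s))
      where
      ∈-signs : ∀ s → s ∈ₗ (plus ∷ minus ∷ [])
      ∈-signs plus = here refl
      ∈-signs minus = there (here refl)

    factor : Fin ℓ × Root ℓ → Carrier
    factor (i , j , s) with contains? s i j
    ... | yes _ = 1#
    ... | no _ = x i - s ▹ x j

    factor-≈ : ∀ {s i j} → ¬ Contains s i j → factor (i , j , s) ≈ x i - s ▹ x j
    factor-≈ {s} {i} {j} h with contains? s i j
    ... | yes c = ⊥-elim (h c)
    ... | no _ = ≈-refl

    -- All forms whose hyperplane misses the generic point, whether or not they belong to edges. The
    -- entries `(i , i , minus)` contribute `2 x i`, which serves every loop set.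
    Q : Carrier
    Q = ∏ factor triples

    Q-∣ : ∀ {s i j} → ¬ Contains s i j → (x i - s ▹ x j) ∣ Q
    Q-∣ {s} {i} {j} h = ∣-resp (factor-≈ h) ≈-refl (∈-∏ {f = factor} (∈-triples s i j))

    ev-Q : ¬ (ev.⟦ Q ⟧ K.≈ K.0#)
    ev-Q = product triples
      where
      one : ∀ t → ¬ (ev.⟦ factor t ⟧ K.≈ K.0#)
      one (i , j , s) with contains? s i j
      ... | yes _ = λ h → 1≉0 (K.trans (K.sym ev.1-homo) h)
      ... | no h = generic h
      product : ∀ ts → ¬ (ev.⟦ ∏ factor ts ⟧ K.≈ K.0#)
      product [] h = 1≉0 (K.trans (K.sym ev.1-homo) h)
      product (t ∷ ts) h = integral (one t) (product ts) (K.trans (K.sym (ev.*-homo _ _)) h)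

    ▹-*ʳ : ∀ s p q → p * (s ▹ q) ≈ s ▹ (p * q)
    ▹-*ʳ plus p q = ≈-refl
    ▹-*ʳ minus p q = solve 2 (λ p q → p :* (:- q) := :- (p :* q)) ≈-refl p q

    cycle-form : ∀ i → x (vtx i) - (ε i · ε (nextF i)) ▹ x (vtx (nextF i)) ≈ ε i ▹ z i
    cycle-form i = begin
      x (vtx i) - (ε i · ε (nextF i)) ▹ x (vtx (nextF i))
        ≈⟨ +-cong (▹-self (ε i) _) (-‿cong (▹-· (ε i) (ε (nextF i)) _)) ⟨
      ε i ▹ y i - ε i ▹ y (nextF i) ≈⟨ ▹-minus (ε i) _ _ ⟨
      ε i ▹ z i ∎

    cycle-values : ∀ (θ : Fin ℓ → Carrier) i →
      θ (vtx i) - (ε i · ε (nextF i)) ▹ θ (vtx (nextF i)) ≈ ε i ▹ (ε i ▹ θ (vtx i) - ε (nextF i) ▹ θ (vtx (nextF i)))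
    cycle-values θ i = begin
      θ (vtx i) - (ε i · ε (nextF i)) ▹ θ (vtx (nextF i))
        ≈⟨ +-cong (▹-self (ε i) _) (-‿cong (▹-· (ε i) (ε (nextF i)) _)) ⟨
      ε i ▹ ε i ▹ θ (vtx i) - ε i ▹ ε (nextF i) ▹ θ (vtx (nextF i)) ≈⟨ ▹-minus (ε i) _ _ ⟨
      ε i ▹ (ε i ▹ θ (vtx i) - ε (nextF i) ▹ θ (vtx (nextF i))) ∎

    flip-sides : ∀ s p q → q - s ▹ p ≈ - (s ▹ (p - s ▹ q))
    flip-sides plus p q = solve 2 (λ p q → q :- p := :- (p :- q)) ≈-refl p q
    flip-sides minus p q = solve 2 (λ p q → q :- :- p := :- :- (p :- :- q)) ≈-refl p q

    flip-∣ : ∀ s {p q p′ q′} → (p - s ▹ q) ∣ (p′ - s ▹ q′) → (q - s ▹ p) ∣ (q′ - s ▹ p′)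
    flip-∣ s h = ∣-resp (≈-sym (flip-sides s _ _)) (≈-sym (flip-sides s _ _)) (neg-∣ (▹-∣ s (∣-neg (∣-▹ s h))))

    -- The three divisibilities belong to the cycle edges that meet the support, from 0 to 3; `Q`
    -- supplies all other hyperplanes.
    module Supported (α β : Carrier) (d₀ : z₀ ∣ α) (d₁ : z₁ ∣ (α - β)) (d₂ : z₂ ∣ β) where
      along-cycle : ∀ i → z i ∣ (Y α β i - Y α β (nextF i))
      along-cycle zero = ≡.subst (λ k → (y i₀ - y k) ∣ (0# - Y α β k)) (≡.sym next-i₀)
        (∣-respʳ (≈-sym (+-identityˡ _)) (∣-neg d₀))
      along-cycle (suc zero) = ≡.subst (λ k → (y i₁ - y k) ∣ (α - Y α β k)) (≡.sym next-i₁) d₁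
      along-cycle (suc (suc zero)) = ≡.subst (λ k → (y i₂ - y k) ∣ (β - Y α β k)) (≡.sym next-i₂)
        (∣-respʳ (≈-sym (≈-trans (+-congˡ -0#≈0#) (+-identityʳ _))) d₂)
      -- From index 3 on, the successor is 0 or at least 4, so these edges do not see the support.
      along-cycle i@(suc (suc (suc k))) = ∣-0 (x≈y⇒x∙y⁻¹≈ε (≈-sym (Y-far α β (nextF i) (proj₁ away) (proj₂ away))))
        where
        away : toℕ (nextF i) ≢ 1 × toℕ (nextF i) ≢ 2
        away with ℕ.m≤n⇒m<n∨m≡n (ℕ.≤-pred (Fin.toℕ<n i))
        ... | inj₁ lt rewrite toℕ-next-< i lt = (λ ()) , (λ ())
        ... | inj₂ e rewrite toℕ-nextF-last i e = (λ ()) , (λ ())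

      QM : Fin ℓ → Carrier
      QM u = Q * M α β u

      QM-v : ∀ i → ε i ▹ QM (vtx i) ≈ Q * Y α β i
      QM-v i = begin
        ε i ▹ (Q * M α β (vtx i)) ≈⟨ ▹-cong (ε i) (≈-trans (*-congˡ (M-v α β i)) (▹-*ʳ (ε i) Q _)) ⟩
        ε i ▹ ε i ▹ (Q * Y α β i) ≈⟨ ▹-self (ε i) _ ⟩
        Q * Y α β i ∎

      on-edge : ∀ i → (x (vtx i) - (ε i · ε (nextF i)) ▹ x (vtx (nextF i))) ∣ (QM (vtx i) - (ε i · ε (nextF i)) ▹ QM (vtx (nextF i)))
      on-edge i = ∣-resp (≈-sym (cycle-form i)) (≈-sym (≈-trans (cycle-values QM i) (▹-cong (ε i)
        (≈-trans (+-cong (QM-v i) (-‿cong (QM-v (nextF i)))) (solve 3 (λ q a b → q :* a :- q :* b := q :* (a :- b)) ≈-refl Q _ _)))))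
        (▹-∣ (ε i) (∣-▹ (ε i) (∣-*ˡ Q (along-cycle i))))

      QM-log : Log L QM
      QM-log = log edges′ loops
        where
        loops : ∀ i → T (L i) → x i ∣ QM i
        loops i _ = ∣-*ʳ _ (∣-trans (1# + 1# , double) (Q-∣ {minus} {i} {i} contains-loop))
          where
          double : x i - - x i ≈ x i * (1# + 1#)
          double = ≈-trans (+-congˡ (-‿involutive _))
            (≈-sym (≈-trans (distribˡ _ _ _) (+-cong (*-identityʳ _) (*-identityʳ _))))

        contained : ∀ {s i j} → (Σ I λ k → s ≡ ε k · ε (nextF k) × ((i ≡ vtx k × j ≡ vtx (nextF k)) ⊎ (j ≡ vtx k × i ≡ vtx (nextF k)))) →
          (x i - s ▹ x j) ∣ (QM i - s ▹ QM j)
        contained (k , refl , inj₁ (refl , refl)) = on-edge k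
        contained (k , refl , inj₂ (refl , refl)) = flip-∣ (ε k · ε (nextF k)) (on-edge k)

        decide : ∀ {s i j} → E s i j → Dec (Contains s i j) → (x i - s ▹ x j) ∣ (QM i - s ▹ QM j)
        decide e (yes h) = contained (contains-edge e h)
        decide {s} {i} {j} e (no h) = ∣-minus (∣-*ʳ _ (Q-∣ h)) (∣-▹ s (∣-*ʳ _ (Q-∣ h)))

        edges′ : ∀ {s} i j → E s i j → (x i - s ▹ x j) ∣ (QM i - s ▹ QM j)
        edges′ {s} i j e = decide e (contains? s i j)

    divides-first : ∀ p q → p ∣ (p * q)
    divides-first p q = ∣-*ʳ q ∣-refl

    module M₁ = Supported 0# (z₁ * z₂) (∣-0 ≈-refl) (∣-minus (∣-0 ≈-refl) (divides-first z₁ z₂)) (∣-*ˡ z₁ ∣-refl)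
    module M₂ = Supported (z₀ * z₂) (z₀ * z₂) (divides-first z₀ z₂) (∣-0 (-‿inverseʳ _)) (∣-*ˡ z₀ ∣-refl)
    module M₃ = Supported (z₀ * z₁) 0# (divides-first z₀ z₁) (∣-minus (∣-*ˡ z₀ ∣-refl) (∣-0 ≈-refl)) (∣-0 ≈-refl)

    syzygy-Y : ∀ i → z₁ * Y (z₀ * z₂) (z₀ * z₂) i ≈ z₀ * Y 0# (z₁ * z₂) i + z₂ * Y (z₀ * z₁) 0# i
    syzygy-Y zero = ≈-trans (zeroʳ _) (≈-sym (≈-trans (+-cong (zeroʳ _) (zeroʳ _)) (+-identityˡ _)))
    syzygy-Y (suc zero) = ≈-sym (≈-trans (≈-trans (+-congʳ (zeroʳ _)) (+-identityˡ _))
      (solve 3 (λ a b c → c :* (a :* b) := b :* (a :* c)) ≈-refl z₀ z₁ z₂))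
    syzygy-Y (suc (suc zero)) = ≈-sym (≈-trans (≈-trans (+-congˡ (zeroʳ _)) (+-identityʳ _))
      (solve 3 (λ a b c → a :* (b :* c) := b :* (a :* c)) ≈-refl z₀ z₁ z₂))
    syzygy-Y (suc (suc (suc _))) = ≈-trans (zeroʳ _) (≈-sym (≈-trans (+-cong (zeroʳ _) (zeroʳ _)) (+-identityˡ _)))

    syzygy : ∀ u → z₁ * M₂.QM u ≈ z₀ * M₁.QM u + z₂ * M₃.QM u
    syzygy u = begin
      z₁ * (Q * M (z₀ * z₂) (z₀ * z₂) u) ≈⟨ solve 3 (λ a q extra → a :* (q :* extra) := q :* (a :* extra)) ≈-refl z₁ Q _ ⟩
      Q * (z₁ * M (z₀ * z₂) (z₀ * z₂) u) ≈⟨ *-congˡ (at-vertex (Fin.any? (λ i → vtx i Fin.≟ u))) ⟩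
      Q * (z₀ * M 0# (z₁ * z₂) u + z₂ * M (z₀ * z₁) 0# u)
        ≈⟨ solve 5 (λ a q extra b n → q :* (a :* extra :+ b :* n) := a :* (q :* extra) :+ b :* (q :* n)) ≈-refl z₀ Q _ z₂ _ ⟩
      z₀ * (Q * M 0# (z₁ * z₂) u) + z₂ * (Q * M (z₀ * z₁) 0# u) ∎
      where
      ▹-+ : ∀ s p q → s ▹ (p + q) ≈ s ▹ p + s ▹ q
      ▹-+ plus p q = ≈-refl
      ▹-+ minus p q = solve 2 (λ p q → :- (p :+ q) := :- p :+ :- q) ≈-refl p q
      at-vertex : Dec (Σ I λ i → vtx i ≡ u) → z₁ * M (z₀ * z₂) (z₀ * z₂) u ≈ z₀ * M 0# (z₁ * z₂) u + z₂ * M (z₀ * z₁) 0# u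
      at-vertex (no h) = ≈-trans (≈-trans (*-congˡ (M-∉ _ _ u (λ i e → h (i , e)))) (zeroʳ _))
        (≈-sym (≈-trans (+-cong (≈-trans (*-congˡ (M-∉ _ _ u (λ i e → h (i , e)))) (zeroʳ _))
          (≈-trans (*-congˡ (M-∉ _ _ u (λ i e → h (i , e)))) (zeroʳ _))) (+-identityˡ _)))
      at-vertex (yes (i , refl)) = begin
        z₁ * M (z₀ * z₂) (z₀ * z₂) (vtx i) ≈⟨ ≈-trans (*-congˡ (M-v _ _ i)) (▹-*ʳ (ε i) z₁ _) ⟩
        ε i ▹ (z₁ * Y (z₀ * z₂) (z₀ * z₂) i) ≈⟨ ▹-cong (ε i) (syzygy-Y i) ⟩
        ε i ▹ (z₀ * Y 0# (z₁ * z₂) i + z₂ * Y (z₀ * z₁) 0# i) ≈⟨ ▹-+ (ε i) _ _ ⟩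
        ε i ▹ (z₀ * Y 0# (z₁ * z₂) i) + ε i ▹ (z₂ * Y (z₀ * z₁) 0# i)
          ≈⟨ +-cong (≈-trans (*-congˡ (M-v _ _ i)) (▹-*ʳ (ε i) z₀ _)) (≈-trans (*-congˡ (M-v _ _ i)) (▹-*ʳ (ε i) z₂ _)) ⟨
        z₀ * M 0# (z₁ * z₂) (vtx i) + z₂ * M (z₀ * z₁) 0# (vtx i) ∎

    σ : I → I → Hom S S
    σ i j = vtx i ≔ (ε i ▹ y j)

    σ-y : ∀ i j → Hom.⟦_⟧ (σ i j) (y i) ≈ y j
    σ-y i j = ≈-trans (≔-ρ-self (vtx i) (ε i) _) (▹-self (ε i) _)

    σ-other : ∀ i j {k} → k ≢ i → Hom.⟦_⟧ (σ i j) (y k) ≈ y k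
    σ-other i j {k} h = ≔-ρ-other (ε k) _ (λ e → h (vtx-injective e))

    σ-diff : ∀ i j p → (y i - y j) ∣ (p - Hom.⟦_⟧ (σ i j) p)
    σ-diff i j p = ∣-resp (begin
      ε i ▹ (x (vtx i) - ε i ▹ y j) ≈⟨ ▹-minus (ε i) _ _ ⟩
      y i - ε i ▹ ε i ▹ y j ≈⟨ +-congˡ (-‿cong (▹-self (ε i) _)) ⟩
      y i - y j ∎) ≈-refl (▹-∣ (ε i) (≔-diff (vtx i) _ p))

    σ-ev : ∀ i j p → ev.⟦ Hom.⟦_⟧ (σ i j) p ⟧ K.≈ ev.⟦ p ⟧
    σ-ev i j = ev-≔ (vtx i) (ε i ▹ y j) (K.trans (ev-▹ (ε i) (ev-flat j i)) (ev.⟦⟧-cong (▹-self (ε i) _)))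
      where
      ev-▹ : ∀ s {p q} → ev.⟦ p ⟧ K.≈ ev.⟦ q ⟧ → ev.⟦ s ▹ p ⟧ K.≈ ev.⟦ s ▹ q ⟧
      ev-▹ plus h = h
      ev-▹ minus h = K.trans (ev.-‿homo _) (K.trans (K.-‿cong h) (K.sym (ev.-‿homo _)))

    -- Sending `y i₀` to `y i₁` and then `y i₁` to `y i₂` is reduction modulo `z₀` and `z₁`. It
    -- leaves the non-zero-divisor `z₂` fixed because `i₃` is a fourth vertex, so `f₃` is reduced to
    -- zero.
    regular : ∀ f₁ f₂ f₃ → z₁ * f₂ ≈ z₀ * f₁ + z₂ * f₃ → Σ Carrier λ p → Σ Carrier λ q → f₃ ≈ z₀ * p + z₁ * q
    regular f₁ f₂ f₃ e = proj₁ step₁ , proj₁ step₂ , (begin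
      f₃ ≈⟨ solve 3 (λ f g h → f := ((f :- g) :+ (g :- h)) :+ h) ≈-refl f₃ s₀.⟦ f₃ ⟧ s₁.⟦ s₀.⟦ f₃ ⟧ ⟧ ⟩
      ((f₃ - s₀.⟦ f₃ ⟧) + (s₀.⟦ f₃ ⟧ - s₁.⟦ s₀.⟦ f₃ ⟧ ⟧)) + s₁.⟦ s₀.⟦ f₃ ⟧ ⟧
        ≈⟨ +-cong (+-cong (proj₂ step₁) (proj₂ step₂)) vanish ⟩
      (z₀ * proj₁ step₁ + z₁ * proj₁ step₂) + 0# ≈⟨ +-identityʳ _ ⟩
      z₀ * proj₁ step₁ + z₁ * proj₁ step₂ ∎)
      where
      module s₀ = Hom (σ i₀ i₁)
      module s₁ = Hom (σ i₁ i₂)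
      step₁ : z₀ ∣ (f₃ - s₀.⟦ f₃ ⟧)
      step₁ = σ-diff i₀ i₁ f₃
      step₂ : z₁ ∣ (s₀.⟦ f₃ ⟧ - s₁.⟦ s₀.⟦ f₃ ⟧ ⟧)
      step₂ = σ-diff i₁ i₂ s₀.⟦ f₃ ⟧
      φ : Carrier → Carrier
      φ p = s₁.⟦ s₀.⟦ p ⟧ ⟧
      φ-+ : ∀ p q → φ (p + q) ≈ φ p + φ q
      φ-+ p q = ≈-trans (s₁.⟦⟧-cong (s₀.+-homo p q)) (s₁.+-homo _ _)
      φ-minus : ∀ p q → φ (p - q) ≈ φ p - φ q
      φ-minus p q = ≈-trans (s₁.⟦⟧-cong (s₀.minus-homo p q)) (s₁.minus-homo _ _)
      φ-* : ∀ p q → φ (p * q) ≈ φ p * φ q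
      φ-* p q = ≈-trans (s₁.⟦⟧-cong (s₀.*-homo p q)) (s₁.*-homo _ _)
      φ-cong : ∀ {p q} → p ≈ q → φ p ≈ φ q
      φ-cong h = s₁.⟦⟧-cong (s₀.⟦⟧-cong h)
      φ-y₀ : φ (y i₀) ≈ y i₂
      φ-y₀ = ≈-trans (s₁.⟦⟧-cong (σ-y i₀ i₁)) (σ-y i₁ i₂)
      φ-y₁ : φ (y i₁) ≈ y i₂
      φ-y₁ = ≈-trans (s₁.⟦⟧-cong (σ-other i₀ i₁ (λ ()))) (σ-y i₁ i₂)
      φ-y₂ : φ (y i₂) ≈ y i₂
      φ-y₂ = ≈-trans (s₁.⟦⟧-cong (σ-other i₀ i₁ (λ ()))) (σ-other i₁ i₂ (λ ()))
      φ-y₃ : φ (y i₃) ≈ y i₃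
      φ-y₃ = ≈-trans (s₁.⟦⟧-cong (σ-other i₀ i₁ (λ ()))) (σ-other i₁ i₂ (λ ()))
      annihilate : ∀ {p q} f → φ p ≈ y i₂ → φ q ≈ y i₂ → φ ((p - q) * f) ≈ 0#
      annihilate f hp hq = ≈-trans (φ-* _ _) (≈-trans (*-congʳ (≈-trans (φ-minus _ _) (≈-trans (+-cong hp (-‿cong hq)) (-‿inverseʳ _)))) (zeroˡ _))
      vanish : φ f₃ ≈ 0#
      vanish = NZD-z {i₂} {i₃} (λ ()) _ (begin
        z₂ * φ f₃ ≈⟨ *-congʳ (≈-trans (φ-minus _ _) (+-cong φ-y₂ (-‿cong φ-y₃))) ⟨
        φ z₂ * φ f₃ ≈⟨ φ-* z₂ f₃ ⟨
        φ (z₂ * f₃) ≈⟨ +-identityˡ _ ⟨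
        0# + φ (z₂ * f₃) ≈⟨ +-congʳ (annihilate f₁ φ-y₀ φ-y₁) ⟨
        φ (z₀ * f₁) + φ (z₂ * f₃) ≈⟨ φ-+ _ _ ⟨
        φ (z₀ * f₁ + z₂ * f₃) ≈⟨ φ-cong e ⟨
        φ (z₁ * f₂) ≈⟨ annihilate f₂ φ-y₁ φ-y₂ ⟩
        0# ∎)

    -- Identifies all yᵢ with y₀ except y_j.
    collapse-env : I → Fin ℓ → Carrier
    collapse-env j u with Fin.any? (λ i → vtx i Fin.≟ u)
    ... | no _ = x u
    ... | yes (i , _) with i Fin.≟ j
    ...   | yes _ = x u
    ...   | no _ = ε i ▹ y i₀

    collapse : I → Hom S S
    collapse j = subst (collapse-env j)

    collapse-env-v : ∀ j i → i ≢ j → collapse-env j (vtx i) ≈ ε i ▹ y i₀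
    collapse-env-v j i i≢j with Fin.any? (λ k → vtx k Fin.≟ vtx i)
    ... | no h = ⊥-elim (h (i , refl))
    ... | yes (k , e) with k Fin.≟ j
    ...   | yes refl = ⊥-elim (i≢j (≡.sym (vtx-injective e)))
    ...   | no _ = reflexive (cong (λ l → ε l ▹ y i₀) (vtx-injective e))

    collapse-env-j : ∀ j → collapse-env j (vtx j) ≈ x (vtx j)
    collapse-env-j j with Fin.any? (λ k → vtx k Fin.≟ vtx j)
    ... | no h = ≈-refl
    ... | yes (k , e) with k Fin.≟ j
    ...   | yes _ = ≈-refl
    ...   | no h = ⊥-elim (h (vtx-injective e))

    collapse-y : ∀ j i → i ≢ j → Hom.⟦_⟧ (collapse j) (y i) ≈ y i₀
    collapse-y j i h = ≈-trans (hom-▹ (collapse j) (ε i) _)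
      (≈-trans (▹-cong (ε i) (≈-trans (subst-x _ _) (collapse-env-v j i h))) (▹-self (ε i) _))

    collapse-y-j : ∀ j → Hom.⟦_⟧ (collapse j) (y j) ≈ y j
    collapse-y-j j = ≈-trans (hom-▹ (collapse j) (ε j) _) (▹-cong (ε j) (≈-trans (subst-x _ _) (collapse-env-j j)))

    collapse-ev : ∀ j p → ev.⟦ Hom.⟦_⟧ (collapse j) p ⟧ K.≈ ev.⟦ p ⟧
    collapse-ev j = ev-subst (collapse-env j) env
      where
      env : ∀ u → ev.⟦ collapse-env j u ⟧ K.≈ ev.⟦ x u ⟧
      env u with Fin.any? (λ i → vtx i Fin.≟ u)
      ... | no _ = K.refl
      ... | yes (i , refl) with i Fin.≟ j
      ...   | yes _ = K.refl
      ...   | no _ = K.trans (ev-▹ (ε i) (ev-flat i₀ i)) (ev.⟦⟧-cong (▹-self (ε i) _))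
        where
        ev-▹ : ∀ s {p q} → ev.⟦ p ⟧ K.≈ ev.⟦ q ⟧ → ev.⟦ s ▹ p ⟧ K.≈ ev.⟦ s ▹ q ⟧
        ev-▹ plus h = h
        ev-▹ minus h = K.trans (ev.-‿homo _) (K.trans (K.-‿cong h) (K.sym (ev.-‿homo _)))

    -- Walks forward from `i` until the index wraps around to zero.
    chain : (H : I → Carrier) → ∀ k → (∀ i → k ≤ toℕ i → H i ≈ H (nextF i)) → ∀ i → k ≤ toℕ i → H i ≈ H i₀
    chain H k h i k≤ = go _ i k≤ ℕ.≤-refl
      where
      go : ∀ n i → k ≤ toℕ i → suc (suc (suc extra)) ℕ.∸ toℕ i ≤ n → H i ≈ H i₀
      go n i k≤ bound with ℕ.m≤n⇒m<n∨m≡n (ℕ.≤-pred (Fin.toℕ<n i))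
      ... | inj₂ e = ≈-trans (h i k≤) (reflexive (cong H (Fin.toℕ-injective (toℕ-nextF-last i e))))
      go zero i k≤ bound | inj₁ lt = ⊥-elim (ℕ.<⇒≱ (ℕ.m<n⇒0<n∸m lt) bound)
      go (suc n) i k≤ bound | inj₁ lt = ≈-trans (h i k≤) (go n (nextF i)
        (ℕ.≤-trans k≤ (ℕ.≤-trans (ℕ.n≤1+n _) (ℕ.≤-reflexive (≡.sym (toℕ-next-< i lt)))))
        (ℕ.≤-trans (ℕ.≤-reflexive (cong (suc (suc (suc extra)) ℕ.∸_) (toℕ-next-< i lt)))
          (ℕ.≤-pred (ℕ.≤-trans (ℕ.≤-reflexive (≡.sym (ℕ.+-∸-assoc 1 lt))) bound))))

    Log-comb : ∀ {r} (f : Fin r → Carrier) (B : Fin r → Fin ℓ → Carrier) → (∀ k → Log L (B k)) → Log L (λ i → ∑ (λ k → f k * B k i))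
    Log-comb f B h = log
      (λ {s} i j e → ∣-respʳ (≈-trans (∑-+ (λ k → f k * B k i) _) (+-congˡ (≈-trans (∑-neg (λ k → s ▹ (f k * B k j))) (-‿cong (∑-▹ s (λ k → f k * B k j))))))
        (∣-∑ (λ k → f k * B k i - s ▹ (f k * B k j)) (λ k → ∣-respʳ (pull s (f k) _ _) (∣-*ˡ (f k) (along (h k) i j e)))))
      (λ i l → ∣-∑ (λ k → f k * B k i) (λ k → ∣-*ˡ (f k) (at-loop (h k) i l)))
      where
      ∑-▹ : ∀ s {n} (g : Fin n → Carrier) → ∑ (λ k → s ▹ g k) ≈ s ▹ ∑ g
      ∑-▹ plus g = ≈-refl
      ∑-▹ minus g = ∑-neg g
      pull : ∀ s f p q → f * (p - s ▹ q) ≈ f * p - s ▹ (f * q)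
      pull plus f p q = solve 3 (λ f p q → f :* (p :- q) := f :* p :- f :* q) ≈-refl f p q
      pull minus f p q = solve 3 (λ f p q → f :* (p :- :- q) := f :* p :- :- (f :* q)) ≈-refl f p q

    module Along (N : Fin ℓ → Carrier) (N-log : Log L N) where
      h : I → Carrier
      h i = ε i ▹ N (vtx i)

      quotient : ∀ i → z i ∣ (h i - h (nextF i))
      quotient i = ∣-resp (≈-trans (▹-cong (ε i) (cycle-form i)) (▹-self (ε i) _))
        (≈-trans (▹-cong (ε i) (cycle-values N i)) (▹-self (ε i) _))
        (▹-∣ (ε i) (∣-▹ (ε i) (along N-log (vtx i) (vtx (nextF i)) (cycle-edge i))))

      w : I → Carrier
      w i = proj₁ (quotient i)

      diff₀ : h i₀ - h i₁ ≈ z₀ * w i₀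
      diff₀ = ≡.subst (λ k → h i₀ - h k ≈ (y i₀ - y k) * w i₀) next-i₀ (proj₂ (quotient i₀))
      diff₁ : h i₁ - h i₂ ≈ z₁ * w i₁
      diff₁ = ≡.subst (λ k → h i₁ - h k ≈ (y i₁ - y k) * w i₁) next-i₁ (proj₂ (quotient i₁))
      diff₂ : h i₂ - h i₃ ≈ z₂ * w i₂
      diff₂ = ≡.subst (λ k → h i₂ - h k ≈ (y i₂ - y k) * w i₂) next-i₂ (proj₂ (quotient i₂))

      -- `collapse j` kills every cycle form that does not involve `y j`.
      collapsed : ∀ j i → i ≢ j → nextF i ≢ j → Hom.⟦_⟧ (collapse j) (h i) ≈ Hom.⟦_⟧ (collapse j) (h (nextF i))
      collapsed j i n n′ = x∙y⁻¹≈ε⇒x≈y _ _ (begin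
        c.⟦ h i ⟧ - c.⟦ h (nextF i) ⟧ ≈⟨ c.minus-homo _ _ ⟨
        c.⟦ h i - h (nextF i) ⟧ ≈⟨ c.⟦⟧-cong (proj₂ (quotient i)) ⟩
        c.⟦ z i * w i ⟧ ≈⟨ c.*-homo _ _ ⟩
        c.⟦ z i ⟧ * c.⟦ w i ⟧
          ≈⟨ *-congʳ (≈-trans (c.minus-homo _ _) (≈-trans (+-cong (collapse-y j i n) (-‿cong (collapse-y j (nextF i) n′))) (-‿inverseʳ _))) ⟩
        0# * c.⟦ w i ⟧ ≈⟨ zeroˡ _ ⟩
        0# ∎)
        where module c = Hom (collapse j)

      -- Moving only y_j, the two forms at y_j become opposite.
      balance : ∀ (j p n : I) → p ≢ j → n ≢ j → i₀ ≢ j → (h p - h j ≈ (y p - y j) * w p) → (h j - h n ≈ (y j - y n) * w j) →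
        Hom.⟦_⟧ (collapse j) (h p) ≈ Hom.⟦_⟧ (collapse j) (h n) → ev.⟦ w p ⟧ K.≈ ev.⟦ w j ⟧
      balance j p n p≢j n≢j i₀≢j dp dj e = K.trans (K.sym (collapse-ev j (w p)))
        (K.trans (ev.⟦⟧-cong (NZD-cancel (NZD-z i₀≢j) (begin
          (y i₀ - y j) * c.⟦ w p ⟧ ≈⟨ *-congʳ (≈-trans (c.minus-homo _ _) (+-cong (collapse-y j p p≢j) (-‿cong (collapse-y-j j)))) ⟨
          c.⟦ y p - y j ⟧ * c.⟦ w p ⟧ ≈⟨ c.*-homo _ _ ⟨
          c.⟦ (y p - y j) * w p ⟧ ≈⟨ c.⟦⟧-cong dp ⟨
          c.⟦ h p - h j ⟧ ≈⟨ c.minus-homo _ _ ⟩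
          c.⟦ h p ⟧ - c.⟦ h j ⟧ ≈⟨ +-congʳ e ⟩
          c.⟦ h n ⟧ - c.⟦ h j ⟧ ≈⟨ minus-swap _ _ ⟩
          - (c.⟦ h j ⟧ - c.⟦ h n ⟧) ≈⟨ -‿cong (c.minus-homo _ _) ⟨
          - c.⟦ h j - h n ⟧ ≈⟨ -‿cong (≈-trans (c.⟦⟧-cong dj) (c.*-homo _ _)) ⟩
          - (c.⟦ y j - y n ⟧ * c.⟦ w j ⟧)
            ≈⟨ -‿cong (*-congʳ (≈-trans (c.minus-homo _ _) (+-cong (collapse-y-j j) (-‿cong (collapse-y j n n≢j))))) ⟩
          - ((y j - y i₀) * c.⟦ w j ⟧) ≈⟨ solve 3 (λ a b w → :- ((a :- b) :* w) := (b :- a) :* w) ≈-refl (y j) (y i₀) _ ⟩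
          (y i₀ - y j) * c.⟦ w j ⟧ ∎))) (collapse-ev j (w j)))
        where module c = Hom (collapse j)

      next≢ : ∀ i {j : I} → toℕ j ≢ 0 → toℕ j ≤ toℕ i → nextF i ≢ j
      next≢ i j≢0 le e with ℕ.m≤n⇒m<n∨m≡n (ℕ.≤-pred (Fin.toℕ<n i))
      ... | inj₂ l = j≢0 (≡.trans (cong toℕ (≡.sym e)) (toℕ-nextF-last i l))
      ... | inj₁ l = ℕ.<⇒≱ (ℕ.≤-reflexive (≡.trans (≡.sym (toℕ-next-< i l)) (cong toℕ e))) le

      beyond : ∀ i {j : I} → toℕ j < toℕ i → i ≢ j
      beyond i lt refl = ℕ.<⇒≢ lt refl

      ev-w₀₁ : ev.⟦ w i₀ ⟧ K.≈ ev.⟦ w i₁ ⟧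
      ev-w₀₁ = balance i₁ i₀ i₂ (λ ()) (λ ()) (λ ()) diff₀ diff₁
        -- From `i₂` on, the collapsed values stay constant until the cycle returns to `i₀`.
        (≈-sym (chain (λ i → Hom.⟦_⟧ (collapse i₁) (h i)) 2 (λ i le → collapsed i₁ i (beyond i le)
          (next≢ i (λ ()) (ℕ.≤-trans (s≤s z≤n) le))) i₂ ℕ.≤-refl))

      ev-w₁₂ : ev.⟦ w i₁ ⟧ K.≈ ev.⟦ w i₂ ⟧
      ev-w₁₂ = balance i₂ i₁ i₃ (λ ()) (λ ()) (λ ()) diff₁ diff₂
        (≈-trans (≈-sym (≡.subst (λ k → c.⟦ h i₀ ⟧ ≈ c.⟦ h k ⟧) next-i₀ (collapsed i₂ i₀ (λ ()) (λ e → 1≢2 (≡.trans (≡.sym next-i₀) e)))))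
          (≈-sym (chain (λ i → c.⟦ h i ⟧) 3 (λ i le → collapsed i₂ i (beyond i le)
            (next≢ i (λ ()) (ℕ.≤-trans (s≤s (s≤s z≤n)) le))) i₃ ℕ.≤-refl)))
        where
        module c = Hom (collapse i₂)
        1≢2 : i₁ ≢ i₂
        1≢2 ()

    -- In `Q M₃ = z₀ N + z₁ N′`, the quotients of `N′` at the generic point are `- Q` along edge 0
    -- and zero along edge 2, whereas `Along` makes them equal.
    not-free : ¬ LogBasis L
    not-free B = ev-Q (K.trans (K.sym (KP.-‿involutive _)) (K.trans (K.-‿cong -Q≈0) KP.-0#≈0#))
      where
      module KP = RingProperties K.ring
      module B = LogBasis B
      f₁ f₂ f₃ : Fin B.rank → Carrier
      f₁ = proj₁ (B.span M₁.QM M₁.QM-log)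
      f₂ = proj₁ (B.span M₂.QM M₂.QM-log)
      f₃ = proj₁ (B.span M₃.QM M₃.QM-log)

      -- Independence of the basis turns the syzygy of the three derivations into one for each
      -- coefficient.
      relation : ∀ k → z₁ * f₂ k ≈ z₀ * f₁ k + z₂ * f₃ k
      relation k = x∙y⁻¹≈ε⇒x≈y _ _ (B.indep (λ k → z₁ * f₂ k - (z₀ * f₁ k + z₂ * f₃ k)) (λ i → begin
        ∑ (λ k → (z₁ * f₂ k - (z₀ * f₁ k + z₂ * f₃ k)) * B.basis k i)
          ≈⟨ ∑-cong (λ k → solve 7 (λ a b c f g h e → (b :* g :- (a :* f :+ c :* h)) :* e := b :* (g :* e) :+ ((:- a) :* (f :* e) :+ (:- c) :* (h :* e)))
               ≈-refl z₀ z₁ z₂ (f₁ k) (f₂ k) (f₃ k) (B.basis k i)) ⟩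
        ∑ (λ k → z₁ * (f₂ k * B.basis k i) + ((- z₀) * (f₁ k * B.basis k i) + (- z₂) * (f₃ k * B.basis k i)))
          ≈⟨ ≈-trans (∑-+ (λ k → z₁ * (f₂ k * B.basis k i)) _) (+-cong (∑-*ˡ z₁ (λ k → f₂ k * B.basis k i))
               (≈-trans (∑-+ (λ k → (- z₀) * (f₁ k * B.basis k i)) _) (+-cong (∑-*ˡ (- z₀) (λ k → f₁ k * B.basis k i)) (∑-*ˡ (- z₂) (λ k → f₃ k * B.basis k i))))) ⟩
        z₁ * ∑ (λ k → f₂ k * B.basis k i) + ((- z₀) * ∑ (λ k → f₁ k * B.basis k i) + (- z₂) * ∑ (λ k → f₃ k * B.basis k i))
          ≈⟨ +-cong (*-congˡ (≈-sym (e₂ i))) (+-cong (*-congˡ (≈-sym (e₁ i))) (*-congˡ (≈-sym (e₃ i)))) ⟩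
        z₁ * M₂.QM i + ((- z₀) * M₁.QM i + (- z₂) * M₃.QM i) ≈⟨ +-congʳ (syzygy i) ⟩
        (z₀ * M₁.QM i + z₂ * M₃.QM i) + ((- z₀) * M₁.QM i + (- z₂) * M₃.QM i)
          ≈⟨ solve 4 (λ a c extra n → (a :* extra :+ c :* n) :+ ((:- a) :* extra :+ (:- c) :* n) := (a :- a) :* extra) ≈-refl z₀ z₂ _ _ ⟩
        (z₀ - z₀) * M₁.QM i ≈⟨ ≈-trans (*-congʳ (-‿inverseʳ _)) (zeroˡ _) ⟩
        0# ∎) k)
        where
        e₁ : ∀ i → M₁.QM i ≈ ∑ (λ k → f₁ k * B.basis k i)
        e₁ = proj₂ (B.span M₁.QM M₁.QM-log)
        e₂ : ∀ i → M₂.QM i ≈ ∑ (λ k → f₂ k * B.basis k i)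
        e₂ = proj₂ (B.span M₂.QM M₂.QM-log)
        e₃ : ∀ i → M₃.QM i ≈ ∑ (λ k → f₃ k * B.basis k i)
        e₃ = proj₂ (B.span M₃.QM M₃.QM-log)

      P Q′ : Fin B.rank → Carrier
      P k = proj₁ (regular (f₁ k) (f₂ k) (f₃ k) (relation k))
      Q′ k = proj₁ (proj₂ (regular (f₁ k) (f₂ k) (f₃ k) (relation k)))

      N N′ : Fin ℓ → Carrier
      N i = ∑ (λ k → P k * B.basis k i)
      N′ i = ∑ (λ k → Q′ k * B.basis k i)

      module A = Along N (Log-comb P B.basis B.basis-log)
      module A′ = Along N′ (Log-comb Q′ B.basis B.basis-log)
      open A′ using (ev-w₀₁; ev-w₁₂)

      decomposition : ∀ u → M₃.QM u ≈ z₀ * N u + z₁ * N′ u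
      decomposition u = begin
        M₃.QM u ≈⟨ proj₂ (B.span M₃.QM M₃.QM-log) u ⟩
        ∑ (λ k → f₃ k * B.basis k u)
          ≈⟨ ∑-cong (λ k → ≈-trans (*-congʳ (proj₂ (proj₂ (regular (f₁ k) (f₂ k) (f₃ k) (relation k)))))
               (solve 5 (λ a b p q e → (a :* p :+ b :* q) :* e := a :* (p :* e) :+ b :* (q :* e)) ≈-refl z₀ z₁ (P k) (Q′ k) (B.basis k u))) ⟩
        ∑ (λ k → z₀ * (P k * B.basis k u) + z₁ * (Q′ k * B.basis k u))
          ≈⟨ ≈-trans (∑-+ (λ k → z₀ * (P k * B.basis k u)) _) (+-cong (∑-*ˡ z₀ (λ k → P k * B.basis k u)) (∑-*ˡ z₁ (λ k → Q′ k * B.basis k u))) ⟩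
        z₀ * N u + z₁ * N′ u ∎

      at-index : ∀ i → Q * Y (z₀ * z₁) 0# i ≈ z₀ * A.h i + z₁ * A′.h i
      at-index i = begin
        Q * Y (z₀ * z₁) 0# i ≈⟨ M₃.QM-v i ⟨
        ε i ▹ M₃.QM (vtx i) ≈⟨ ▹-cong (ε i) (decomposition (vtx i)) ⟩
        ε i ▹ (z₀ * N (vtx i) + z₁ * N′ (vtx i)) ≈⟨ distribute (ε i) _ _ _ _ ⟩
        z₀ * A.h i + z₁ * A′.h i ∎
        where
        distribute : ∀ s p q p′ q′ → s ▹ (p * q + p′ * q′) ≈ p * (s ▹ q) + p′ * (s ▹ q′)
        distribute plus p q p′ q′ = ≈-refl
        distribute minus p q p′ q′ = solve 4 (λ p q p′ q′ → :- (p :* q :+ p′ :* q′) := p :* (:- q) :+ p′ :* (:- q′)) ≈-refl p q p′ q′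

      difference : ∀ i j → Q * Y (z₀ * z₁) 0# i - Q * Y (z₀ * z₁) 0# j ≈ z₀ * (A.h i - A.h j) + z₁ * (A′.h i - A′.h j)
      difference i j = ≈-trans (+-cong (at-index i) (-‿cong (at-index j)))
        (solve 6 (λ a b p q p′ q′ → (a :* p :+ b :* q) :- (a :* p′ :+ b :* q′) := a :* (p :- p′) :+ b :* (q :- q′)) ≈-refl z₀ z₁ _ _ _ _)

      module s = Hom (σ i₀ i₁)

      s-z₀ : s.⟦ z₀ ⟧ ≈ 0#
      s-z₀ = ≈-trans (s.minus-homo _ _) (≈-trans (+-cong (σ-y i₀ i₁) (-‿cong (σ-other i₀ i₁ (λ ())))) (-‿inverseʳ _))

      s-z₁ : s.⟦ z₁ ⟧ ≈ z₁
      s-z₁ = ≈-trans (s.minus-homo _ _) (+-cong (σ-other i₀ i₁ (λ ())) (-‿cong (σ-other i₀ i₁ (λ ()))))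

      -- Reduction modulo `z₀` does not change values at the generic point, and it fixes `z₁`, which
      -- can then be cancelled.
      modulo-z₀ : ∀ {p q r} → z₀ * p + z₁ * q ≈ z₁ * r → ev.⟦ q ⟧ K.≈ ev.⟦ r ⟧
      modulo-z₀ {p} {q} {r} e = K.trans (K.sym (σ-ev i₀ i₁ q)) (K.trans (ev.⟦⟧-cong (NZD-cancel (NZD-z {i₁} {i₂} (λ ())) (begin
        z₁ * s.⟦ q ⟧ ≈⟨ *-congʳ s-z₁ ⟨
        s.⟦ z₁ ⟧ * s.⟦ q ⟧ ≈⟨ +-identityˡ _ ⟨
        0# + s.⟦ z₁ ⟧ * s.⟦ q ⟧ ≈⟨ +-cong (≈-sym (≈-trans (*-congʳ s-z₀) (zeroˡ _))) (≈-sym (s.*-homo _ _)) ⟩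
        s.⟦ z₀ ⟧ * s.⟦ p ⟧ + s.⟦ z₁ * q ⟧ ≈⟨ +-congʳ (s.*-homo _ _) ⟨
        s.⟦ z₀ * p ⟧ + s.⟦ z₁ * q ⟧ ≈⟨ s.+-homo _ _ ⟨
        s.⟦ z₀ * p + z₁ * q ⟧ ≈⟨ s.⟦⟧-cong e ⟩
        s.⟦ z₁ * r ⟧ ≈⟨ s.*-homo _ _ ⟩
        s.⟦ z₁ ⟧ * s.⟦ r ⟧ ≈⟨ *-congʳ s-z₁ ⟩
        z₁ * s.⟦ r ⟧ ∎))) (σ-ev i₀ i₁ r))

      ev-w′₂ : ev.⟦ A′.w i₂ ⟧ K.≈ K.0#
      ev-w′₂ = K.trans (modulo-z₀ {A.w i₂} {A′.w i₂} {0#} (≈-trans (NZD-z {i₂} {i₃} (λ ()) _ (begin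
        z₂ * (z₀ * A.w i₂ + z₁ * A′.w i₂)
          ≈⟨ solve 5 (λ a b c p q → c :* (a :* p :+ b :* q) := a :* (c :* p) :+ b :* (c :* q)) ≈-refl z₀ z₁ z₂ _ _ ⟩
        z₀ * (z₂ * A.w i₂) + z₁ * (z₂ * A′.w i₂) ≈⟨ +-cong (*-congˡ A.diff₂) (*-congˡ A′.diff₂) ⟨
        z₀ * (A.h i₂ - A.h i₃) + z₁ * (A′.h i₂ - A′.h i₃) ≈⟨ difference i₂ i₃ ⟨
        Q * 0# - Q * 0# ≈⟨ -‿inverseʳ _ ⟩
        0# ∎)) (≈-sym (zeroʳ z₁)))) ev.0-homo

      ev-w′₀ : ev.⟦ A′.w i₀ ⟧ K.≈ ev.⟦ - Q ⟧
      ev-w′₀ = modulo-z₀ {A.w i₀} {A′.w i₀} {(- Q)} (NZD-cancel (NZD-z {i₀} {i₁} (λ ())) (begin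
        z₀ * (z₀ * A.w i₀ + z₁ * A′.w i₀)
          ≈⟨ solve 4 (λ a b p q → a :* (a :* p :+ b :* q) := a :* (a :* p) :+ b :* (a :* q)) ≈-refl z₀ z₁ _ _ ⟩
        z₀ * (z₀ * A.w i₀) + z₁ * (z₀ * A′.w i₀) ≈⟨ +-cong (*-congˡ A.diff₀) (*-congˡ A′.diff₀) ⟨
        z₀ * (A.h i₀ - A.h i₁) + z₁ * (A′.h i₀ - A′.h i₁) ≈⟨ difference i₀ i₁ ⟨
        Q * 0# - Q * (z₀ * z₁) ≈⟨ ≈-trans (+-congʳ (zeroʳ _)) (+-identityˡ _) ⟩
        - (Q * (z₀ * z₁)) ≈⟨ solve 3 (λ q a b → :- (q :* (a :* b)) := a :* (b :* (:- q))) ≈-refl Q z₀ z₁ ⟩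
        z₀ * (z₁ * - Q) ∎))

      -Q≈0 : K.- ev.⟦ Q ⟧ K.≈ K.0#
      -Q≈0 = K.trans (K.sym (ev.-‿homo Q)) (K.trans (K.sym ev-w′₀) (K.trans ev-w₀₁ (K.trans ev-w₁₂ ev-w′₂)))

-- Switching functions, generic points, and the conclusion.

module GenericFlats where
  open import Data.Bool using (Bool; true; false; _∧_; _xor_; if_then_else_)
  open import Data.Nat as ℕ using (zero; suc; _+_; _≤_; _<_; _≤ᵇ_; _<ᵇ_; z≤n; s≤s)
  import Data.Nat.Properties as ℕ
  open import Data.Nat.Divisibility using (_∣?_)
  open import Data.Nat.ListAction using (sum)
  open import Data.Integer using (ℤ; -[1+_]) renaming (+_ to posℤ)
  import Data.Integer as ℤ
  import Data.Integer.Properties as ℤ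
  open import Data.Fin using (Fin; zero; suc; toℕ)
  import Data.Fin as Fin
  import Data.Fin.Properties as Fin
  open import Data.List using (tabulate)
  open import Data.List.Properties using (map-tabulate)
  open import Data.Product using (proj₁; proj₂)
  open import Data.Sum using (_⊎_; inj₁; inj₂)
  open import Data.Empty using (⊥-elim)
  open import Function using (_∘_)
  open import Relation.Nullary using (¬_; Dec; yes; no)
  open import Relation.Nullary.Decidable using (map′; _×-dec_; ¬?; decidable-stable)
  open import Relation.Binary.Definitions using (tri<; tri≈; tri>)
  open import Relation.Binary.PropositionalEquality using (_≡_; _≢_; refl; cong; cong₂; sym; trans; subst)
  import Algebra.Properties.Ring as RingProperties
  import Algebra.Properties.Semiring.Mult as SemiringMult
  open Signs
  open RingTools
  open PolynomialEvaluation
  open Forms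
  open VertexSets
  open BalancedCycles
  open Derivations
  open CycleObstruction

  ·-interchange : ∀ a b c d → (a · b) · (c · d) ≡ (a · c) · (b · d)
  ·-interchange a b c d = trans (·-assoc a b (c · d)) (trans (cong (a ·_) swap) (sym (·-assoc a c (b · d))))
    where
    swap : b · (c · d) ≡ c · (b · d)
    swap = trans (sym (·-assoc b c d)) (trans (cong (_· d) (·-comm b c)) (·-assoc c b d))

  signProduct : ∀ {n} → (Fin n → Sign) → (ℕ → Bool) → Sign
  signProduct {zero} s P = plus
  signProduct {suc n} s P = pick (P 0) (s zero) · signProduct (s ∘ suc) (P ∘ suc)

  parity-sum : ∀ {n} (s : Fin n → Sign) (P : ℕ → Bool) →
    parity (sum (tabulate (λ i → if P (toℕ i) ∧ isMinus (s i) then 1 else 0))) ≡ signProduct s P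
  parity-sum {zero} s P = refl
  parity-sum {suc n} s P = trans (parity-+ (if P 0 ∧ isMinus (s zero) then 1 else 0) _)
    (cong₂ _·_ (parity-if (P 0) (s zero)) (parity-sum (s ∘ suc) (P ∘ suc)))

  signProduct-cong : ∀ {n} (s : Fin n → Sign) {P Q : ℕ → Bool} → (∀ k → P k ≡ Q k) → signProduct s P ≡ signProduct s Q
  signProduct-cong {zero} s h = refl
  signProduct-cong {suc n} s h = cong₂ _·_ (cong (λ b → pick b (s zero)) (h 0)) (signProduct-cong (s ∘ suc) (h ∘ suc))

  pick-xor : ∀ b c s → pick b s · pick c s ≡ pick (b xor c) s
  pick-xor true true s = ·-self s
  pick-xor true false s = ·-identityʳ s
  pick-xor false c s = refl

  signProduct-xor : ∀ {n} (s : Fin n → Sign) P Q → signProduct s P · signProduct s Q ≡ signProduct s (λ k → P k xor Q k)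
  signProduct-xor {zero} s P Q = refl
  signProduct-xor {suc n} s P Q = trans (·-interchange (pick (P 0) (s zero)) _ _ _)
    (cong₂ _·_ (pick-xor (P 0) (Q 0) (s zero)) (signProduct-xor (s ∘ suc) (P ∘ suc) (Q ∘ suc)))

  signProduct-false : ∀ {n} (s : Fin n → Sign) → signProduct s (λ _ → false) ≡ plus
  signProduct-false {zero} s = refl
  signProduct-false {suc n} s = signProduct-false (s ∘ suc)

  signProduct-< : ∀ {n} (s : Fin n → Sign) → signProduct s (λ k → k <ᵇ n) ≡ signProduct s (λ _ → true)
  signProduct-< {zero} s = refl
  signProduct-< {suc n} s = cong (s zero ·_) (signProduct-< (s ∘ suc))

  signProduct-single : ∀ {n} (s : Fin n → Sign) i → signProduct s (λ k → (k <ᵇ toℕ i) xor (k <ᵇ suc (toℕ i))) ≡ s i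
  signProduct-single s zero = trans (cong (s zero ·_) (signProduct-false (s ∘ suc))) (·-identityʳ (s zero))
  signProduct-single s (suc i) = signProduct-single (s ∘ suc) i

  -- An arc is the symmetric difference of two initial arcs, which makes its sign `ε a · ε b`.
  arc-xor : ∀ a b → a ≤ b → ∀ k → ((a ≤ᵇ k) ∧ (k <ᵇ b)) ≡ ((k <ᵇ a) xor (k <ᵇ b))
  arc-xor zero b _ k = refl
  arc-xor (suc a) (suc b) (s≤s h) zero = refl
  arc-xor (suc a) (suc b) (s≤s h) (suc k) = trans (cong (_∧ (k <ᵇ b)) (≤ᵇ-suc a k)) (arc-xor a b h k)

  xor-notB : ∀ b → b xor notB b ≡ true
  xor-notB true = refl
  xor-notB false = refl

  module Switching {ℓ : ℕ} {G : SignedGraph ℓ} (C : Cycle G) (balanced : Balanced C) where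
    n : ℕ
    n = suc (m C)

    -- The switching function: the sign of the arc from vertex 0 to vertex `i`. Switching by it
    -- makes all cycle edges positive.
    ε : Fin n → Sign
    ε i = signProduct (s C) (λ k → k <ᵇ toℕ i)

    parity-negCount : ∀ (P : ℕ → Bool) → parity (negCount C (λ i → P (toℕ i))) ≡ signProduct (s C) P
    parity-negCount P = trans
      (cong (λ l → parity (sum l)) (map-tabulate {n = n} (λ i → i) (λ i → if P (toℕ i) ∧ isMinus (s C i) then 1 else 0)))
      (parity-sum (s C) P)

    total : signProduct (s C) (λ _ → true) ≡ plus
    total = trans (sym (parity-negCount (λ _ → true))) (2∣⇒parity balanced)

    -- Consecutive initial arcs differ by one edge. After the last edge the arc is the whole cycle,
    -- whose sign is plus by balance, as is that of the empty arc.
    ε-step : ∀ i → s C i ≡ ε i · ε (nextF i)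
    ε-step i = trans (sym (signProduct-single (s C) i)) (trans (sym (signProduct-xor (s C) (_<ᵇ toℕ i) (_<ᵇ suc (toℕ i)))) (cong (ε i ·_) next))
      where
      next : signProduct (s C) (λ k → k <ᵇ suc (toℕ i)) ≡ ε (nextF i)
      next with ℕ.m≤n⇒m<n∨m≡n (ℕ.≤-pred (Fin.toℕ<n i))
      ... | inj₁ lt = cong (λ j → signProduct (s C) (_<ᵇ j)) (sym (toℕ-nextF-< i lt))
      ... | inj₂ e = trans (cong (λ j → signProduct (s C) (_<ᵇ suc j)) e) (trans (signProduct-< (s C)) (trans total
          (sym (trans (cong (λ j → signProduct (s C) (_<ᵇ j)) (toℕ-nextF-last i e)) (signProduct-false (s C))))))

    arc : ∀ a b → toℕ a ≤ toℕ b → signProduct (s C) (λ k → (toℕ a ≤ᵇ k) ∧ (k <ᵇ toℕ b)) ≡ ε a · ε b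
    arc a b h = trans (signProduct-cong (s C) (arc-xor (toℕ a) (toℕ b) h)) (sym (signProduct-xor (s C) (_<ᵇ toℕ a) (_<ᵇ toℕ b)))

    -- The sign `ε a · ε b` is that of both arcs between the two vertices, so the edge is a balanced
    -- chord unless its ends are consecutive, possibly across index 0.
    chord-or-edge : ¬ BalancedChord C → ∀ a b → toℕ a < toℕ b → Edge G (ε a · ε b) (v C a) (v C b) → nextF a ≡ b ⊎ nextF b ≡ a
    chord-or-edge none a b a<b e with ℕ.m≤n⇒m<n∨m≡n a<b
    ... | inj₂ a+1≡b = inj₁ (Fin.toℕ-injective (trans (toℕ-nextF-< a (ℕ.<-≤-trans a<b (ℕ.≤-pred (Fin.toℕ<n b)))) a+1≡b))
    ... | inj₁ gap with toℕ a ℕ.≟ 0 ×-dec toℕ b ℕ.≟ m C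
    ... | yes (a≡0 , b≡m) = inj₂ (Fin.toℕ-injective (trans (toℕ-nextF-last b b≡m) (sym a≡0)))
    ... | no notWrap = ⊥-elim (none record
      { a = a ; b = b ; gap = ℕ.≤-trans (ℕ.≤-reflexive (ℕ.+-comm (toℕ a) 2)) gap ; notWrap = notWrap ; t = ε a · ε b ; chord = e
      ; bal₁ = parity⇒2∣ _ (balance (λ k → (toℕ a ≤ᵇ k) ∧ (k <ᵇ toℕ b)) inside)
      ; bal₂ = parity⇒2∣ _ (balance (λ k → notB ((toℕ a ≤ᵇ k) ∧ (k <ᵇ toℕ b))) outside) })
      where
      inside : signProduct (s C) (λ k → (toℕ a ≤ᵇ k) ∧ (k <ᵇ toℕ b)) ≡ ε a · ε b
      inside = arc a b (ℕ.<⇒≤ a<b)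
      outside : signProduct (s C) (λ k → notB ((toℕ a ≤ᵇ k) ∧ (k <ᵇ toℕ b))) ≡ ε a · ε b
      outside = sym (trans (sym inside) (·≡plus⇒≡ _ _ (trans (signProduct-xor (s C)
        (λ k → (toℕ a ≤ᵇ k) ∧ (k <ᵇ toℕ b)) (λ k → notB ((toℕ a ≤ᵇ k) ∧ (k <ᵇ toℕ b))))
        (trans (signProduct-cong (s C) (λ k → xor-notB ((toℕ a ≤ᵇ k) ∧ (k <ᵇ toℕ b)))) total))))
      balance : ∀ P → signProduct (s C) P ≡ ε a · ε b → parity (negCount C (λ i → P (toℕ i)) + signVal (ε a · ε b)) ≡ plus
      balance P h = trans (parity-+ (negCount C (λ i → P (toℕ i))) (signVal (ε a · ε b)))
        (trans (cong₂ _·_ (trans (parity-negCount P) h) (parity-signVal (ε a · ε b))) (·-self (ε a · ε b)))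

  -- The obstruction only refutes that there is no balanced chord; the finite search turns this into
  -- a chord.
  balancedChord? : ∀ {ℓ} {G : SignedGraph ℓ} (C : Cycle G) → (∀ s i j → Dec (Edge G s i j)) → Dec (BalancedChord C)
  balancedChord? {G = G} C edge? = map′
    (λ { (a , b , t , gap , wrap , e , b₁ , b₂) → record { a = a ; b = b ; gap = gap ; notWrap = wrap ; t = t ; chord = e ; bal₁ = b₁ ; bal₂ = b₂ } })
    (λ { record { a = a ; b = b ; gap = gap ; notWrap = wrap ; t = t ; chord = e ; bal₁ = b₁ ; bal₂ = b₂ } → a , b , t , gap , wrap , e , b₁ , b₂ })
    (Fin.any? λ a → Fin.any? λ b → anySign? λ t → (toℕ a + 2 ℕ.≤? toℕ b) ×-dec (¬? (toℕ a ℕ.≟ 0 ×-dec toℕ b ℕ.≟ m C) ×-dec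
      (edge? t (v C a) (v C b) ×-dec ((2 ∣? (negCount C (inArc a b) + signVal t)) ×-dec
        (2 ∣? (negCount C (λ i → notB (inArc a b i)) + signVal t))))))

  infixr 8 _▹ℤ_
  _▹ℤ_ : Sign → ℤ → ℤ
  plus ▹ℤ z = z
  minus ▹ℤ z = ℤ.- z

  unit : Sign → ℤ
  unit s = s ▹ℤ posℤ 1

  unit-· : ∀ s t u → unit s ≡ u ▹ℤ unit t → u ≡ s · t
  unit-· plus plus plus _ = refl
  unit-· plus minus minus _ = refl
  unit-· minus plus minus _ = refl
  unit-· minus minus plus _ = refl

  module GenericPoint {c ℓ′ : Level} (K : CommutativeRing c ℓ′) (field₀ : IsFieldChar0 K) {ℓ : ℕ} (G : SignedGraph ℓ) (sub : NegInPos G)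
    (C : Cycle G) (balanced : Balanced C) (none : ¬ BalancedChord C) where
    open Poly K using (var)
    open Evaluation K
    open PolynomialForms K field₀ ℓ
    open Switching C balanced
    private
      module K = CommutativeRing K
      Γ : Adjacency ℓ
      Γ = signedGraphAdjacency G sub
    open Graph Γ
    open IntegerSolver K using (fromℤ; fromℤ-+; fromℤ-neg)
    open SemiringMult K.semiring using () renaming (_×_ to _×ⁿ_)
    module KP = RingProperties K.ring

    identity : Hom K K
    identity = record
      { ⟦_⟧ = λ a → a ; ⟦⟧-cong = λ h → h ; +-homo = λ _ _ → K.refl ; *-homo = λ _ _ → K.refl ; 1-homo = K.refl }

    module EK = Evaluate K identity

    -- On the cycle the point is the switching function, elsewhere its coordinates
    -- are distinct integers ≥ 2.
    point : Fin ℓ → ℤ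
    point u with Fin.any? (λ i → v C i Fin.≟ u)
    ... | yes (i , _) = unit (ε i)
    ... | no _ = posℤ (2 + toℕ u)

    point-v : ∀ i → point (v C i) ≡ unit (ε i)
    point-v i with Fin.any? (λ j → v C j Fin.≟ v C i)
    ... | yes (j , e) = cong (unit ∘ ε) (v-inj C e)
    ... | no h = ⊥-elim (h (i , refl))

    coords : Fin ℓ → K.Carrier
    coords u = fromℤ (point u)

    ev : Hom (PolyRing ℓ) K
    ev = EK.evalHom coords

    natK≈ : ∀ k → k ×ⁿ K.1# K.≈ natK K k
    natK≈ zero = K.refl
    natK≈ (suc k) = K.+-congˡ (natK≈ k)

    fromℤ≉0 : ∀ z → z ≢ posℤ 0 → ¬ (fromℤ z K.≈ K.0#)
    fromℤ≉0 (posℤ zero) h _ = h refl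
    fromℤ≉0 (posℤ (suc k)) h e = proj₂ (proj₂ field₀) k (K.trans (K.sym (natK≈ (suc k))) e)
    fromℤ≉0 -[1+ k ] h e = proj₂ (proj₂ field₀) k (K.trans (K.sym (natK≈ (suc k)))
      (K.trans (K.sym (KP.-‿involutive _)) (K.trans (K.-‿cong e) KP.-0#≈0#)))

    open LinearForms polynomialForms using (_▹_; ρ; _-_)

    ev-var : ∀ i → Hom.⟦_⟧ ev (var i) K.≈ coords i
    ev-var i = EK.eval-var coords i

    ev-▹ : ∀ s p z → Hom.⟦_⟧ ev p K.≈ fromℤ z → Hom.⟦_⟧ ev (s ▹ p) K.≈ fromℤ (s ▹ℤ z)
    ev-▹ plus p z h = h
    ev-▹ minus p z h = K.trans (Hom.-‿homo ev p) (K.trans (K.-‿cong h) (K.sym (fromℤ-neg z)))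

    ev-eval : ∀ e → (∀ i → Hom.⟦_⟧ ev (e i) K.≈ Hom.⟦_⟧ ev (var i)) → ∀ p → Hom.⟦_⟧ ev (Id.eval ℓ e p) K.≈ Hom.⟦_⟧ ev p
    ev-eval e h p = K.trans (N.eval-hom e p) (EK.eval-ext (λ i → K.trans (h i) (ev-var i)) p)
      where module N = Naturality (PolyRing ℓ) K (constHom ℓ) identity ev (EK.eval-const coords)

    ev-assign : ∀ u r → Hom.⟦_⟧ ev r K.≈ Hom.⟦_⟧ ev (var u) → ∀ i → Hom.⟦_⟧ ev (assign u r i) K.≈ Hom.⟦_⟧ ev (var i)
    ev-assign u r h i with i Fin.≟ u
    ... | yes refl = h
    ... | no _ = K.refl

    integral : ∀ {p q} → ¬ (p K.≈ K.0#) → ¬ (q K.≈ K.0#) → ¬ (p K.* q K.≈ K.0#)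
    integral {p} {q} hp hq e = hq (RingKit.NZD-unit K (proj₂ (proj₁ (proj₂ field₀) p hp)) q e)

    -- Vanishing is decided on integers, and characteristic zero carries non-vanishing over to `K`.
    generic : ∀ {s i j} → point i ≢ s ▹ℤ point j → ¬ (Hom.⟦_⟧ ev (var i - s ▹ var j) K.≈ K.0#)
    generic {s} {i} {j} h e = fromℤ≉0 (point i ℤ.- s ▹ℤ point j) (λ z → h (ℤ.i-j≡0⇒i≡j (point i) (s ▹ℤ point j) z))
      (K.trans (fromℤ-+ (point i) _) (K.trans (K.+-cong (K.sym (ev-var i)) (K.trans (fromℤ-neg (s ▹ℤ point j))
        (K.-‿cong (K.sym (ev-▹ s (var j) (point j) (ev-var j)))))) (K.trans (K.sym (Hom.minus-homo ev (var i) (s ▹ var j))) e)))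

    loop-free : ∀ {i} → point i ≢ minus ▹ℤ point i
    loop-free {i} with Fin.any? (λ j → v C j Fin.≟ i)
    ... | no _ = λ ()
    ... | yes (j , _) with ε j
    ...   | plus = λ ()
    ...   | minus = λ ()

    Contained : Sign → Fin ℓ → Fin ℓ → Set
    Contained s i j = Σ (Fin n) λ k → s ≡ ε k · ε (nextF k) × ((i ≡ v C k × j ≡ v C (nextF k)) ⊎ (j ≡ v C k × i ≡ v C (nextF k)))

    contained-< : ∀ a b → toℕ a < toℕ b → Edge G (ε a · ε b) (v C a) (v C b) → Contained (ε a · ε b) (v C a) (v C b)
    contained-< a b lt e with chord-or-edge none a b lt e
    ... | inj₁ refl = a , refl , inj₁ (refl , refl)
    ... | inj₂ refl = b , ·-comm (ε (nextF b)) (ε b) , inj₂ (refl , refl)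

    contained-sym : ∀ {s i j} → Contained s i j → Contained s j i
    contained-sym (k , e , inj₁ p) = k , e , inj₂ p
    contained-sym (k , e , inj₂ p) = k , e , inj₁ p

    -- Coordinates off the cycle are distinct integers at least 2 and those on it are units, so the
    -- form of an edge can vanish only if both ends are on the cycle. The edge then has sign
    -- `ε a · ε b`, and without balanced chords it is a cycle edge.
    contained : ∀ {s i j} → Edge G s i j → point i ≡ s ▹ℤ point j → Contained s i j
    contained {s} {i} {j} e h with Fin.any? (λ a → v C a Fin.≟ i) | Fin.any? (λ b → v C b Fin.≟ j)
    contained {plus} {i} {j} e h | no _ | no _ =
      ⊥-elim (E-irrefl {plus} e (Fin.toℕ-injective (ℕ.suc-injective (ℕ.suc-injective (ℤ.+-injective h)))))
    contained {minus} {i} {j} e () | no _ | no _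
    contained {s} {i} {j} e h | yes (a , _) | no _ = ⊥-elim (small (ε a) s h)
      where
      small : ∀ t s → unit t ≢ s ▹ℤ posℤ (2 + toℕ j)
      small plus plus ()
      small plus minus ()
      small minus plus ()
      small minus minus ()
    contained {s} {i} {j} e h | no _ | yes (b , _) = ⊥-elim (small (ε b) s h)
      where
      small : ∀ t s → posℤ (2 + toℕ i) ≢ s ▹ℤ unit t
      small plus plus ()
      small plus minus ()
      small minus plus ()
      small minus minus ()
    contained {s} {i} {j} e h | yes (a , refl) | yes (b , refl) with unit-· (ε a) (ε b) s h
    ... | refl with ℕ.<-cmp (toℕ a) (toℕ b)
    ... | tri< lt _ _ = contained-< a b lt e
    ... | tri≈ _ eq _ = ⊥-elim (E-irrefl {ε a · ε b} e (cong (v C) (Fin.toℕ-injective eq)))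
    ... | tri> _ _ gt = subst (λ t → Contained t (v C a) (v C b)) (·-comm (ε b) (ε a))
      (contained-sym (contained-< b a gt (subst (λ t → Edge G t (v C b) (v C a)) (·-comm (ε a) (ε b)) (E-sym {ε a · ε b} e))))

    ev-y : ∀ i → Hom.⟦_⟧ ev (ρ (v C i , ε i)) K.≈ fromℤ (posℤ 1)
    ev-y i = K.trans (ev-▹ (ε i) (var (v C i)) (point (v C i)) (ev-var (v C i)))
      (K.reflexive (cong fromℤ (trans (cong (ε i ▹ℤ_) (point-v i)) (twice (ε i)))))
      where
      twice : ∀ s → s ▹ℤ unit s ≡ posℤ 1
      twice plus = refl
      twice minus = refl

  cycleFlat : ∀ {c ℓ′} (K : CommutativeRing c ℓ′) (field₀ : IsFieldChar0 K) {ℓ} (G : SignedGraph ℓ) (sub : NegInPos G)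
    (C : Cycle G) → Balanced C → 4 ≤ len C → ¬ BalancedChord C →
    CycleFlat (PolynomialForms.polynomialForms K field₀ ℓ) (signedGraphAdjacency G sub) K
  -- The length is `suc m`, so beyond the four named vertices there are `k` more.
  cycleFlat K field₀ {ℓ} G sub C@(record { m = suc (suc (suc k)) }) balanced (s≤s (s≤s (s≤s (s≤s z≤n)))) none = record
    { subst = Id.evalHom ℓ
    ; subst-x = Id.eval-var ℓ
    ; ev = ev
    ; ev-subst = ev-eval
    ; ev-≔ = λ u r h → ev-eval (assign u r) (ev-assign u r h)
    ; 1≉0 = proj₁ field₀
    ; integral = integral
    ; extra = k
    ; vtx = v C
    ; vtx-injective = v-inj C
    ; ε = ε
    ; cycle-edge = λ i → subst (λ t → Edge G t (v C i) (v C (nextF i))) (ε-step i) (edges C i)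
    ; ev-flat = λ i j → CommutativeRing.trans K (ev-y i) (CommutativeRing.sym K (ev-y j))
    ; Contains = λ s i j → point i ≡ s ▹ℤ point j
    ; contains? = λ s i j → point i ℤ.≟ s ▹ℤ point j
    ; generic = λ {s} {i} {j} → generic {s} {i} {j}
    ; contains-loop = λ {i} → loop-free {i}
    ; contains-edge = contained }
    where
    open Evaluation K
    open PolynomialForms K field₀ ℓ
    open Switching C balanced
    open GenericPoint K field₀ G sub C balanced none

  free⇒balancedChordal : ∀ {c ℓ′} (K : CommutativeRing c ℓ′) (field₀ : IsFieldChar0 K) {ℓ} (G : SignedGraph ℓ) → NegInPos G →
    ∀ L → Poly.Free K G L → BalancedChordal G
  free⇒balancedChordal K field₀ {ℓ} G sub L free C balanced 4≤len = decidable-stable (balancedChord? C (Adjacency.E? Γ)) λ none →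
    NonFreeness.not-free polynomialForms Γ K (cycleFlat K field₀ G sub C balanced 4≤len none) L (free⇒logBasis G sub free)
    where
    open PolynomialForms K field₀ ℓ
    Γ : Adjacency ℓ
    Γ = signedGraphAdjacency G sub

open Derivations
open GenericFlats

theorem1p4 : {c ℓ′ : Level} (K : CommutativeRing c ℓ′) → IsFieldChar0 K →
    (ℓ : ℕ) (G : SignedGraph ℓ) → NegInPos G →
    (BalancedChordal G ⇔ Poly.Free K G allLoops) ×
    (Poly.Free K G allLoops ⇔ Σ (LoopSet ℓ) (λ L → Poly.Free K G L))
theorem1p4 K field₀ ℓ G sub =
  mk⇔ toFree (free⇒balancedChordal K field₀ G sub allLoops) ,
  -- Freeness for some loop set passes through balanced chordality to freeness for all loops.
  mk⇔ (allLoops ,_) (λ { (L , free) → toFree (free⇒balancedChordal K field₀ G sub L free) })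
  where
  toFree : BalancedChordal G → Poly.Free K G allLoops
  toFree = PolynomialForms.balancedChordal⇒free K field₀ ℓ G sub
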